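{- For every integer $n\ge 0$, \[ N^{0}(0,8;8n+r)=N^{0}(4,8;8n+r)\quad (r\in\{5,7\}),\qquad N^{0}(1,8;8n+r)=N^{0}(3,8;8n+r)\quad (r\in\{4,6\}). \]
   Context: An odd Durfee symbol of a positive integer $n$ consists of a nonnegative integer $D$ together with two (possibly empty) non-increasing sequences of odd positive integers $a_1\ge\cdots\ge a_s$ (top row) and $b_1\ge\cdots\ge b_t$ (bottom row), all entries at most $2D+1$, such that $n=\sum a_i+\sum b_j+2D^2+2D+1$. Its odd rank is $s-t$. For integers $a$ and $M\ge1$, $N^{0}(a,M;n)$ is the number of odd Durfee symbols of $n$ whose odd rank is congruent to $a$ modulo $M$ (and $N^0(a,M;0)=0$). -}

module Defs where

open import Data.Nat using (ℕ; zero; suc; _+_; _*_; _≤_; _≥_; _≟_; _≤?_; _≥?_; NonZero)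
import Data.Nat.Properties as ℕP
open import Data.Nat.DivMod using (_%_)
open import Data.Integer as ℤ using (ℤ; +_)
open import Data.Integer.DivMod using (_%ℕ_)
open import Data.Nat.ListAction using (sum)
open import Data.List using (List; []; _∷_; length; map; concatMap; filter; upTo)
open import Data.List.Relation.Unary.All using (All; all?)
open import Data.List.Relation.Unary.Linked using (Linked; linked?)
open import Data.Product using (_×_; _,_; proj₁; proj₂)
open import Relation.Binary.PropositionalEquality using (_≡_)
open import Relation.Nullary using (Dec)
open import Relation.Nullary.Decidable using (_×-dec_)

-- A candidate odd Durfee symbol: (D , top row , bottom row).
Symbol : Set
Symbol = ℕ × List ℕ × List ℕ

OddPos : ℕ → Set
OddPos k = k % 2 ≡ 1

ValidRow : ℕ → List ℕ → Set
ValidRow D xs = Linked _≥_ xs × All OddPos xs × All (λ x → x ≤ 2 * D + 1) xs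

IsOddDurfeeSymbol : ℕ → Symbol → Set
IsOddDurfeeSymbol n (D , as , bs) =
  ValidRow D as × ValidRow D bs ×
  (n ≡ sum as + sum bs + 2 * D * D + 2 * D + 1)

oddRank : Symbol → ℤ
oddRank (D , as , bs) = + length as ℤ.- + length bs

validRow? : ∀ D xs → Dec (ValidRow D xs)
validRow? D xs =
  linked? (λ x y → y ≤? x) xs ×-dec
  (all? (λ x → x % 2 ≟ 1) xs ×-dec all? (λ x → x ≤? 2 * D + 1) xs)

isOddDurfeeSymbol? : ∀ n σ → Dec (IsOddDurfeeSymbol n σ)
isOddDurfeeSymbol? n (D , as , bs) =
  validRow? D as ×-dec (validRow? D bs ×-dec
  (n ≟ sum as + sum bs + 2 * D * D + 2 * D + 1))

listsOfLength : ℕ → ℕ → List (List ℕ)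
listsOfLength m zero = [] ∷ []
listsOfLength m (suc k) =
  concatMap (λ x → map (x ∷_) (listsOfLength m k)) (upTo (suc m))

smallLists : ℕ → List (List ℕ)
smallLists m = concatMap (listsOfLength m) (upTo (suc m))

-- A duplicate-free finite list of symbols containing every odd Durfee
-- symbol of n (each row of a symbol of n has length ≤ n and entries ≤ n,
-- and D ≤ n), so that filtering it gives exactly the odd Durfee symbols of n.
candidates : ℕ → List Symbol
candidates n =
  concatMap (λ D → concatMap (λ as → map (λ bs → (D , as , bs)) (smallLists n))
                               (smallLists n))
            (upTo (suc n))

RankCong : ℤ → (M : ℕ) → .{{NonZero M}} → Symbol → Set
RankCong a M σ = oddRank σ %ℕ M ≡ a %ℕ M

-- N⁰(a, M; n): number of odd Durfee symbols of n with odd rank ≡ a (mod M).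
-- (For n = 0 there are none, since 2D²+2D+1 ≥ 1, so N⁰(a,M;0) = 0.)
N0 : ℤ → (M : ℕ) → .{{NonZero M}} → ℕ → ℕ
N0 a M n =
  length (filter (λ σ → oddRank σ %ℕ M ≟ a %ℕ M)
                 (filter (isOddDurfeeSymbol? n) (candidates n)))

{-# OPTIONS --safe #-}

-- Write q = Q². By the q-Vandermonde identity the odd Durfee symbols of odd rank m are counted by
-- Q · Q^|m| φ_|m|, where φₘ = ∑ₖ qᵏ [m+2k choose k]. The two Pascal rules give φₘ + q^{m+3} φ_{m+3} = p
-- with p = 1/∏(1-qⁱ); after setting φ₋ₘ = qᵐ φₘ this is a reflection φᵢ + φ₋₃₋ᵢ = p - δᵢ on ℤ.
-- It remains to see that A₀ = ∑ w₀(m) Q^|m| φ_|m| and A₁ = ∑ w₁(m) Q^|m| φ_|m|, for two even weights of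
-- antiperiod 4, vanish at the exponents ≡ 4, 6 and ≡ 3, 5 (mod 8) respectively.
--
-- Convolving φ with an alternating theta series ∑ (-1)ᵏ Q^{sk²} turns the reflection into a recursion in m,
-- because p is killed by the antisymmetry k ↦ 1-k. For s = 4, on the exponents ≡ 0, 1 (mod 4), the recursion
-- has the solution Q^{m²} C, and C is found by summing over m. With θ = ∑ Q^{4l²} and ψ = ∑ Q^{n(n+1)} this
-- gives (A₀ or A₁) · θ ψ ∏(1-qⁱ) explicitly, and Gauss' identities show that θ ψ ∏(1-qⁱ) is a series in Q⁸:
-- hence the classes 4 for A₀ and 5 for A₁. For s = 1 the recursion shows that a combination 2 Θ₀ A₀ + Θ₁ A₁
-- is supported on the exponents ≡ 0, 2 (mod 8), which yields the classes 6 for A₀ and 3 for A₁.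

module Submission where

open import Defs
open import Algebra.Bundles using (CommutativeRing)
open import Algebra.Solver.Ring.AlmostCommutativeRing using (fromCommutativeRing; _-Raw-AlmostCommutative⟶_)
import Algebra.Solver.Ring as RingSolver
open import Data.Bool using (true; false; if_then_else_)
open import Data.Empty using (⊥-elim)
open import Data.Integer using (ℤ; +_; -[1+_]; ∣_∣) renaming (_+_ to _+ᶻ_; _*_ to _*ᶻ_; -_ to -ᶻ_; _-_ to _-ᶻ_)
import Data.Integer as ℤ
open import Data.Integer.DivMod using (_%ℕ_)
import Data.Integer.Properties as ℤP
import Data.Integer.Tactic.RingSolver as ℤR
open import Data.List using (List; []; _∷_; _++_; length; map; concatMap; filter; upTo; applyUpTo)
open import Data.List.Relation.Unary.All using (All; []; _∷_)
import Data.List.Relation.Unary.All as All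
open import Data.List.Relation.Unary.Linked using (Linked; []; [-]; _∷_)
import Data.List.Relation.Unary.Linked as Linked
open import Data.List.Relation.Unary.Linked.Properties using (Linked⇒All)
open import Data.Maybe using (Maybe; just; nothing)
open import Data.Nat using (ℕ; zero; suc; _+_; _*_; _∸_; _≤_; _<_; _≥_; z≤n; s≤s; _⊔_; NonZero)
open import Data.Nat.DivMod using (_%_; _/_)
import Data.Nat.DivMod as DivMod
open import Data.Nat.ListAction using (sum)
open import Data.Nat.Properties using (*-assoc; *-comm; *-identityˡ; *-monoʳ-<; *-monoʳ-≤; *-suc; *-zeroʳ; +-assoc; +-cancelʳ-≤; +-comm; +-identityʳ; +-mono-<-≤; +-mono-≤; +-monoʳ-≤; +-monoˡ-<; +-monoˡ-≤; +-suc; +-∸-assoc; <-irrefl; <-≤-trans; _<?_; <⇒≤; <⇒≱; m+[n∸m]≡n; m+n∸n≡m; m+n≤o⇒n≤o; m∸n+n≡m; m≤m*n; m≤m+n; m≤m⊔n; m≤n*m; m≤n+m; m≤n⇒m<n∨m≡n; m≤n⇒m≤1+n; m≤n⇒m⊔n≡n; m≤n⊔m; m≥n⇒m⊔n≡m; n<1+n; n∸n≡0; n≢0⇒n>0; n≤0⇒n≡0; n≤1+n; suc-injective; _≟_; ≤-<-trans; ≤-pred; ≤-refl; ≤-reflexive; ≤-total; ≤-trans; _≤?_; ≤∧≢⇒<; ≮⇒≥; ≰⇒>; ⊔-lub; module ≤-Reasoning)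
import Data.Nat.Tactic.RingSolver as ℕR
open import Data.Product using (_×_; _,_; proj₁; proj₂; ∃)
open import Data.Sum using (_⊎_; inj₁; inj₂; [_,_]′)
open import Function using (_∘_; case_of_)
open import Level using (0ℓ)
open import Relation.Binary.PropositionalEquality using (_≡_; _≢_; refl; sym; trans; cong; cong₂; subst; module ≡-Reasoning)
import Relation.Binary.Reasoning.Setoid as SetoidReasoning
open import Relation.Nullary using (¬_; Dec; yes; no; does)
open import Relation.Nullary.Decidable using (_×-dec_)

-- Formal power series over ℤ

Series : Set
Series = ℕ → ℤ

infix 4 _≈_
record _≈_ (f g : Series) : Set where
  constructor mk≈
  field at : ∀ n → f n ≡ g n
open _≈_

infixl 6 _⊕_ _⊖_
infixl 7 _⊛_
infix 8 ⊝_

tail : Series → Series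
tail f n = f (suc n)

const : ℤ → Series
const c zero    = c
const c (suc n) = + 0

𝟘 𝟙 : Series
𝟘 = const (+ 0)
𝟙 = const (+ 1)

≈-refl : ∀ {f} → f ≈ f
≈-refl = mk≈ λ _ → refl

≈-sym : ∀ {f g} → f ≈ g → g ≈ f
≈-sym e = mk≈ λ n → sym (at e n)

≈-trans : ∀ {f g h} → f ≈ g → g ≈ h → f ≈ h
≈-trans d e = mk≈ λ n → trans (at d n) (at e n)

≡⇒≈ : ∀ {f g} → f ≡ g → f ≈ g
≡⇒≈ refl = ≈-refl

𝟘-at : ∀ n → 𝟘 n ≡ + 0
𝟘-at zero    = refl
𝟘-at (suc n) = refl

opaque
  _⊕_ : Series → Series → Series
  (f ⊕ g) n = f n +ᶻ g n

  ⊝_ : Series → Series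
  (⊝ f) n = -ᶻ f n

  _⊛_ : Series → Series → Series
  (f ⊛ g) zero    = f 0 *ᶻ g 0
  (f ⊛ g) (suc n) = f 0 *ᶻ g (suc n) +ᶻ (tail f ⊛ g) n

  X : ℕ → Series
  X zero    n       = 𝟙 n
  X (suc a) zero    = + 0
  X (suc a) (suc n) = X a n

  ⊛-cong : ∀ {f f′ g g′} → f ≈ f′ → g ≈ g′ → f ⊛ g ≈ f′ ⊛ g′
  ⊛-cong d e = mk≈ (go d e)
    where
    go : ∀ {f f′ g g′} → f ≈ f′ → g ≈ g′ → ∀ n → (f ⊛ g) n ≡ (f′ ⊛ g′) n
    go d e zero    = cong₂ _*ᶻ_ (at d 0) (at e 0)
    go d e (suc n) = cong₂ _+ᶻ_ (cong₂ _*ᶻ_ (at d 0) (at e (suc n))) (go (mk≈ λ k → at d (suc k)) e n)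

  ⊕-cong : ∀ {f f′ g g′} → f ≈ f′ → g ≈ g′ → f ⊕ g ≈ f′ ⊕ g′
  ⊕-cong d e = mk≈ λ n → cong₂ _+ᶻ_ (at d n) (at e n)

  ⊝-cong : ∀ {f g} → f ≈ g → ⊝ f ≈ ⊝ g
  ⊝-cong d = mk≈ λ n → cong -ᶻ_ (at d n)

  ⊛-suc : ∀ f g n → (f ⊛ g) (suc n) ≡ (f ⊛ tail g) n +ᶻ f (suc n) *ᶻ g 0
  ⊛-suc f g zero    = refl
  ⊛-suc f g (suc n) = trans (cong (f 0 *ᶻ g (suc (suc n)) +ᶻ_) (⊛-suc (tail f) g n))
                            (sym (ℤP.+-assoc (f 0 *ᶻ g (suc (suc n))) _ _))

  ⊛-comm : ∀ f g → f ⊛ g ≈ g ⊛ f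
  ⊛-comm f g = mk≈ (go f g)
    where
    go : ∀ f g n → (f ⊛ g) n ≡ (g ⊛ f) n
    go f g zero    = ℤP.*-comm (f 0) (g 0)
    go f g (suc n) = trans (cong₂ _+ᶻ_ (ℤP.*-comm (f 0) (g (suc n))) (go (tail f) g n))
                     (trans (ℤP.+-comm (g (suc n) *ᶻ f 0) _) (sym (⊛-suc g f n)))

  ⊛-distribʳ : ∀ h f g → (f ⊕ g) ⊛ h ≈ f ⊛ h ⊕ g ⊛ h
  ⊛-distribʳ h f g = mk≈ (go f g)
    where
    go : ∀ f g n → ((f ⊕ g) ⊛ h) n ≡ (f ⊛ h ⊕ g ⊛ h) n
    go f g zero    = ℤP.*-distribʳ-+ (h 0) (f 0) (g 0)
    go f g (suc n) = trans (cong ((f 0 +ᶻ g 0) *ᶻ h (suc n) +ᶻ_) (go (tail f) (tail g) n))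
                           (lem (f 0) (g 0) (h (suc n)) ((tail f ⊛ h) n) ((tail g ⊛ h) n))
      where
      lem : ∀ a b c d e → (a +ᶻ b) *ᶻ c +ᶻ (d +ᶻ e) ≡ (a *ᶻ c +ᶻ d) +ᶻ (b *ᶻ c +ᶻ e)
      lem = ℤR.solve-∀

  scale-⊛ : ∀ c f g n → ((λ k → c *ᶻ f k) ⊛ g) n ≡ c *ᶻ (f ⊛ g) n
  scale-⊛ c f g zero    = ℤP.*-assoc c (f 0) (g 0)
  scale-⊛ c f g (suc n) = trans (cong (c *ᶻ f 0 *ᶻ g (suc n) +ᶻ_) (scale-⊛ c (tail f) g n))
                                (lem c (f 0) (g (suc n)) ((tail f ⊛ g) n))
    where
    lem : ∀ a b c d → a *ᶻ b *ᶻ c +ᶻ a *ᶻ d ≡ a *ᶻ (b *ᶻ c +ᶻ d)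
    lem = ℤR.solve-∀

  ⊛-assoc : ∀ f g h → f ⊛ g ⊛ h ≈ f ⊛ (g ⊛ h)
  ⊛-assoc f g h = mk≈ (go f)
    where
    go : ∀ f n → (f ⊛ g ⊛ h) n ≡ (f ⊛ (g ⊛ h)) n
    go f zero    = ℤP.*-assoc (f 0) (g 0) (h 0)
    go f (suc n) = trans (cong (f 0 *ᶻ g 0 *ᶻ h (suc n) +ᶻ_)
                     (trans (at (⊛-distribʳ h (λ k → f 0 *ᶻ tail g k) (tail f ⊛ g)) n)
                            (cong₂ _+ᶻ_ (scale-⊛ (f 0) (tail g) h n) (go (tail f) n))))
                   (lem (f 0) (g 0) (h (suc n)) ((tail g ⊛ h) n) ((tail f ⊛ (g ⊛ h)) n))
      where
      lem : ∀ a b c d e → a *ᶻ b *ᶻ c +ᶻ (a *ᶻ d +ᶻ e) ≡ a *ᶻ (b *ᶻ c +ᶻ d) +ᶻ e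
      lem = ℤR.solve-∀

  𝟘-⊛ : ∀ f g → (∀ n → f n ≡ + 0) → ∀ n → (f ⊛ g) n ≡ + 0
  𝟘-⊛ f g z zero    = cong (_*ᶻ g 0) (z 0)
  𝟘-⊛ f g z (suc n) = cong₂ _+ᶻ_ (cong (_*ᶻ g (suc n)) (z 0)) (𝟘-⊛ (tail f) g (z ∘ suc) n)

  const-⊛ : ∀ c g n → (const c ⊛ g) n ≡ c *ᶻ g n
  const-⊛ c g zero    = refl
  const-⊛ c g (suc n) = trans (cong (c *ᶻ g (suc n) +ᶻ_) (𝟘-⊛ (tail (const c)) g (λ _ → refl) n)) (ℤP.+-identityʳ _)

  ⊛-identityˡ : ∀ f → 𝟙 ⊛ f ≈ f
  ⊛-identityˡ f = mk≈ λ n → trans (const-⊛ (+ 1) f n) (ℤP.*-identityˡ (f n))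

  ⊕-assoc : ∀ f g h → f ⊕ g ⊕ h ≈ f ⊕ (g ⊕ h)
  ⊕-assoc f g h = mk≈ λ n → ℤP.+-assoc (f n) (g n) (h n)

  ⊕-comm : ∀ f g → f ⊕ g ≈ g ⊕ f
  ⊕-comm f g = mk≈ λ n → ℤP.+-comm (f n) (g n)

  ⊕-identityˡ : ∀ f → 𝟘 ⊕ f ≈ f
  ⊕-identityˡ f = mk≈ λ n → trans (cong (_+ᶻ f n) (𝟘-at n)) (ℤP.+-identityˡ (f n))

  ⊕-inverseˡ : ∀ f → ⊝ f ⊕ f ≈ 𝟘
  ⊕-inverseˡ f = mk≈ λ n → trans (ℤP.+-inverseˡ (f n)) (sym (𝟘-at n))

  ⊕-at : ∀ f g n → (f ⊕ g) n ≡ f n +ᶻ g n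
  ⊕-at f g n = refl

  ⊝-at : ∀ f n → (⊝ f) n ≡ -ᶻ f n
  ⊝-at f n = refl

  const-+ : ∀ x y → const (x +ᶻ y) ≈ const x ⊕ const y
  const-+ x y = mk≈ λ { zero → refl ; (suc n) → refl }

  const-neg : ∀ x → const (-ᶻ x) ≈ ⊝ const x
  const-neg x = mk≈ λ { zero → refl ; (suc n) → refl }

  const-* : ∀ x y → const (x *ᶻ y) ≈ const x ⊛ const y
  const-* x y = mk≈ λ n → trans (lem n) (sym (const-⊛ x (const y) n))
    where
    lem : ∀ n → const (x *ᶻ y) n ≡ x *ᶻ const y n
    lem zero    = refl
    lem (suc n) = sym (ℤP.*-zeroʳ x)

_⊖_ : Series → Series → Series
f ⊖ g = f ⊕ ⊝ g

⊕-congˡ : ∀ {f g g′} → g ≈ g′ → f ⊕ g ≈ f ⊕ g′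
⊕-congˡ = ⊕-cong ≈-refl

⊛-congˡ : ∀ {f g g′} → g ≈ g′ → f ⊛ g ≈ f ⊛ g′
⊛-congˡ = ⊛-cong ≈-refl

⊖-cong : ∀ {f f′ g g′} → f ≈ f′ → g ≈ g′ → f ⊖ g ≈ f′ ⊖ g′
⊖-cong d e = ⊕-cong d (⊝-cong e)

seriesRing : CommutativeRing 0ℓ 0ℓ
seriesRing = record
  { Carrier = Series ; _≈_ = _≈_ ; _+_ = _⊕_ ; _*_ = _⊛_ ; -_ = ⊝_ ; 0# = 𝟘 ; 1# = 𝟙
  ; isCommutativeRing = record
    { isRing = record
      { +-isAbelianGroup = record
        { isGroup = record
          { isMonoid = record
            { isSemigroup = record
              { isMagma = record
                { isEquivalence = record { refl = ≈-refl ; sym = ≈-sym ; trans = ≈-trans }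
                ; ∙-cong = ⊕-cong }
              ; assoc = ⊕-assoc }
            ; identity = ⊕-identityˡ , λ f → ≈-trans (⊕-comm f 𝟘) (⊕-identityˡ f) }
          ; inverse = ⊕-inverseˡ , λ f → ≈-trans (⊕-comm f (⊝ f)) (⊕-inverseˡ f)
          ; ⁻¹-cong = ⊝-cong }
        ; comm = ⊕-comm }
      ; *-cong = ⊛-cong
      ; *-assoc = ⊛-assoc
      ; *-identity = ⊛-identityˡ , λ f → ≈-trans (⊛-comm f 𝟙) (⊛-identityˡ f)
      ; distrib = (λ f g h → ≈-trans (⊛-comm f (g ⊕ h)) (≈-trans (⊛-distribʳ f g h) (⊕-cong (⊛-comm g f) (⊛-comm h f))))
                , ⊛-distribʳ }
    ; *-comm = ⊛-comm } }

open CommutativeRing seriesRing using () renaming (setoid to ≈-setoid)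

const-homo : CommutativeRing.rawRing ℤP.+-*-commutativeRing -Raw-AlmostCommutative⟶ fromCommutativeRing seriesRing
const-homo = record
  { ⟦_⟧ = const ; +-homo = const-+ ; *-homo = const-* ; -‿homo = const-neg ; 0-homo = ≈-refl ; 1-homo = ≈-refl }

const-≟ : ∀ x y → Maybe (const x ≈ const y)
const-≟ x y with x ℤ.≟ y
... | yes refl = just ≈-refl
... | no _     = nothing

module Solver = RingSolver (CommutativeRing.rawRing ℤP.+-*-commutativeRing)
                           (fromCommutativeRing seriesRing) const-homo const-≟
open Solver using (solve; _:+_; _:*_; _:-_; :-_; con; _:=_)

module ≈-Reasoning = SetoidReasoning ≈-setoid

opaque
  unfolding _⊕_ ⊝_ _⊛_ X

  X-+ : ∀ a b → X a ⊛ X b ≈ X (a + b)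
  X-+ zero b = ⊛-identityˡ (X b)
  X-+ (suc a) b = mk≈ λ where
    zero    → refl
    (suc n) → trans (ℤP.+-identityˡ _) (at (X-+ a b) n)

  X-⊛-≥ : ∀ a f n → (X a ⊛ f) (a + n) ≡ f n
  X-⊛-≥ zero f n    = at (⊛-identityˡ f) n
  X-⊛-≥ (suc a) f n = trans (ℤP.+-identityˡ _) (X-⊛-≥ a f n)

  X-⊛-< : ∀ a f n → n < a → (X a ⊛ f) n ≡ + 0
  X-⊛-< (suc a) f zero    _       = refl
  X-⊛-< (suc a) f (suc n) (s≤s l) = trans (ℤP.+-identityˡ _) (X-⊛-< a f n l)

  ⊛-zero-at : ∀ f g n → (∀ i j → i + j ≡ n → f i *ᶻ g j ≡ + 0) → (f ⊛ g) n ≡ + 0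
  ⊛-zero-at f g zero    z = z 0 0 refl
  ⊛-zero-at f g (suc n) z = cong₂ _+ᶻ_ (z 0 (suc n) refl) (⊛-zero-at (tail f) g n λ i j e → z (suc i) j (cong suc e))

  X-0 : X 0 ≈ 𝟙
  X-0 = mk≈ λ _ → refl

X-cong : ∀ {a b} → a ≡ b → X a ≈ X b
X-cong refl = ≈-refl

infix 4 _≈[_]_
_≈[_]_ : Series → ℕ → Series → Set
f ≈[ n ] g = ∀ i → i ≤ n → f i ≡ g i

opaque
  unfolding _⊛_

  ⊛-cong[] : ∀ {f f′ g g′} n → f ≈[ n ] f′ → g ≈[ n ] g′ → f ⊛ g ≈[ n ] f′ ⊛ g′
  ⊛-cong[] n d e zero    l = cong₂ _*ᶻ_ (d 0 z≤n) (e 0 z≤n)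
  ⊛-cong[] {f} {f′} (suc n) d e (suc i) (s≤s l) =
    cong₂ _+ᶻ_ (cong₂ _*ᶻ_ (d 0 z≤n) (e (suc i) (s≤s l)))
               (⊛-cong[] {tail f} {tail f′} n (λ i l → d (suc i) (s≤s l)) (λ i l → e i (m≤n⇒m≤1+n l)) i l)

-- Sums over ℤ

Small : ℕ → Series → Set
Small n f = ∀ i → i ≤ n → f i ≡ + 0

Ord : ℕ → Series → Set
Ord a f = ∀ i → i < a → f i ≡ + 0

Ord-X : ∀ a f → Ord a (X a ⊛ f)
Ord-X a f i l = X-⊛-< a f i l

Ord-⊛ʳ : ∀ {a} f {g} → Ord a g → Ord a (f ⊛ g)
Ord-⊛ʳ {a} f {g} o i l = ⊛-zero-at f g i λ x y e →
  trans (cong (f x *ᶻ_) (o y (≤-<-trans (m+n≤o⇒n≤o x (≤-reflexive e)) l))) (ℤP.*-zeroʳ (f x))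

Ord-⊛ˡ : ∀ {a} {f} g → Ord a f → Ord a (f ⊛ g)
Ord-⊛ˡ {f = f} g o i l = trans (at (⊛-comm f g) i) (Ord-⊛ʳ g o i l)

Ord-≈ : ∀ {a f g} → f ≈ g → Ord a g → Ord a f
Ord-≈ e o i l = trans (at e i) (o i l)

Ord-≤ : ∀ {a b f} → a ≤ b → Ord b f → Ord a f
Ord-≤ a≤b o i l = o i (<-≤-trans l a≤b)

Ord-𝟘 : ∀ {a f} → f ≈ 𝟘 → Ord a f
Ord-𝟘 e i _ = trans (at e i) (𝟘-at i)

Null : (ℤ → Series) → Set
Null F = ∀ n → ∃ λ B → ∀ k → B ≤ ∣ k ∣ → Small n (F k)

record Fam : Set where
  constructor fam
  field
    fn   : ℤ → Series
    null : Null fn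
open Fam

order-bound : ∀ c d {m a n} → m ≤ c + d * a → suc (c + d * n) ≤ m → n < a
order-bound c d {m} {a} {n} p q = ≰⇒> λ a≤n →
  <-irrefl refl (≤-trans q (≤-trans p (+-monoʳ-≤ c (*-monoʳ-≤ d a≤n))))

ordFam : (c d : ℕ) (F : ℤ → Series) → (∀ k → ∃ λ a → Ord a (F k) × ∣ k ∣ ≤ c + d * a) → Fam
ordFam c d F o = fam F λ n → suc (c + d * n) , λ k l i i≤n →
  let (a , oa , b) = o k in oa i (≤-<-trans i≤n (order-bound c d b l))

ball : (ℤ → Series) → ℕ → Series
ball F zero    = F (+ 0)
ball F (suc N) = ball F N ⊕ (F (+ suc N) ⊕ F -[1+ N ])

opaque
  unfolding _⊕_ ⊝_ _⊛_ X

  ∑ : Fam → Series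
  ∑ F n = ball (fn F) (proj₁ (null F n)) n

  ball-stable′ : ∀ F i B → (∀ k → B ≤ ∣ k ∣ → F k i ≡ + 0) → ∀ M → ball F (M + B) i ≡ ball F B i
  ball-stable′ F i B z zero    = refl
  ball-stable′ F i B z (suc M) =
    trans (cong₂ _+ᶻ_ (ball-stable′ F i B z M)
            (cong₂ _+ᶻ_ (z (+ suc (M + B)) (m≤n+m B (suc M))) (z -[1+ M + B ] (m≤n+m B (suc M)))))
          (ℤP.+-identityʳ _)

  ball-stable : ∀ F i B → (∀ k → B ≤ ∣ k ∣ → F k i ≡ + 0) → ∀ N → B ≤ N → ball F N i ≡ ball F B i
  ball-stable F i B z N l = subst (λ M → ball F M i ≡ ball F B i) (m∸n+n≡m l) (ball-stable′ F i B z (N ∸ B))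

  ∑-at : ∀ F n B → (∀ k → B ≤ ∣ k ∣ → fn F k n ≡ + 0) → ∀ N → B ≤ N → ball (fn F) N n ≡ ∑ F n
  ∑-at F n B z N l =
    let B′ = proj₁ (null F n)
        M  = B ⊔ B′
    in trans (ball-stable (fn F) n B z N l)
      (trans (sym (ball-stable (fn F) n B z M (m≤m⊔n B B′)))
             (ball-stable (fn F) n B′ (λ k p → proj₂ (null F n) k p n ≤-refl) M (m≤n⊔m B B′)))

  ∑-lim : ∀ F n → ∃ λ B → ∀ N → B ≤ N → ∀ i → i ≤ n → ball (fn F) N i ≡ ∑ F i
  ∑-lim F n = let (B , z) = null F n in B , λ N l i i≤n → ∑-at F i B (λ k p → z k p i i≤n) N l

  ball-cong : ∀ {F G} → (∀ k → F k ≈ G k) → ∀ N → ball F N ≈ ball G N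
  ball-cong e zero    = e (+ 0)
  ball-cong e (suc N) = ⊕-cong (ball-cong e N) (⊕-cong (e _) (e _))

  ball-⊕ : ∀ F G N → ball (λ k → F k ⊕ G k) N ≈ ball F N ⊕ ball G N
  ball-⊕ F G zero    = ≈-refl
  ball-⊕ F G (suc N) = ≈-trans (⊕-cong (ball-⊕ F G N) ≈-refl)
    (solve 6 (λ a b c d e f → (a :+ b) :+ ((c :+ d) :+ (e :+ f)) := (a :+ (c :+ e)) :+ (b :+ (d :+ f))) ≈-refl
       (ball F N) (ball G N) (F (+ suc N)) (G (+ suc N)) (F -[1+ N ]) (G -[1+ N ]))

  ball-⊛ : ∀ g F N → ball (λ k → g ⊛ F k) N ≈ g ⊛ ball F N
  ball-⊛ g F zero    = ≈-refl
  ball-⊛ g F (suc N) = ≈-trans (⊕-cong (ball-⊛ g F N) ≈-refl)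
    (solve 4 (λ g a b c → g :* a :+ (g :* b :+ g :* c) := g :* (a :+ (b :+ c))) ≈-refl
       g (ball F N) (F (+ suc N)) (F -[1+ N ]))

  ball-reflect : ∀ F N → ball (λ k → F (-ᶻ k)) N ≈ ball F N
  ball-reflect F zero    = ≈-refl
  ball-reflect F (suc N) = ⊕-cong (ball-reflect F N) (mk≈ λ n → ℤP.+-comm (F -[1+ N ] n) (F (+ suc N) n))

  ball-swap : ∀ (F : ℤ → ℤ → Series) M N → ball (λ j → ball (F j) N) M ≈ ball (λ k → ball (λ j → F j k) M) N
  ball-swap F zero    N = ≈-refl
  ball-swap F (suc M) N = ≈-trans (⊕-cong (ball-swap F M N) (≈-sym (ball-⊕ _ _ N)))
                                  (≈-sym (ball-⊕ _ _ N))

  ball-shift : ∀ F N → ball (λ k → F (k +ᶻ + 1)) N ⊕ F (-ᶻ (+ N)) ≈ ball F N ⊕ F (+ suc N)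
  ball-shift F zero    = mk≈ λ n → ℤP.+-comm (F (+ 1) n) (F (+ 0) n)
  ball-shift F (suc N) = mk≈ λ n → begin
    (ball G N n +ᶻ (F (+ (suc N + 1)) n +ᶻ F (1 ℤ.⊖ suc N) n)) +ᶻ F -[1+ N ] n
      ≡⟨ cong₂ (λ x y → (ball G N n +ᶻ (F (+ x) n +ᶻ F y n)) +ᶻ F -[1+ N ] n)
           (+-comm (suc N) 1) (trans (ℤP.[1+m]⊖[1+n]≡m⊖n 0 N) (0⊖ N)) ⟩
    (ball G N n +ᶻ (F (+ (2 + N)) n +ᶻ F (-ᶻ (+ N)) n)) +ᶻ F -[1+ N ] n
      ≡⟨ lem₁ (ball G N n) (F (+ (2 + N)) n) _ _ ⟩
    (ball G N n +ᶻ F (-ᶻ (+ N)) n) +ᶻ (F (+ (2 + N)) n +ᶻ F -[1+ N ] n)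
      ≡⟨ cong (_+ᶻ (F (+ (2 + N)) n +ᶻ F -[1+ N ] n)) (at (ball-shift F N) n) ⟩
    (ball F N n +ᶻ F (+ suc N) n) +ᶻ (F (+ (2 + N)) n +ᶻ F -[1+ N ] n)
      ≡⟨ lem₂ (ball F N n) _ _ _ ⟩
    (ball F N n +ᶻ (F (+ suc N) n +ᶻ F -[1+ N ] n)) +ᶻ F (+ (2 + N)) n ∎
    where
    open ≡-Reasoning
    G : ℤ → Series
    G k = F (k +ᶻ + 1)
    0⊖ : ∀ m → 0 ℤ.⊖ m ≡ -ᶻ (+ m)
    0⊖ zero    = refl
    0⊖ (suc m) = refl
    lem₁ : ∀ a b c d → (a +ᶻ (b +ᶻ c)) +ᶻ d ≡ (a +ᶻ c) +ᶻ (b +ᶻ d)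
    lem₁ = ℤR.solve-∀
    lem₂ : ∀ a b c d → (a +ᶻ b) +ᶻ (c +ᶻ d) ≡ (a +ᶻ (b +ᶻ d)) +ᶻ c
    lem₂ = ℤR.solve-∀

  ∑-cong : ∀ F G → (∀ k → fn F k ≈ fn G k) → ∑ F ≈ ∑ G
  ∑-cong F G e = mk≈ λ n →
    let (B , p) = ∑-lim F n ; (B′ , p′) = ∑-lim G n
        N = B ⊔ B′
    in trans (sym (p N (m≤m⊔n B B′) n ≤-refl))
      (trans (at (ball-cong e N) n) (p′ N (m≤n⊔m B B′) n ≤-refl))

  ∑-⊕ : ∀ H F G → (∀ k → fn H k ≈ fn F k ⊕ fn G k) → ∑ H ≈ ∑ F ⊕ ∑ G
  ∑-⊕ H F G e = mk≈ λ n →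
    let (B , p) = ∑-lim F n ; (B′ , p′) = ∑-lim G n ; (B″ , p″) = ∑-lim H n
        N = B ⊔ B′ ⊔ B″
        l = m≤m⊔n (B ⊔ B′) B″
    in trans (sym (p″ N (m≤n⊔m (B ⊔ B′) B″) n ≤-refl))
      (trans (at (≈-trans (ball-cong e N) (ball-⊕ (fn F) (fn G) N)) n)
      (cong₂ _+ᶻ_ (p N (≤-trans (m≤m⊔n B B′) l) n ≤-refl)
                  (p′ N (≤-trans (m≤n⊔m B B′) l) n ≤-refl)))

  ∑-⊛ : ∀ H g F → (∀ k → fn H k ≈ g ⊛ fn F k) → ∑ H ≈ g ⊛ ∑ F
  ∑-⊛ H g F e = mk≈ λ n →
    let (B , p) = ∑-lim F n ; (B′ , p′) = ∑-lim H n
        N = B ⊔ B′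
    in trans (sym (p′ N (m≤n⊔m B B′) n ≤-refl))
      (trans (at (≈-trans (ball-cong e N) (ball-⊛ g (fn F) N)) n)
             (⊛-cong[] {g} {g} n (λ _ _ → refl) (p N (m≤m⊔n B B′)) n ≤-refl))

  ∑-reflect : ∀ H F → (∀ k → fn H k ≈ fn F (-ᶻ k)) → ∑ H ≈ ∑ F
  ∑-reflect H F e = mk≈ λ n →
    let (B , p) = ∑-lim F n ; (B′ , p′) = ∑-lim H n
        N = B ⊔ B′
    in trans (sym (p′ N (m≤n⊔m B B′) n ≤-refl))
      (trans (at (≈-trans (ball-cong e N) (ball-reflect (fn F) N)) n)
             (p N (m≤m⊔n B B′) n ≤-refl))

  ∑-shift1 : ∀ H F → (∀ k → fn H k ≈ fn F (k +ᶻ + 1)) → ∑ H ≈ ∑ F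
  ∑-shift1 H F e = mk≈ λ n →
    let (B , p) = ∑-lim F n ; (B′ , p′) = ∑-lim H n ; (B″ , z) = null F n
        N = B ⊔ B′ ⊔ B″
        l = m≤m⊔n (B ⊔ B′) B″
        l′ = m≤n⊔m (B ⊔ B′) B″
        s = at (ball-shift (fn F) N) n
    in trans (sym (p′ N (≤-trans (m≤n⊔m B B′) l) n ≤-refl))
      (trans (at (ball-cong e N) n)
      (trans (sym (ℤP.+-identityʳ _))
      (trans (cong (ball (λ k → fn F (k +ᶻ + 1)) N n +ᶻ_)
                (sym (z (-ᶻ (+ N)) (subst (B″ ≤_) (sym (ℤP.∣-i∣≡∣i∣ (+ N))) l′) n ≤-refl)))
      (trans s
      (trans (cong (ball (fn F) N n +ᶻ_) (z (+ suc N) (m≤n⇒m≤1+n l′) n ≤-refl))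
      (trans (ℤP.+-identityʳ _) (p N (≤-trans (m≤m⊔n B B′) l) n ≤-refl)))))))

abs-bound : ∀ k d → ∣ k ∣ ≤ ∣ k +ᶻ d ∣ + ∣ d ∣
abs-bound k d = subst (λ x → ∣ x ∣ ≤ ∣ k +ᶻ d ∣ + ∣ d ∣) (lem k d)
  (subst (λ y → ∣ (k +ᶻ d) +ᶻ (-ᶻ d) ∣ ≤ ∣ k +ᶻ d ∣ + y) (ℤP.∣-i∣≡∣i∣ d) (ℤP.∣i+j∣≤∣i∣+∣j∣ (k +ᶻ d) (-ᶻ d)))
  where
  lem : ∀ k d → (k +ᶻ d) +ᶻ (-ᶻ d) ≡ k
  lem = ℤR.solve-∀

shiftFam : ℤ → Fam → Fam
shiftFam d F = fam (λ k → fn F (k +ᶻ d)) λ n →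
  let (B , z) = null F n
  in B + ∣ d ∣ , λ k l → z (k +ᶻ d) (+-cancelʳ-≤ ∣ d ∣ B _ (≤-trans l (abs-bound k d)))

∑-shiftℕ : ∀ m F → ∑ (shiftFam (+ m) F) ≈ ∑ F
∑-shiftℕ zero    F = ∑-cong (shiftFam (+ 0) F) F λ k → ≡⇒≈ (cong (fn F) (ℤP.+-identityʳ k))
∑-shiftℕ (suc m) F = ≈-trans (∑-shift1 (shiftFam (+ suc m) F) (shiftFam (+ m) F) λ k → ≡⇒≈ (cong (fn F) (sym (ℤP.+-assoc k (+ 1) (+ m)))))
                             (∑-shiftℕ m F)

∑-shift : ∀ d H F → (∀ k → fn H k ≈ fn F (k +ᶻ d)) → ∑ H ≈ ∑ F
∑-shift (+ m)    H F e = ≈-trans (∑-cong H (shiftFam (+ m) F) e) (∑-shiftℕ m F)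
∑-shift -[1+ m ] H F e = ≈-sym (≈-trans (∑-cong F (shiftFam (+ suc m) H) λ k →
  ≈-trans (≡⇒≈ (cong (fn F) (lem k (+ suc m)))) (≈-sym (e _))) (∑-shiftℕ (suc m) H))
  where
  lem : ∀ k d → k ≡ (k +ᶻ d) +ᶻ (-ᶻ d)
  lem = ℤR.solve-∀

Null₂ : (ℤ → ℤ → Series) → Set
Null₂ F = ∀ n → ∃ λ B → ∀ j k → (B ≤ ∣ j ∣) ⊎ (B ≤ ∣ k ∣) → Small n (F j k)

record Fam₂ : Set where
  constructor fam₂
  field
    fn₂   : ℤ → ℤ → Series
    null₂ : Null₂ fn₂
open Fam₂

ordFam₂ : (c d : ℕ) (F : ℤ → ℤ → Series) →
          (∀ j k → ∃ λ a → Ord a (F j k) × ∣ j ∣ ≤ c + d * a × ∣ k ∣ ≤ c + d * a) → Fam₂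
ordFam₂ c d F o = fam₂ F λ n → suc (c + d * n) , λ j k l i i≤n →
  let (a , oa , b , b′) = o j k
  in oa i (≤-<-trans i≤n ([ order-bound c d b , order-bound c d b′ ]′ l))

row : Fam₂ → ℤ → Fam
row F j = fam (fn₂ F j) λ n → let (B , z) = null₂ F n in B , λ k l → z j k (inj₂ l)

flip₂ : Fam₂ → Fam₂
flip₂ F = fam₂ (λ k j → fn₂ F j k) λ n →
  let (B , z) = null₂ F n in B , λ { k j (inj₁ l) → z j k (inj₂ l) ; k j (inj₂ l) → z j k (inj₁ l) }

opaque
  unfolding _⊕_ ⊝_ _⊛_ X ∑

  ball-zero : ∀ F i → (∀ k → F k i ≡ + 0) → ∀ N → ball F N i ≡ + 0
  ball-zero F i z zero    = z (+ 0)
  ball-zero F i z (suc N) = cong₂ _+ᶻ_ (ball-zero F i z N) (cong₂ _+ᶻ_ (z _) (z _))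

  rows-null : ∀ F → Null (λ j → ∑ (row F j))
  rows-null F n = let (B , z) = null₂ F n in B , λ j l i i≤n →
    ball-zero (fn₂ F j) i (λ k → z j k (inj₁ l) i i≤n) (proj₁ (null₂ F i))

rows : Fam₂ → Fam
rows F = fam (λ j → ∑ (row F j)) (rows-null F)

opaque
  unfolding _⊕_ ⊝_ _⊛_ X ∑ ∑-lim rows-null

  ∑∑-at : ∀ F n → ∃ λ B → ∀ N → B ≤ N → ball (λ j → ball (fn₂ F j) N) N n ≡ ∑ (rows F) n
  ∑∑-at F n = let (B , z) = null₂ F n in B , λ N l →
    trans (ball-at (λ j → ∑-at (row F j) n B (λ k p → z j k (inj₂ p) n ≤-refl) N l) N)
          (proj₂ (∑-lim (rows F) n) N l n ≤-refl)
    where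
    ball-at : ∀ {F G : ℤ → Series} → (∀ k → F k n ≡ G k n) → ∀ N → ball F N n ≡ ball G N n
    ball-at e zero    = e (+ 0)
    ball-at e (suc N) = cong₂ _+ᶻ_ (ball-at e N) (cong₂ _+ᶻ_ (e _) (e _))

  ∑-swap : ∀ F → ∑ (rows F) ≈ ∑ (rows (flip₂ F))
  ∑-swap F = mk≈ λ n →
    let (B , p) = ∑∑-at F n ; (B′ , p′) = ∑∑-at (flip₂ F) n
        N = B ⊔ B′
    in trans (sym (p N (m≤m⊔n B B′)))
      (trans (at (ball-swap (fn₂ F) N N) n) (p′ N (m≤n⊔m B B′)))

  ∑-zero-at : ∀ F n → (∀ k → fn F k n ≡ + 0) → ∑ F n ≡ + 0
  ∑-zero-at F n z = ball-zero (fn F) n z (proj₁ (null F n))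

  ∑-single : ∀ F → (∀ k → k ≢ + 0 → fn F k ≈ 𝟘) → ∑ F ≈ fn F (+ 0)
  ∑-single F z = mk≈ λ n → go n (proj₁ (null F n))
    where
    go : ∀ n N → ball (fn F) N n ≡ fn F (+ 0) n
    go n zero    = refl
    go n (suc N) = trans (cong₂ _+ᶻ_ (go n N)
      (cong₂ _+ᶻ_ (trans (at (z (+ suc N) λ ()) n) (𝟘-at n)) (trans (at (z -[1+ N ] λ ()) n) (𝟘-at n)))) (ℤP.+-identityʳ _)

-- Gaussian binomial coefficients and the series φ

X-merge : ∀ a b {n} f → a + b ≡ n → X a ⊛ (X b ⊛ f) ≈ X n ⊛ f
X-merge a b f refl = ≈-trans (≈-sym (⊛-assoc (X a) (X b) f)) (⊛-cong (X-+ a b) ≈-refl)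

X0-⊛ : ∀ f → X 0 ⊛ f ≈ f
X0-⊛ f = ≈-trans (⊛-cong X-0 ≈-refl) (⊛-identityˡ f)

⊛-𝟘 : ∀ f {g} → g ≈ 𝟘 → f ⊛ g ≈ 𝟘
⊛-𝟘 f {g} e = mk≈ λ n → trans (⊛-zero-at f g n λ i j _ →
  trans (cong (f i *ᶻ_) (trans (at e j) (𝟘-at j))) (ℤP.*-zeroʳ (f i))) (sym (𝟘-at n))

opaque
  unfolding _⊕_

  ⊕-𝟘 : ∀ f {g} → g ≈ 𝟘 → f ⊕ g ≈ f
  ⊕-𝟘 f e = mk≈ λ n → trans (cong (f n +ᶻ_) (trans (at e n) (𝟘-at n))) (ℤP.+-identityʳ (f n))

  𝟘-⊕ : ∀ {f} g → f ≈ 𝟘 → f ⊕ g ≈ g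
  𝟘-⊕ g e = mk≈ λ n → trans (cong (_+ᶻ g n) (trans (at e n) (𝟘-at n))) (ℤP.+-identityˡ (g n))

extend : (ℕ → Series) → ℤ → Series
extend F (+ n)    = F n
extend F -[1+ n ] = 𝟘

natFam : (c d : ℕ) (F : ℕ → Series) → (∀ k → ∃ λ a → Ord a (F k) × k ≤ c + d * a) → Fam
natFam c d F o = ordFam c d (extend F) λ where
  (+ n)    → o n
  -[1+ n ] → proj₁ (o (suc n)) , Ord-𝟘 ≈-refl , proj₂ (proj₂ (o (suc n)))

single : Series → Fam
single f = fam g λ n → 1 , λ { (+ zero) () ; (+ suc k) _ i _ → 𝟘-at i ; -[1+ k ] _ i _ → 𝟘-at i }
  where
  g : ℤ → Series
  g (+ zero)  = f
  g (+ suc n) = 𝟘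
  g -[1+ n ]  = 𝟘

∑-peel : ∀ F G → (∀ n → fn F (+ suc n) ≈ fn G (+ n)) → (∀ n → fn F -[1+ n ] ≈ 𝟘) → (∀ n → fn G -[1+ n ] ≈ 𝟘) →
         ∑ F ≈ fn F (+ 0) ⊕ ∑ G
∑-peel F G e z z′ = ≈-trans (∑-⊕ F S (shiftFam -[1+ 0 ] G) split)
  (⊕-cong (∑-single S λ { (+ zero) k≢0 → ⊥-elim (k≢0 refl) ; (+ suc n) _ → ≈-refl ; -[1+ n ] _ → ≈-refl })
          (∑-shift -[1+ 0 ] (shiftFam -[1+ 0 ] G) G λ k → ≈-refl))
  where
  S = single (fn F (+ 0))
  split : ∀ k → fn F k ≈ fn S k ⊕ fn G (k +ᶻ -[1+ 0 ])
  split (+ zero)  = ≈-sym (⊕-𝟘 _ (z′ 0))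
  split (+ suc n) = ≈-sym (≈-trans (𝟘-⊕ _ ≈-refl) (≈-sym (e n)))
  split -[1+ n ]  = ≈-trans (z n) (≈-sym (≈-trans (𝟘-⊕ _ ≈-refl) (z′ (suc (n + 0)))))

partial : (ℕ → Series) → ℕ → Series
partial F zero    = F 0
partial F (suc N) = partial F N ⊕ F (suc N)

ball-extend : ∀ F N → ball (extend F) N ≈ partial F N
ball-extend F zero    = ≈-refl
ball-extend F (suc N) = ⊕-cong (ball-extend F N) (⊕-𝟘 _ ≈-refl)

-- Gaussian binomial coefficients in the variable q = Q².
c : ℕ → ℕ → Series
c n       zero    = 𝟙
c zero    (suc k) = 𝟘
c (suc n) (suc k) = c n k ⊕ X (2 * suc k) ⊛ c n (suc k)

c-zero : ∀ n k → n < k → c n k ≈ 𝟘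
c-zero zero    (suc k) _       = ≈-refl
c-zero (suc n) (suc k) (s≤s l) = ≈-trans (𝟘-⊕ _ (c-zero n k l)) (⊛-𝟘 _ (c-zero n (suc k) (m≤n⇒m≤1+n l)))

c-pascal : ∀ n k → c (suc n) (suc k) ≈ c n (suc k) ⊕ X (2 * (n ∸ k)) ⊛ c n k
c-pascal zero zero = ≈-trans (⊕-𝟘 _ (⊛-𝟘 (X 2) ≈-refl)) (≈-sym (≈-trans (𝟘-⊕ _ ≈-refl) (X0-⊛ 𝟙)))
c-pascal zero (suc k) = ≈-trans (𝟘-⊕ _ ≈-refl) (≈-trans (⊛-𝟘 (X (2 * suc (suc k))) ≈-refl) (≈-sym (≈-trans (𝟘-⊕ _ ≈-refl) (⊛-𝟘 (X 0) ≈-refl))))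
c-pascal (suc n) zero = begin
  𝟙 ⊕ X 2 ⊛ c (suc n) 1                        ≈⟨ ⊕-congˡ (⊛-congˡ (c-pascal n 0)) ⟩
  𝟙 ⊕ X 2 ⊛ (c n 1 ⊕ X (2 * n) ⊛ 𝟙)
    ≈⟨ solve 3 (λ x a y → con (+ 1) :+ x :* (a :+ y :* con (+ 1)) := (con (+ 1) :+ x :* a) :+ (x :* (y :* con (+ 1)))) ≈-refl (X 2) (c n 1) (X (2 * n)) ⟩
  (𝟙 ⊕ X 2 ⊛ c n 1) ⊕ X 2 ⊛ (X (2 * n) ⊛ 𝟙)     ≈⟨ ⊕-congˡ (X-merge 2 (2 * n) 𝟙 (lem n)) ⟩
  (𝟙 ⊕ X 2 ⊛ c n 1) ⊕ X (2 * suc n) ⊛ 𝟙          ∎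
  where
  open ≈-Reasoning
  lem : ∀ n → 2 + 2 * n ≡ 2 * suc n
  lem = ℕR.solve-∀
c-pascal (suc n) (suc k) = begin
  c (suc n) (suc k) ⊕ X (2 * (2 + k)) ⊛ c (suc n) (2 + k)
    ≈⟨ ⊕-cong (c-pascal n k) (⊛-congˡ (c-pascal n (suc k))) ⟩
  (c n (suc k) ⊕ X (2 * (n ∸ k)) ⊛ c n k) ⊕ X (2 * (2 + k)) ⊛ (c n (2 + k) ⊕ X (2 * (n ∸ suc k)) ⊛ c n (suc k))
    ≈⟨ solve 5 (λ a y x d w → (a :+ y) :+ x :* (d :+ w) := (a :+ x :* d) :+ (y :+ x :* w)) ≈-refl
         (c n (suc k)) (X (2 * (n ∸ k)) ⊛ c n k) (X (2 * (2 + k))) (c n (2 + k)) (X (2 * (n ∸ suc k)) ⊛ c n (suc k)) ⟩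
  (c n (suc k) ⊕ X (2 * (2 + k)) ⊛ c n (2 + k)) ⊕ (X (2 * (n ∸ k)) ⊛ c n k ⊕ X (2 * (2 + k)) ⊛ (X (2 * (n ∸ suc k)) ⊛ c n (suc k)))
    ≈⟨ ⊕-congˡ (⊕-congˡ swap-powers) ⟩
  (c n (suc k) ⊕ X (2 * (2 + k)) ⊛ c n (2 + k)) ⊕ (X (2 * (n ∸ k)) ⊛ c n k ⊕ X (2 * (n ∸ k)) ⊛ (X (2 * suc k) ⊛ c n (suc k)))
    ≈⟨ ⊕-congˡ (solve 3 (λ y a b → y :* a :+ y :* b := y :* (a :+ b)) ≈-refl (X (2 * (n ∸ k))) (c n k) (X (2 * suc k) ⊛ c n (suc k))) ⟩
  c (suc n) (2 + k) ⊕ X (2 * (n ∸ k)) ⊛ c (suc n) (suc k) ∎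
  where
  open ≈-Reasoning
  lem : ∀ k d → 2 * (2 + k) + 2 * d ≡ 2 * suc d + 2 * suc k
  lem = ℕR.solve-∀
  swap-powers : X (2 * (2 + k)) ⊛ (X (2 * (n ∸ suc k)) ⊛ c n (suc k)) ≈ X (2 * (n ∸ k)) ⊛ (X (2 * suc k) ⊛ c n (suc k))
  swap-powers with k <? n
  ... | yes l = ≈-trans (X-merge (2 * (2 + k)) (2 * (n ∸ suc k)) (c n (suc k)) refl)
               (≈-sym (X-merge (2 * (n ∸ k)) (2 * suc k) (c n (suc k))
                  (sym (trans (lem k (n ∸ suc k)) (cong (λ x → 2 * x + 2 * suc k) (sym (+-∸-assoc 1 l)))))))
  ... | no ¬l = ≈-trans (⊛-𝟘 (X (2 * (2 + k))) (⊛-𝟘 (X (2 * (n ∸ suc k))) z))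
               (≈-sym (⊛-𝟘 (X (2 * (n ∸ k))) (⊛-𝟘 (X (2 * suc k)) z)))
    where z = c-zero n (suc k) (s≤s (≮⇒≥ ¬l))

c-self : ∀ n → c n n ≈ 𝟙
c-self zero    = ≈-refl
c-self (suc n) = ≈-trans (⊕-cong (c-self n) (⊛-𝟘 (X (2 * suc n)) (c-zero n (suc n) ≤-refl))) (⊕-𝟘 _ ≈-refl)

c-cong : ∀ {m n} k → m ≡ n → c m k ≈ c n k
c-cong k refl = ≈-refl

c-sym : ∀ i j → c (i + j) i ≈ c (i + j) j
c-sym zero    j       = ≈-sym (c-self j)
c-sym (suc i) zero    = ≈-trans (c-cong (suc i) (+-identityʳ (suc i))) (c-self (suc i))
c-sym (suc i) (suc j) = begin
  c (suc (i + suc j)) (suc i)                                    ≈⟨ ⊕-cong (c-sym i (suc j)) (⊛-congˡ step) ⟩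
  c (i + suc j) (suc j) ⊕ X (2 * suc i) ⊛ c (i + suc j) j
    ≈⟨ ⊕-congˡ (⊛-cong (X-cong (cong (2 *_) (sym (trans (cong (_∸ j) (+-suc i j)) (m+n∸n≡m (suc i) j))))) ≈-refl) ⟩
  c (i + suc j) (suc j) ⊕ X (2 * (i + suc j ∸ j)) ⊛ c (i + suc j) j ≈⟨ ≈-sym (c-pascal (i + suc j) j) ⟩
  c (suc (i + suc j)) (suc j) ∎
  where
  open ≈-Reasoning
  step : c (i + suc j) (suc i) ≈ c (i + suc j) j
  step = ≈-trans (c-cong (suc i) (+-suc i j)) (≈-trans (c-sym (suc i) j) (c-cong j (sym (+-suc i j))))

-- ∑ₖ q^{(a+1)k} [m+2k choose k]
weightedφ : (a : ℕ) → ℕ → Fam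
weightedφ a m = natFam 0 1 (λ k → X (2 * (suc a * k)) ⊛ c (m + 2 * k) k) λ k →
  k , Ord-≤ (≤-trans (m≤m+n k (a * k)) (m≤m+n _ _)) (Ord-X _ _) , ≤-reflexive (sym (+-identityʳ k))

φ χ : ℕ → Series
φ m = ∑ (weightedφ 0 m)
χ m = ∑ (weightedφ 1 m)

φ-suc₁ : ∀ m → φ (suc m) ≈ φ m ⊕ X (2 * (m + 3)) ⊛ χ (m + 2)
φ-suc₁ m = ≈-trans (∑-⊕ (weightedφ 0 (suc m)) (weightedφ 0 m) (shiftFam -[1+ 0 ] G) split)
  (⊕-congˡ (≈-trans (∑-shift -[1+ 0 ] (shiftFam -[1+ 0 ] G) G λ _ → ≈-refl)
    (∑-⊛ G (X (2 * (m + 3))) (weightedφ 1 (m + 2)) λ { (+ n) → ≈-refl ; -[1+ n ] → ≈-sym (⊛-𝟘 (X (2 * (m + 3))) ≈-refl) })))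
  where
  open ≈-Reasoning
  g : ℕ → Series
  g j = X (2 * (m + 3)) ⊛ (X (2 * (2 * j)) ⊛ c (m + 2 + 2 * j) j)
  G = natFam 0 1 g λ k → k , Ord-⊛ʳ (X (2 * (m + 3))) (Ord-≤ (≤-trans (m≤m+n k _) (m≤m+n (2 * k) (2 * k + 0))) (Ord-X _ _)) , ≤-reflexive (sym (+-identityʳ k))
  e₁ : ∀ m j → suc m + 2 * suc j ≡ suc (m + 2 + 2 * j)
  e₁ = ℕR.solve-∀
  e₂ : ∀ m j → m + 2 + 2 * j ≡ m + 2 * suc j
  e₂ = ℕR.solve-∀
  e₃ : ∀ m j → m + 2 + 2 * j ≡ (m + 2 + j) + j
  e₃ = ℕR.solve-∀
  e₄ : ∀ m j → 2 * (1 * suc j) + 2 * (m + 2 + j) ≡ 2 * (m + 3) + 2 * (2 * j)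
  e₄ = ℕR.solve-∀
  split : ∀ k → fn (weightedφ 0 (suc m)) k ≈ fn (weightedφ 0 m) k ⊕ extend g (k +ᶻ -[1+ 0 ])
  split (+ zero)  = ≈-sym (⊕-𝟘 (X 0 ⊛ 𝟙) ≈-refl)
  split -[1+ n ]  = ≈-sym (⊕-𝟘 𝟘 ≈-refl)
  split (+ suc j) = begin
    X (2 * (1 * suc j)) ⊛ c (suc m + 2 * suc j) (suc j)
      ≈⟨ ⊛-congˡ (≈-trans (c-cong (suc j) (e₁ m j)) (c-pascal (m + 2 + 2 * j) j)) ⟩
    X (2 * (1 * suc j)) ⊛ (c (m + 2 + 2 * j) (suc j) ⊕ X (2 * (m + 2 + 2 * j ∸ j)) ⊛ c (m + 2 + 2 * j) j)
      ≈⟨ solve 3 (λ x a b → x :* (a :+ b) := x :* a :+ x :* b) ≈-refl (X (2 * (1 * suc j))) (c (m + 2 + 2 * j) (suc j)) (X (2 * (m + 2 + 2 * j ∸ j)) ⊛ c (m + 2 + 2 * j) j) ⟩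
    X (2 * (1 * suc j)) ⊛ c (m + 2 + 2 * j) (suc j) ⊕ X (2 * (1 * suc j)) ⊛ (X (2 * (m + 2 + 2 * j ∸ j)) ⊛ c (m + 2 + 2 * j) j)
      ≈⟨ ⊕-cong (⊛-congˡ (c-cong (suc j) (e₂ m j)))
           (≈-trans (X-merge (2 * (1 * suc j)) (2 * (m + 2 + 2 * j ∸ j)) (c (m + 2 + 2 * j) j)
              (trans (cong (λ x → 2 * (1 * suc j) + 2 * x) (trans (cong (_∸ j) (e₃ m j)) (m+n∸n≡m (m + 2 + j) j))) (e₄ m j)))
              (≈-sym (X-merge (2 * (m + 3)) (2 * (2 * j)) (c (m + 2 + 2 * j) j) refl))) ⟩
    X (2 * (1 * suc j)) ⊛ c (m + 2 * suc j) (suc j) ⊕ g j ∎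

φ-suc₂ : ∀ m → φ (suc m) ≈ χ m ⊕ X 2 ⊛ φ (2 + m)
φ-suc₂ m = ≈-trans (∑-⊕ (weightedφ 0 (suc m)) (weightedφ 1 m) (shiftFam -[1+ 0 ] G) split)
  (⊕-congˡ (≈-trans (∑-shift -[1+ 0 ] (shiftFam -[1+ 0 ] G) G λ _ → ≈-refl)
    (∑-⊛ G (X 2) (weightedφ 0 (2 + m)) λ { (+ n) → ≈-refl ; -[1+ n ] → ≈-sym (⊛-𝟘 (X 2) ≈-refl) })))
  where
  open ≈-Reasoning
  g : ℕ → Series
  g j = X 2 ⊛ (X (2 * (1 * j)) ⊛ c (2 + m + 2 * j) j)
  G = natFam 0 1 g λ k → k , Ord-⊛ʳ (X 2) (Ord-≤ (≤-trans (m≤m+n k 0) (m≤m+n (1 * k) (1 * k + 0))) (Ord-X _ _)) , ≤-reflexive (sym (+-identityʳ k))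
  e₁ : ∀ m j → suc m + 2 * suc j ≡ suc (2 + m + 2 * j)
  e₁ = ℕR.solve-∀
  e₂ : ∀ m j → 2 + m + 2 * j ≡ m + 2 * suc j
  e₂ = ℕR.solve-∀
  e₃ : ∀ j → 2 + 2 * (1 * j) ≡ 2 * (1 * suc j)
  e₃ = ℕR.solve-∀
  e₄ : ∀ j → 2 * (1 * suc j) + 2 * suc j ≡ 2 * (2 * suc j)
  e₄ = ℕR.solve-∀
  split : ∀ k → fn (weightedφ 0 (suc m)) k ≈ fn (weightedφ 1 m) k ⊕ extend g (k +ᶻ -[1+ 0 ])
  split (+ zero)  = ≈-sym (⊕-𝟘 (X 0 ⊛ 𝟙) ≈-refl)
  split -[1+ n ]  = ≈-sym (⊕-𝟘 𝟘 ≈-refl)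
  split (+ suc j) = begin
    X (2 * (1 * suc j)) ⊛ c (suc m + 2 * suc j) (suc j)
      ≈⟨ ⊛-congˡ (c-cong (suc j) (e₁ m j)) ⟩
    X (2 * (1 * suc j)) ⊛ (c (2 + m + 2 * j) j ⊕ X (2 * suc j) ⊛ c (2 + m + 2 * j) (suc j))
      ≈⟨ solve 4 (λ x a y b → x :* (a :+ y :* b) := x :* (y :* b) :+ x :* a) ≈-refl (X (2 * (1 * suc j))) (c (2 + m + 2 * j) j) (X (2 * suc j)) (c (2 + m + 2 * j) (suc j)) ⟩
    X (2 * (1 * suc j)) ⊛ (X (2 * suc j) ⊛ c (2 + m + 2 * j) (suc j)) ⊕ X (2 * (1 * suc j)) ⊛ c (2 + m + 2 * j) j
      ≈⟨ ⊕-cong (≈-trans (X-merge (2 * (1 * suc j)) (2 * suc j) _ (e₄ j)) (⊛-congˡ (c-cong (suc j) (e₂ m j))))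
                (≈-sym (X-merge 2 (2 * (1 * j)) _ (e₃ j))) ⟩
    X (2 * (2 * suc j)) ⊛ c (m + 2 * suc j) (suc j) ⊕ g j ∎

φ-zero : φ 0 ≈ 𝟙 ⊕ X 2 ⊛ φ 1 ⊕ X 4 ⊛ χ 1
φ-zero = begin
  φ 0  ≈⟨ ∑-peel (weightedφ 0 0) T (λ n → ≈-refl) (λ n → ≈-refl) (λ n → ≈-refl) ⟩
  X 0 ⊛ 𝟙 ⊕ ∑ T  ≈⟨ ⊕-cong (X0-⊛ 𝟙) (∑-⊕ T G₁ G₂ split) ⟩
  𝟙 ⊕ (∑ G₁ ⊕ ∑ G₂)
    ≈⟨ ⊕-congˡ (⊕-cong (∑-⊛ G₁ (X 2) (weightedφ 0 1) λ { (+ n) → ≈-refl ; -[1+ n ] → ≈-sym (⊛-𝟘 (X 2) ≈-refl) })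
                             (∑-⊛ G₂ (X 4) (weightedφ 1 1) λ { (+ n) → ≈-refl ; -[1+ n ] → ≈-sym (⊛-𝟘 (X 4) ≈-refl) })) ⟩
  𝟙 ⊕ (X 2 ⊛ φ 1 ⊕ X 4 ⊛ χ 1) ≈⟨ ≈-sym (⊕-assoc 𝟙 _ _) ⟩
  𝟙 ⊕ X 2 ⊛ φ 1 ⊕ X 4 ⊛ χ 1 ∎
  where
  open ≈-Reasoning
  t g₁ g₂ : ℕ → Series
  t j  = X (2 * (1 * suc j)) ⊛ c (0 + 2 * suc j) (suc j)
  g₁ j = X 2 ⊛ (X (2 * (1 * j)) ⊛ c (1 + 2 * j) j)
  g₂ j = X 4 ⊛ (X (2 * (2 * j)) ⊛ c (1 + 2 * j) j)
  T = natFam 0 1 t λ k → k , Ord-≤ (≤-trans (n≤1+n k) (≤-trans (m≤m+n (suc k) 0) (m≤m+n (1 * suc k) (1 * suc k + 0)))) (Ord-X _ _) , ≤-reflexive (sym (+-identityʳ k))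
  G₁ = natFam 0 1 g₁ λ k → k , Ord-⊛ʳ (X 2) (Ord-≤ (≤-trans (m≤m+n k 0) (m≤m+n (1 * k) (1 * k + 0))) (Ord-X _ _)) , ≤-reflexive (sym (+-identityʳ k))
  G₂ = natFam 0 1 g₂ λ k → k , Ord-⊛ʳ (X 4) (Ord-≤ (≤-trans (m≤m+n k _) (m≤m+n (2 * k) (2 * k + 0))) (Ord-X _ _)) , ≤-reflexive (sym (+-identityʳ k))
  e₁ : ∀ j → 2 * suc j ≡ suc (1 + 2 * j)
  e₁ = ℕR.solve-∀
  e₂ : ∀ j → 1 + 2 * j ≡ suc j + j
  e₂ = ℕR.solve-∀
  e₃ : ∀ j → 2 * (1 * suc j) ≡ 2 + 2 * (1 * j)
  e₃ = ℕR.solve-∀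
  e₄ : ∀ j → 2 * (1 * suc j) + 2 * suc j ≡ 4 + 2 * (2 * j)
  e₄ = ℕR.solve-∀
  split : ∀ k → fn T k ≈ fn G₁ k ⊕ fn G₂ k
  split -[1+ n ] = ≈-sym (⊕-𝟘 𝟘 ≈-refl)
  split (+ j) = begin
    X (2 * (1 * suc j)) ⊛ c (2 * suc j) (suc j)
      ≈⟨ ⊛-congˡ (c-cong (suc j) (e₁ j)) ⟩
    X (2 * (1 * suc j)) ⊛ (c (1 + 2 * j) j ⊕ X (2 * suc j) ⊛ c (1 + 2 * j) (suc j))
      ≈⟨ ⊛-congˡ (⊕-congˡ (⊛-congˡ
           (≈-trans (c-cong (suc j) (e₂ j)) (≈-trans (c-sym (suc j) j) (c-cong j (sym (e₂ j))))))) ⟩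
    X (2 * (1 * suc j)) ⊛ (c (1 + 2 * j) j ⊕ X (2 * suc j) ⊛ c (1 + 2 * j) j)
      ≈⟨ solve 3 (λ x a y → x :* (a :+ y :* a) := x :* a :+ x :* (y :* a)) ≈-refl (X (2 * (1 * suc j))) (c (1 + 2 * j) j) (X (2 * suc j)) ⟩
    X (2 * (1 * suc j)) ⊛ c (1 + 2 * j) j ⊕ X (2 * (1 * suc j)) ⊛ (X (2 * suc j) ⊛ c (1 + 2 * j) j)
      ≈⟨ ⊕-cong (≈-sym (X-merge 2 (2 * (1 * j)) _ (sym (e₃ j))))
                (≈-trans (X-merge (2 * (1 * suc j)) (2 * suc j) _ (e₄ j)) (≈-sym (X-merge 4 (2 * (2 * j)) _ refl))) ⟩
    g₁ j ⊕ g₂ j ∎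

P : Series
P = φ 0 ⊕ X 6 ⊛ φ 3

φ-P : ∀ m → φ m ⊕ X (2 * (m + 3)) ⊛ φ (m + 3) ≈ P
φ-P zero    = ≈-refl
φ-P (suc m) = ≈-trans (≈-sym step) (φ-P m)
  where
  open ≈-Reasoning
  e : ∀ m → 2 * (m + 3) + 2 ≡ 2 * (suc m + 3)
  e = ℕR.solve-∀
  φ-cong : ∀ {m n} → m ≡ n → φ m ≈ φ n
  φ-cong refl = ≈-refl
  step : φ m ⊕ X (2 * (m + 3)) ⊛ φ (m + 3) ≈ φ (suc m) ⊕ X (2 * (suc m + 3)) ⊛ φ (suc m + 3)
  step = begin
    φ m ⊕ X (2 * (m + 3)) ⊛ φ (m + 3)
      ≈⟨ ⊕-congˡ (⊛-congˡ (≈-trans (φ-cong (+-suc m 2)) (φ-suc₂ (m + 2)))) ⟩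
    φ m ⊕ X (2 * (m + 3)) ⊛ (χ (m + 2) ⊕ X 2 ⊛ φ (2 + (m + 2)))
      ≈⟨ solve 5 (λ a x b y d → a :+ x :* (b :+ y :* d) := (a :+ x :* b) :+ x :* (y :* d)) ≈-refl
           (φ m) (X (2 * (m + 3))) (χ (m + 2)) (X 2) (φ (2 + (m + 2))) ⟩
    (φ m ⊕ X (2 * (m + 3)) ⊛ χ (m + 2)) ⊕ X (2 * (m + 3)) ⊛ (X 2 ⊛ φ (2 + (m + 2)))
      ≈⟨ ⊕-cong (≈-sym (φ-suc₁ m)) (≈-trans (X-merge (2 * (m + 3)) 2 _ (e m)) (⊛-congˡ (φ-cong (sym (cong suc (+-suc m 2)))))) ⟩
    φ (suc m) ⊕ X (2 * (suc m + 3)) ⊛ φ (suc m + 3) ∎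

φ-P₁ : X 2 ⊛ φ 1 ⊕ X 4 ⊛ φ 2 ≈ P ⊖ 𝟙
φ-P₁ = ≈-sym (begin
  (φ 0 ⊕ X 6 ⊛ φ 3) ⊖ 𝟙                                ≈⟨ ⊖-cong (⊕-cong φ-zero ≈-refl) ≈-refl ⟩
  (𝟙 ⊕ X 2 ⊛ φ 1 ⊕ X 4 ⊛ χ 1 ⊕ X 6 ⊛ φ 3) ⊖ 𝟙            ≈⟨ ⊖-cong (⊕-congˡ (≈-sym (X-merge 4 2 (φ 3) refl))) ≈-refl ⟩
  (𝟙 ⊕ X 2 ⊛ φ 1 ⊕ X 4 ⊛ χ 1 ⊕ X 4 ⊛ (X 2 ⊛ φ 3)) ⊖ 𝟙
    ≈⟨ solve 4 (λ a x b d → (con (+ 1) :+ a :+ x :* b :+ x :* d) :- con (+ 1) := a :+ x :* (b :+ d)) ≈-refl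
         (X 2 ⊛ φ 1) (X 4) (χ 1) (X 2 ⊛ φ 3) ⟩
  X 2 ⊛ φ 1 ⊕ X 4 ⊛ (χ 1 ⊕ X 2 ⊛ φ 3)                     ≈⟨ ⊕-congˡ (⊛-congˡ (≈-sym (φ-suc₂ 1))) ⟩
  X 2 ⊛ φ 1 ⊕ X 4 ⊛ φ 2 ∎)
  where open ≈-Reasoning

-- Extends u to negative indices by u₋ₙ = Q²ⁿ uₙ, so that Qⁱ uᵢ is even in i.
unhat : (ℕ → Series) → ℤ → Series
unhat u (+ n)    = u n
unhat u -[1+ n ] = X (2 * suc n) ⊛ u (suc n)

hat : (ℕ → Series) → ℤ → Series
hat u i = X ∣ i ∣ ⊛ u ∣ i ∣

δ : ℤ → Series
δ -[1+ 0 ] = 𝟙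
δ -[1+ 1 ] = 𝟙
δ _        = 𝟘

φ-reflection : ∀ i → unhat φ i ⊕ unhat φ (-[1+ 2 ] -ᶻ i) ≈ P ⊖ δ i
φ-reflection (+ zero)  = ≈-trans (φ-P 0) (solve 1 (λ p → p := p :- con (+ 0)) ≈-refl P)
φ-reflection (+ suc n) = ≈-trans (⊕-congˡ (≡⇒≈ (cong (λ x → X (2 * suc x) ⊛ φ (suc x)) (+-comm 3 n))))
  (≈-trans (φ-P (suc n)) (solve 1 (λ p → p := p :- con (+ 0)) ≈-refl P))
φ-reflection -[1+ 0 ] = φ-P₁
φ-reflection -[1+ 1 ] = ≈-trans (⊕-comm _ _) φ-P₁
φ-reflection -[1+ suc (suc n) ] = ≈-trans (⊕-comm _ _)
  (≈-trans (⊕-congˡ (≡⇒≈ (cong (λ x → X (2 * x) ⊛ φ x) (+-comm 3 n))))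
  (≈-trans (φ-P n) (solve 1 (λ p → p := p :- con (+ 0)) ≈-refl P)))

⊕-cong[] : ∀ {f f′ g g′} n → f ≈[ n ] f′ → g ≈[ n ] g′ → f ⊕ g ≈[ n ] f′ ⊕ g′
⊕-cong[] {f} {f′} {g} {g′} n d e i l = trans (⊕-at f g i) (trans (cong₂ _+ᶻ_ (d i l) (e i l)) (sym (⊕-at f′ g′ i)))

≈⇒≈[] : ∀ {f g n} → f ≈ g → f ≈[ n ] g
≈⇒≈[] e i _ = at e i

≈[]-trans : ∀ {f g h n} → f ≈[ n ] g → g ≈[ n ] h → f ≈[ n ] h
≈[]-trans d e i l = trans (d i l) (e i l)

≈[]-sym : ∀ {f g n} → f ≈[ n ] g → g ≈[ n ] f
≈[]-sym d i l = sym (d i l)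

⊕-Ord : ∀ {a n} f {g} → Ord a g → n < a → f ⊕ g ≈[ n ] f
⊕-Ord f {g} o n<a i i≤n = trans (⊕-at f g i) (trans (cong (f i +ᶻ_) (o i (≤-<-trans i≤n n<a))) (ℤP.+-identityʳ (f i)))

Ord-⊝ : ∀ {a f} → Ord a f → Ord a (⊝ f)
Ord-⊝ {f = f} o i l = trans (⊝-at f i) (cong -ᶻ_ (o i l))

1-X : ℕ → Series
1-X a = 𝟙 ⊖ X a

Ord-Xa : ∀ a → Ord a (X a)
Ord-Xa a = Ord-≈ (solve 1 (λ x → x := x :* con (+ 1)) ≈-refl (X a)) (Ord-X a 𝟙)

1-X≈1 : ∀ a {n} → n < a → 1-X a ≈[ n ] 𝟙
1-X≈1 a l = ⊕-Ord 𝟙 (Ord-⊝ (Ord-Xa a)) l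

euler : (d K : ℕ) → Series
euler d zero    = 𝟙
euler d (suc K) = euler d K ⊛ 1-X (d * suc K)

euler∞ : ℕ → Series
euler∞ d n = euler d n n

euler-stable : ∀ d .{{_ : NonZero d}} n M → euler d (M + n) ≈[ n ] euler d n
euler-stable d n zero    = λ _ _ → refl
euler-stable d n (suc M) = ≈[]-trans
  (⊛-cong[] {euler d (M + n)} {euler d n} n (euler-stable d n M)
     (1-X≈1 (d * suc (M + n)) (≤-trans (s≤s (m≤n+m n M)) (m≤n*m (suc (M + n)) d))))
  (≈⇒≈[] (≈-trans (⊛-comm _ _) (⊛-identityˡ _)))

euler-lim : ∀ d .{{_ : NonZero d}} n N → n ≤ N → euler d N ≈[ n ] euler∞ d
euler-lim d n N l i i≤n = lem i N (≤-trans i≤n l)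
  where
  lem : ∀ i N → i ≤ N → euler d N i ≡ euler d i i
  lem i N l = subst (λ M → euler d M i ≡ euler d i i) (m∸n+n≡m l) (euler-stable d i (N ∸ i) i ≤-refl)

c-ratio : ∀ i j → 1-X (2 * suc j) ⊛ c (i + suc j) (suc j) ≈ 1-X (2 * suc i) ⊛ c (suc i + j) j
c-ratio i j = begin
  1-X (2 * suc j) ⊛ c n (suc j)
    ≈⟨ solve 2 (λ x a → (con (+ 1) :- x) :* a := a :- x :* a) ≈-refl (X (2 * suc j)) (c n (suc j)) ⟩
  c n (suc j) ⊖ X (2 * suc j) ⊛ c n (suc j)
    ≈⟨ solve 4 (λ a b y d → a :- b := (a :+ y :* d) :- b :- y :* d) ≈-refl (c n (suc j)) (X (2 * suc j) ⊛ c n (suc j)) (X (2 * (n ∸ j))) (c n j) ⟩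
  (c n (suc j) ⊕ X (2 * (n ∸ j)) ⊛ c n j) ⊖ X (2 * suc j) ⊛ c n (suc j) ⊖ X (2 * (n ∸ j)) ⊛ c n j
    ≈⟨ ⊖-cong (⊖-cong (≈-sym (c-pascal n j)) ≈-refl) ≈-refl ⟩
  c (suc n) (suc j) ⊖ X (2 * suc j) ⊛ c n (suc j) ⊖ X (2 * (n ∸ j)) ⊛ c n j
    ≈⟨ solve 3 (λ a b y → (a :+ b) :- b :- y :* a := (con (+ 1) :- y) :* a) ≈-refl (c n j) (X (2 * suc j) ⊛ c n (suc j)) (X (2 * (n ∸ j))) ⟩
  1-X (2 * (n ∸ j)) ⊛ c n j
    ≈⟨ ⊛-cong (⊖-cong ≈-refl (X-cong (cong (2 *_) (trans (cong (_∸ j) (+-suc i j)) (m+n∸n≡m (suc i) j))))) (c-cong j (+-suc i j)) ⟩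
  1-X (2 * suc i) ⊛ c (suc i + j) j ∎
  where
  open ≈-Reasoning
  n = i + suc j

euler-c : ∀ n i k → n ≤ i → euler 2 k ⊛ c (i + k) k ≈[ n ] 𝟙
euler-c n i zero    l = ≈⇒≈[] (⊛-identityˡ 𝟙)
euler-c n i (suc k) l = ≈[]-trans
  (≈⇒≈[] (≈-trans (⊛-assoc _ _ _) (≈-trans (⊛-congˡ (c-ratio i k))
     (solve 3 (λ a b d → a :* (b :* d) := b :* (a :* d)) ≈-refl (euler 2 k) (1-X (2 * suc i)) (c (suc i + k) k)))))
  (≈[]-trans (⊛-cong[] {1-X (2 * suc i)} n (1-X≈1 (2 * suc i) (≤-trans (s≤s l) (m≤m+n (suc i) _))) (euler-c n (suc i) k (m≤n⇒m≤1+n l)))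
     (≈⇒≈[] (⊛-identityˡ 𝟙)))

φ-term : ℕ → ℕ → Series
φ-term m k = X (2 * (1 * k)) ⊛ c (m + 2 * k) k

euler-partial : ∀ n m K → n ≤ m → euler 2 K ⊛ partial (φ-term m) K ≈[ n ] 𝟙
euler-partial n m zero    l = ≈⇒≈[] (≈-trans (⊛-identityˡ _) (X0-⊛ 𝟙))
euler-partial n m (suc K) l = ≈[]-trans (≈⇒≈[] regroup)
  (≈[]-trans (⊕-cong[] n (⊛-cong[] {1-X (2 * suc K)} n (λ _ _ → refl) (euler-partial n m K l))
                         (⊛-cong[] {X (2 * (1 * suc K))} n (λ _ _ → refl) (euler-c n (m + suc K) (suc K) (≤-trans l (m≤m+n m (suc K))))))
  (≈⇒≈[] (≈-trans (⊕-congˡ (⊛-cong (X-cong (cong (2 *_) (*-identityˡ (suc K)))) ≈-refl))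
     (solve 1 (λ x → (con (+ 1) :- x) :* con (+ 1) :+ x :* con (+ 1) := con (+ 1)) ≈-refl (X (2 * suc K))))))
  where
  e : ∀ m K → m + 2 * suc K ≡ m + suc K + suc K
  e = ℕR.solve-∀
  regroup : euler 2 (suc K) ⊛ partial (φ-term m) (suc K) ≈
            1-X (2 * suc K) ⊛ (euler 2 K ⊛ partial (φ-term m) K) ⊕ X (2 * (1 * suc K)) ⊛ (euler 2 (suc K) ⊛ c (m + suc K + suc K) (suc K))
  regroup = ≈-trans (⊛-congˡ (⊕-congˡ (⊛-congˡ (c-cong (suc K) (e m K)))))
    (solve 5 (λ a b s x d → a :* b :* (s :+ x :* d) := b :* (a :* s) :+ x :* (a :* b :* d)) ≈-refl
      (euler 2 K) (1-X (2 * suc K)) (partial (φ-term m) K) (X (2 * (1 * suc K))) (c (m + suc K + suc K) (suc K)))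

euler-P : euler∞ 2 ⊛ P ≈ 𝟙
euler-P = mk≈ λ n →
  let (B , lim) = ∑-lim (weightedφ 0 n) n
      N = B ⊔ n
  in trans (⊛-cong[] {euler∞ 2} n (≈[]-sym (euler-lim 2 n N (m≤n⊔m B n)))
       (≈[]-trans (≈⇒≈[] (≈-sym (φ-P n)))
       (≈[]-trans (⊕-Ord (φ n) (Ord-X (2 * (n + 3)) (φ (n + 3))) (≤-trans (≤-trans (s≤s (m≤m+n n 2)) (≤-reflexive (sym (+-suc n 2)))) (m≤m+n (n + 3) _)))
       (≈[]-trans (≈[]-sym (lim N (m≤m⊔n B n))) (≈⇒≈[] (ball-extend (φ-term n) N)))))
       n ≤-refl)
     (euler-partial n n N ≤-refl n ≤-refl)

-- Gauss' theta identities

partial-Ord : ∀ {a} F N → (∀ k → Ord a (F (suc k))) → ∀ {n} → n < a → partial F N ≈[ n ] F 0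
partial-Ord F zero    o l = λ _ _ → refl
partial-Ord F (suc N) o l = ≈[]-trans (⊕-Ord (partial F N) (o N) l) (partial-Ord F N o l)

partial-cong : ∀ {F G : ℕ → Series} N → (∀ k → k ≤ N → F k ≈ G k) → partial F N ≈ partial G N
partial-cong zero    e = e 0 z≤n
partial-cong (suc N) e = ⊕-cong (partial-cong N λ k l → e k (m≤n⇒m≤1+n l)) (e (suc N) ≤-refl)

segment : (s d : ℕ) → Series
segment s zero    = 𝟙
segment s (suc d) = segment s d ⊛ 1-X (4 * (s + suc d))

segment-peel : ∀ s d → segment s (suc d) ≈ 1-X (4 * suc s) ⊛ segment (suc s) d
segment-peel s zero = ≈-trans (⊛-comm _ _) (⊛-cong (⊖-cong ≈-refl (X-cong (cong (4 *_) (+-comm s 1)))) ≈-refl)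
segment-peel s (suc d) = ≈-trans (⊛-cong (segment-peel s d) (⊖-cong ≈-refl (X-cong (cong (4 *_) (+-suc s (suc d))))))
  (⊛-assoc _ _ _)

segment-0 : ∀ d → segment 0 d ≈ euler 4 d
segment-0 zero    = ≈-refl
segment-0 (suc d) = ⊛-cong (segment-0 d) ≈-refl

-- Shanks' finite form, with x = Q⁴ and Y n s = yₙˢ: the sum T (n+1) - (1 - yₙ) T n telescopes.
module Shanks
  (z : Series) (y : ℕ → Series) (Y : ℕ → ℕ → Series)
  (zy : ∀ n → z ⊛ y n ≈ X (4 * suc n))
  (Y-zero : ∀ n → Y n 0 ≈ 𝟙)
  (Y-suc : ∀ n s → Y n (suc s) ≈ y n ⊛ Y n s)
  (Y-step : ∀ n s → Y (suc n) s ≈ X (4 * s) ⊛ Y n s)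
  where

  o : ℕ → Series
  o zero    = 𝟙
  o (suc s) = o s ⊛ (𝟙 ⊖ z ⊛ X (4 * s))

  term : ℕ → ℕ → Series
  term n s = segment s (n ∸ s) ⊛ o s ⊛ Y n s

  T : ℕ → Series
  T n = partial (term n) n

  V : ℕ → ℕ → Series
  V n s = segment s (n ∸ s) ⊛ o (suc s) ⊛ Y n (suc s)

  private
    core : ∀ n s → s ≤ n → term (suc n) s ≈ (𝟙 ⊖ y n) ⊛ term n s ⊕ V n s ⊖ 1-X (4 * s) ⊛ term n s
    core n s l = begin
      segment s (suc n ∸ s) ⊛ o s ⊛ Y (suc n) s
        ≈⟨ ⊛-cong (⊛-cong (≈-trans (≡⇒≈ (cong (segment s) (+-∸-assoc 1 l)))
              (⊛-congˡ (⊖-cong ≈-refl (≈-trans (X-cong (cong (4 *_) (trans (+-suc s (n ∸ s)) (cong suc (m+[n∸m]≡n l))))) (≈-sym (zy n)))))) ≈-refl) (Y-step n s) ⟩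
      A ⊛ (𝟙 ⊖ z ⊛ y n) ⊛ o s ⊛ (X (4 * s) ⊛ Y n s)
        ≈⟨ solve 6 (λ A z y o x Y → A :* (con (+ 1) :- z :* y) :* o :* (x :* Y) :=
             (con (+ 1) :- y) :* (A :* o :* Y) :+ A :* (o :* (con (+ 1) :- z :* x)) :* (y :* Y) :- (con (+ 1) :- x) :* (A :* o :* Y))
             ≈-refl A z (y n) (o s) (X (4 * s)) (Y n s) ⟩
      (𝟙 ⊖ y n) ⊛ term n s ⊕ A ⊛ o (suc s) ⊛ (y n ⊛ Y n s) ⊖ 1-X (4 * s) ⊛ term n s
        ≈⟨ ⊖-cong (⊕-congˡ (⊛-congˡ (≈-sym (Y-suc n s)))) ≈-refl ⟩
      (𝟙 ⊖ y n) ⊛ term n s ⊕ V n s ⊖ 1-X (4 * s) ⊛ term n s ∎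
      where
      open ≈-Reasoning
      A : Series
      A = segment s (n ∸ s)

    V-prev : ∀ n s → suc s ≤ n → 1-X (4 * suc s) ⊛ term n (suc s) ≈ V n s
    V-prev n s l = ≈-trans (≈-sym (≈-trans (⊛-assoc _ _ _) (≈-trans (⊛-assoc _ _ _) (⊛-congˡ (≈-sym (⊛-assoc _ _ _))))))
      (⊛-cong (⊛-cong (≈-trans (≈-sym (segment-peel s (n ∸ suc s))) (≡⇒≈ (cong (segment s) (sym (+-∸-assoc 1 l))))) ≈-refl) ≈-refl)

    telescope : ∀ n k → k ≤ n → partial (term (suc n)) k ≈ (𝟙 ⊖ y n) ⊛ partial (term n) k ⊕ V n k
    telescope n zero l = ≈-trans (core n 0 l)
      (≈-trans (⊖-cong ≈-refl (⊛-cong (⊖-cong ≈-refl X-0) ≈-refl))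
               (solve 2 (λ a b → a :- (con (+ 1) :- con (+ 1)) :* b := a) ≈-refl ((𝟙 ⊖ y n) ⊛ term n 0 ⊕ V n 0) (term n 0)))
    telescope n (suc k) l = begin
      partial (term (suc n)) k ⊕ term (suc n) (suc k)
        ≈⟨ ⊕-cong (telescope n k (<⇒≤ l)) (core n (suc k) l) ⟩
      ((𝟙 ⊖ y n) ⊛ partial (term n) k ⊕ V n k) ⊕ ((𝟙 ⊖ y n) ⊛ term n (suc k) ⊕ V n (suc k) ⊖ 1-X (4 * suc k) ⊛ term n (suc k))
        ≈⟨ ⊕-congˡ (⊖-cong ≈-refl (V-prev n k l)) ⟩
      ((𝟙 ⊖ y n) ⊛ partial (term n) k ⊕ V n k) ⊕ ((𝟙 ⊖ y n) ⊛ term n (suc k) ⊕ V n (suc k) ⊖ V n k)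
        ≈⟨ solve 5 (λ u p v t w → (u :* p :+ v) :+ (u :* t :+ w :- v) := u :* (p :+ t) :+ w) ≈-refl
             (𝟙 ⊖ y n) (partial (term n) k) (V n k) (term n (suc k)) (V n (suc k)) ⟩
      (𝟙 ⊖ y n) ⊛ partial (term n) (suc k) ⊕ V n (suc k) ∎
      where open ≈-Reasoning

  T-zero : T 0 ≈ 𝟙
  T-zero = ≈-trans (⊛-congˡ (Y-zero 0)) (≈-trans (⊛-cong (⊛-identityˡ 𝟙) ≈-refl) (⊛-identityˡ 𝟙))

  T-suc : ∀ n → T (suc n) ≈ (𝟙 ⊖ y n) ⊛ T n ⊕ (𝟙 ⊕ X (4 * suc n)) ⊛ (o (suc n) ⊛ Y n (suc n))
  T-suc n = begin
    partial (term (suc n)) n ⊕ term (suc n) (suc n)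
      ≈⟨ ⊕-cong (telescope n n ≤-refl) (⊛-congˡ (Y-step n (suc n))) ⟩
    ((𝟙 ⊖ y n) ⊛ T n ⊕ segment n (n ∸ n) ⊛ o (suc n) ⊛ Y n (suc n)) ⊕ segment (suc n) (n ∸ n) ⊛ o (suc n) ⊛ (X (4 * suc n) ⊛ Y n (suc n))
      ≈⟨ ⊕-cong (⊕-congˡ (⊛-cong (⊛-cong (≡⇒≈ (cong (segment n) (n∸n≡0 n))) ≈-refl) ≈-refl))
                (⊛-cong (⊛-cong (≡⇒≈ (cong (segment (suc n)) (n∸n≡0 n))) ≈-refl) ≈-refl) ⟩
    ((𝟙 ⊖ y n) ⊛ T n ⊕ 𝟙 ⊛ o (suc n) ⊛ Y n (suc n)) ⊕ 𝟙 ⊛ o (suc n) ⊛ (X (4 * suc n) ⊛ Y n (suc n))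
      ≈⟨ solve 4 (λ a o Y x → (a :+ con (+ 1) :* o :* Y) :+ con (+ 1) :* o :* (x :* Y) := a :+ (con (+ 1) :+ x) :* (o :* Y)) ≈-refl
           ((𝟙 ⊖ y n) ⊛ T n) (o (suc n)) (Y n (suc n)) (X (4 * suc n)) ⟩
    (𝟙 ⊖ y n) ⊛ T n ⊕ (𝟙 ⊕ X (4 * suc n)) ⊛ (o (suc n) ⊛ Y n (suc n)) ∎
    where open ≈-Reasoning

  T-lim : (∀ n → Ord (suc n) (y n)) → ∀ n → T n ≈[ n ] euler 4 n
  T-lim yo n = ≈[]-trans (partial-Ord (term n) n (λ k → Ord-⊛ʳ (segment (suc k) (n ∸ suc k) ⊛ o (suc k)) (Ord-≈ (Y-suc n k) (Ord-⊛ˡ (Y n k) (yo n)))) ≤-refl)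
    (≈⇒≈[] (≈-trans (⊛-congˡ (Y-zero n))
      (≈-trans (solve 1 (λ a → a :* con (+ 1) :* con (+ 1) := a) ≈-refl (segment 0 n)) (segment-0 n))))

double : ℕ → ℕ
double zero    = 0
double (suc n) = suc (suc (double n))

double≡ : ∀ n → double n ≡ 2 * n
double≡ zero    = refl
double≡ (suc n) = trans (cong (λ x → 2 + x) (double≡ n)) (lem n)
  where
  lem : ∀ n → 2 + 2 * n ≡ 2 * suc n
  lem = ℕR.solve-∀

n≤double : ∀ n → n ≤ double n
n≤double zero    = z≤n
n≤double (suc n) = s≤s (m≤n⇒m≤1+n (n≤double n))

ψ-term : ℕ → Series
ψ-term k = X (k * suc k)

ψ-fam : Fam
ψ-fam = natFam 0 1 ψ-term λ k → k , Ord-≤ (m≤m*n k (suc k)) (Ord-Xa _) , ≤-reflexive (sym (+-identityʳ k))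

ψ : Series
ψ = ∑ ψ-fam

module Gauss₁ where

  y : ℕ → Series
  y n = X (2 + 4 * n)

  Y : ℕ → ℕ → Series
  Y n s = X ((2 + 4 * n) * s)

  zy : ∀ n → X 2 ⊛ y n ≈ X (4 * suc n)
  zy n = ≈-trans (X-+ 2 (2 + 4 * n)) (X-cong (lem n))
    where
    lem : ∀ n → 2 + (2 + 4 * n) ≡ 4 * suc n
    lem = ℕR.solve-∀

  Y-zero : ∀ n → Y n 0 ≈ 𝟙
  Y-zero n = ≈-trans (X-cong (*-zeroʳ (2 + 4 * n))) X-0

  Y-suc : ∀ n s → Y n (suc s) ≈ y n ⊛ Y n s
  Y-suc n s = ≈-trans (X-cong (*-suc (2 + 4 * n) s)) (≈-sym (X-+ _ _))

  Y-step : ∀ n s → Y (suc n) s ≈ X (4 * s) ⊛ Y n s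
  Y-step n s = ≈-trans (X-cong (lem n s)) (≈-sym (X-+ _ _))
    where
    lem : ∀ n s → (2 + 4 * suc n) * s ≡ 4 * s + (2 + 4 * n) * s
    lem = ℕR.solve-∀

  open Shanks (X 2) y Y zy Y-zero Y-suc Y-step

  Ψ : ℕ → Series
  Ψ n = partial ψ-term (double n)

  T-product : ∀ n → T n ≈ o n ⊛ Ψ n
  T-product zero    = ≈-trans T-zero (≈-sym (≈-trans (⊛-identityˡ _) X-0))
  T-product (suc n) = begin
    T (suc n) ≈⟨ T-suc n ⟩
    (𝟙 ⊖ X (2 + 4 * n)) ⊛ T n ⊕ (𝟙 ⊕ X (4 * suc n)) ⊛ (o (suc n) ⊛ X ((2 + 4 * n) * suc n))
      ≈⟨ ⊕-cong (⊛-cong (⊖-cong ≈-refl (≈-sym (X-+ 2 (4 * n)))) (T-product n)) ≈-refl ⟩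
    (𝟙 ⊖ X 2 ⊛ X (4 * n)) ⊛ (o n ⊛ Ψ n) ⊕ (𝟙 ⊕ X (4 * suc n)) ⊛ (o (suc n) ⊛ X ((2 + 4 * n) * suc n))
      ≈⟨ solve 5 (λ u o p x y → u :* (o :* p) :+ (con (+ 1) :+ x) :* (o :* u :* y) := o :* u :* (p :+ y :+ x :* y)) ≈-refl
           (𝟙 ⊖ X 2 ⊛ X (4 * n)) (o n) (Ψ n) (X (4 * suc n)) (X ((2 + 4 * n) * suc n)) ⟩
    o (suc n) ⊛ (Ψ n ⊕ X ((2 + 4 * n) * suc n) ⊕ X (4 * suc n) ⊛ X ((2 + 4 * n) * suc n))
      ≈⟨ ⊛-congˡ (⊕-cong (⊕-congˡ (X-cong (e₁ n))) (≈-trans (X-+ _ _) (X-cong (e₂ n)))) ⟩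
    o (suc n) ⊛ Ψ (suc n) ∎
    where
    open ≈-Reasoning
    l₁ : ∀ n → (2 + 4 * n) * suc n ≡ suc (2 * n) * suc (suc (2 * n))
    l₁ = ℕR.solve-∀
    l₂ : ∀ n → 4 * suc n + (2 + 4 * n) * suc n ≡ suc (suc (2 * n)) * suc (suc (suc (2 * n)))
    l₂ = ℕR.solve-∀
    e₁ : ∀ n → (2 + 4 * n) * suc n ≡ suc (double n) * suc (suc (double n))
    e₁ n rewrite double≡ n = l₁ n
    e₂ : ∀ n → 4 * suc n + (2 + 4 * n) * suc n ≡ suc (suc (double n)) * suc (suc (suc (double n)))
    e₂ n rewrite double≡ n = l₂ n

  o-euler : ∀ n → o n ⊛ euler 4 n ≈ euler 2 (double n)
  o-euler zero    = ⊛-identityˡ 𝟙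
  o-euler (suc n) = ≈-trans
    (solve 4 (λ o u e v → o :* u :* (e :* v) := o :* e :* u :* v) ≈-refl (o n) (𝟙 ⊖ X 2 ⊛ X (4 * n)) (euler 4 n) (1-X (4 * suc n)))
    (⊛-cong (⊛-cong (o-euler n) (⊖-cong ≈-refl (≈-trans (X-+ 2 (4 * n)) (X-cong (e₁ n))))) (⊖-cong ≈-refl (X-cong (e₂ n))))
    where
    l₁ : ∀ n → 2 + 4 * n ≡ 2 * suc (2 * n)
    l₁ = ℕR.solve-∀
    l₂ : ∀ n → 4 * suc n ≡ 2 * suc (suc (2 * n))
    l₂ = ℕR.solve-∀
    e₁ : ∀ n → 2 + 4 * n ≡ 2 * suc (double n)
    e₁ n rewrite double≡ n = l₁ n
    e₂ : ∀ n → 4 * suc n ≡ 2 * suc (suc (double n))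
    e₂ n rewrite double≡ n = l₂ n

  gauss₁ : euler∞ 2 ⊛ ψ ≈ euler∞ 4 ⊛ euler∞ 4
  gauss₁ = mk≈ λ n →
    let (B , lim) = ∑-lim ψ-fam n
        N = B ⊔ n
        n≤N = m≤n⊔m B n
        weaken : ∀ {f g} → f ≈[ N ] g → f ≈[ n ] g
        weaken e i l = e i (≤-trans l n≤N)
    in ≈[]-trans
         (⊛-cong[] {euler∞ 2} n (≈[]-sym (euler-lim 2 n (double N) (≤-trans n≤N (n≤double N))))
           (≈[]-trans (≈[]-sym (lim (double N) (≤-trans (m≤m⊔n B n) (n≤double N)))) (≈⇒≈[] (ball-extend ψ-term (double N)))))
       (≈[]-trans (≈⇒≈[] (≈-trans (⊛-cong (≈-sym (o-euler N)) ≈-refl)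
                   (≈-trans (solve 3 (λ o e p → o :* e :* p := e :* (o :* p)) ≈-refl (o N) (euler 4 N) (Ψ N))
                            (⊛-congˡ (≈-sym (T-product N))))))
       (⊛-cong[] {euler 4 N} n (euler-lim 4 n N n≤N)
         (≈[]-trans (weaken (T-lim (λ m → Ord-≤ (s≤s (≤-trans (m≤n*m m 4) (n≤1+n (4 * m)))) (Ord-Xa _)) N)) (euler-lim 4 n N n≤N))))
       n ≤-refl

sgn : ℕ → ℤ
sgn zero    = + 1
sgn (suc n) = -ᶻ sgn n

n≤n² : ∀ n → n ≤ n * n
n≤n² zero    = z≤n
n≤n² (suc n) = m≤m*n (suc n) (suc n)

n≤4n² : ∀ n → n ≤ 0 + 1 * (4 * (n * n))
n≤4n² n = ≤-trans (n≤n² n) (≤-trans (m≤n*m (n * n) 4) (m≤m+n _ 0))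

θ-fam θ⁻-fam : Fam
θ-fam  = ordFam 0 1 (λ k → X (4 * (∣ k ∣ * ∣ k ∣))) λ k →
  4 * (∣ k ∣ * ∣ k ∣) , Ord-Xa _ , n≤4n² ∣ k ∣
θ⁻-fam = ordFam 0 1 (λ k → const (sgn ∣ k ∣) ⊛ X (4 * (∣ k ∣ * ∣ k ∣))) λ k →
  4 * (∣ k ∣ * ∣ k ∣) , Ord-⊛ʳ (const (sgn ∣ k ∣)) (Ord-Xa _) , n≤4n² ∣ k ∣

θ θ⁻ : Series
θ  = ∑ θ-fam
θ⁻ = ∑ θ⁻-fam

module Gauss₂ where

  y : ℕ → Series
  y n = ⊝ X (4 * suc n)

  Y : ℕ → ℕ → Series
  Y n s = const (sgn s) ⊛ X (4 * suc n * s)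

  zy : ∀ n → ⊝ 𝟙 ⊛ y n ≈ X (4 * suc n)
  zy n = solve 1 (λ x → (:- con (+ 1)) :* (:- x) := x) ≈-refl (X (4 * suc n))

  Y-zero : ∀ n → Y n 0 ≈ 𝟙
  Y-zero n = ≈-trans (⊛-identityˡ _) (≈-trans (X-cong (*-zeroʳ (4 * suc n))) X-0)

  Y-suc : ∀ n s → Y n (suc s) ≈ y n ⊛ Y n s
  Y-suc n s = ≈-trans (⊛-cong (const-neg (sgn s)) (≈-trans (X-cong (*-suc (4 * suc n) s)) (≈-sym (X-+ _ _))))
    (solve 3 (λ c x y → (:- c) :* (x :* y) := (:- x) :* (c :* y)) ≈-refl (const (sgn s)) (X (4 * suc n)) (X (4 * suc n * s)))

  Y-step : ∀ n s → Y (suc n) s ≈ X (4 * s) ⊛ Y n s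
  Y-step n s = ≈-trans (⊛-congˡ (≈-trans (X-cong (lem n s)) (≈-sym (X-+ _ _))))
    (solve 3 (λ c x y → c :* (x :* y) := x :* (c :* y)) ≈-refl (const (sgn s)) (X (4 * s)) (X (4 * suc n * s)))
    where
    lem : ∀ n s → 4 * suc (suc n) * s ≡ 4 * s + 4 * suc n * s
    lem = ℕR.solve-∀

  open Shanks (⊝ 𝟙) y Y zy Y-zero Y-suc Y-step

  M : ℕ → Series
  M zero    = 𝟙
  M (suc n) = M n ⊛ (𝟙 ⊕ X (4 * suc n))

  o-M : ∀ n → o (suc n) ≈ const (+ 2) ⊛ M n
  o-M zero = ≈-trans (⊛-congˡ (⊖-cong ≈-refl (⊛-congˡ X-0)))
    (solve 0 (con (+ 1) :* (con (+ 1) :- (:- con (+ 1)) :* con (+ 1)) := con (+ 2) :* con (+ 1)) ≈-refl)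
  o-M (suc n) = ≈-trans (⊛-cong (o-M n) ≈-refl)
    (solve 2 (λ m x → con (+ 2) :* m :* (con (+ 1) :- (:- con (+ 1)) :* x) := con (+ 2) :* (m :* (con (+ 1) :+ x))) ≈-refl (M n) (X (4 * suc n)))

  Θ : ℕ → Series
  Θ = ball (fn θ⁻-fam)

  T-product : ∀ n → T n ≈ M n ⊛ Θ n
  T-product zero    = ≈-trans T-zero (≈-sym (≈-trans (⊛-identityˡ _) (≈-trans (⊛-identityˡ _) X-0)))
  T-product (suc n) = begin
    T (suc n) ≈⟨ T-suc n ⟩
    (𝟙 ⊖ ⊝ X (4 * suc n)) ⊛ T n ⊕ (𝟙 ⊕ X (4 * suc n)) ⊛ (o (suc n) ⊛ Y n (suc n))
      ≈⟨ ⊕-cong (⊛-congˡ (T-product n)) (⊛-congˡ (⊛-cong (o-M n) (⊛-congˡ (X-cong (*-assoc 4 (suc n) (suc n)))))) ⟩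
    (𝟙 ⊖ ⊝ X (4 * suc n)) ⊛ (M n ⊛ Θ n) ⊕ (𝟙 ⊕ X (4 * suc n)) ⊛ (const (+ 2) ⊛ M n ⊛ Z)
      ≈⟨ solve 4 (λ x m t z → (con (+ 1) :- (:- x)) :* (m :* t) :+ (con (+ 1) :+ x) :* (con (+ 2) :* m :* z) := m :* (con (+ 1) :+ x) :* (t :+ (z :+ z))) ≈-refl
           (X (4 * suc n)) (M n) (Θ n) Z ⟩
    M (suc n) ⊛ Θ (suc n) ∎
    where
    open ≈-Reasoning
    Z : Series
    Z = const (sgn (suc n)) ⊛ X (4 * (suc n * suc n))

  M-euler : ∀ n → M n ⊛ euler 4 n ≈ euler 8 n
  M-euler zero    = ⊛-identityˡ 𝟙
  M-euler (suc n) = ≈-trans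
    (solve 3 (λ m x e → m :* (con (+ 1) :+ x) :* (e :* (con (+ 1) :- x)) := m :* e :* (con (+ 1) :- x :* x)) ≈-refl (M n) (X (4 * suc n)) (euler 4 n))
    (⊛-cong (M-euler n) (⊖-cong ≈-refl (≈-trans (X-+ _ _) (X-cong (lem n)))))
    where
    lem : ∀ n → 4 * suc n + 4 * suc n ≡ 8 * suc n
    lem = ℕR.solve-∀

  gauss₂ : euler∞ 8 ⊛ θ⁻ ≈ euler∞ 4 ⊛ euler∞ 4
  gauss₂ = mk≈ λ n →
    let (B , lim) = ∑-lim θ⁻-fam n
        N = B ⊔ n
        n≤N = m≤n⊔m B n
        weaken : ∀ {f g} → f ≈[ N ] g → f ≈[ n ] g
        weaken e i l = e i (≤-trans l n≤N)
    in ≈[]-trans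
         (⊛-cong[] {euler∞ 8} n (≈[]-sym (euler-lim 8 n N n≤N)) (≈[]-sym (lim N (m≤m⊔n B n))))
       (≈[]-trans (≈⇒≈[] (≈-trans (⊛-cong (≈-sym (M-euler N)) ≈-refl)
                   (≈-trans (solve 3 (λ o e p → o :* e :* p := e :* (o :* p)) ≈-refl (M N) (euler 4 N) (Θ N))
                            (⊛-congˡ (≈-sym (T-product N))))))
       (⊛-cong[] {euler 4 N} n (euler-lim 4 n N n≤N)
         (≈[]-trans (weaken (T-lim (λ m → Ord-⊝ (Ord-≤ (m≤n*m (suc m) 4) (Ord-Xa _))) N)) (euler-lim 4 n N n≤N))))
       n ≤-refl

open Gauss₁ using (gauss₁)
open Gauss₂ using (gauss₂)

-- Supports modulo 8

%8-cong-+ : ∀ a b c d → a % 8 ≡ c % 8 → b % 8 ≡ d % 8 → (a + b) % 8 ≡ (c + d) % 8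
%8-cong-+ a b c d p q = trans (DivMod.%-distribˡ-+ a b 8)
  (trans (cong₂ (λ x y → (x + y) % 8) p q) (sym (DivMod.%-distribˡ-+ c d 8)))

%8-cancel : ∀ a b c d → a % 8 ≡ c % 8 → (a + b) % 8 ≡ (c + d) % 8 → b % 8 ≡ d % 8
%8-cancel a b c d p q = begin
  b % 8                 ≡⟨ sym (DivMod.[m+kn]%n≡m%n b a 8) ⟩
  (b + a * 8) % 8       ≡⟨ cong (_% 8) (lem a b) ⟩
  (7 * a + (a + b)) % 8 ≡⟨ %8-cong-+ (7 * a) (a + b) (7 * c) (c + d) 7a≡7c q ⟩
  (7 * c + (c + d)) % 8 ≡⟨ cong (_% 8) (sym (lem c d)) ⟩
  (d + c * 8) % 8       ≡⟨ DivMod.[m+kn]%n≡m%n d c 8 ⟩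
  d % 8                 ∎
  where
  open ≡-Reasoning
  lem : ∀ a b → b + a * 8 ≡ 7 * a + (a + b)
  lem = ℕR.solve-∀
  7a≡7c : (7 * a) % 8 ≡ (7 * c) % 8
  7a≡7c = trans (DivMod.%-distribˡ-* 7 a 8) (trans (cong (λ x → (7 * x) % 8) p) (sym (DivMod.%-distribˡ-* 7 c 8)))

Supp : ℕ → Series → Set
Supp r f = ∀ n → n % 8 ≢ r % 8 → f n ≡ + 0

Van : ℕ → Series → Set
Van r f = ∀ n → n % 8 ≡ r % 8 → f n ≡ + 0

Supp-⊛ : ∀ a b {f g} → Supp a f → Supp b g → Supp (a + b) (f ⊛ g)
Supp-⊛ a b {f} {g} p q n n≢ = ⊛-zero-at f g n go
  where
  go : ∀ i j → i + j ≡ n → f i *ᶻ g j ≡ + 0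
  go i j refl with i % 8 ≟ a % 8 | j % 8 ≟ b % 8
  ... | no i≢ | _     = cong (_*ᶻ g j) (p i i≢)
  ... | yes _ | no j≢ = trans (cong (f i *ᶻ_) (q j j≢)) (ℤP.*-zeroʳ (f i))
  ... | yes e | yes d = ⊥-elim (n≢ (%8-cong-+ i j a b e d))

Van-⊛ : ∀ a r {f g} → Supp a f → Van r g → Van (a + r) (f ⊛ g)
Van-⊛ a r {f} {g} p v n n≡ = ⊛-zero-at f g n go
  where
  go : ∀ i j → i + j ≡ n → f i *ᶻ g j ≡ + 0
  go i j refl with i % 8 ≟ a % 8
  ... | no i≢ = cong (_*ᶻ g j) (p i i≢)
  ... | yes e = trans (cong (f i *ᶻ_) (v j (%8-cancel i j a r e n≡))) (ℤP.*-zeroʳ (f i))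

Supp-≈ : ∀ r {f g} → f ≈ g → Supp r g → Supp r f
Supp-≈ r e p n n≢ = trans (at e n) (p n n≢)

Van-≈ : ∀ r {f g} → f ≈ g → Van r g → Van r f
Van-≈ r e p n n≡ = trans (at e n) (p n n≡)

Supp-∑ : ∀ r F → (∀ k → Supp r (fn F k)) → Supp r (∑ F)
Supp-∑ r F p n n≢ = ∑-zero-at F n λ k → p k n n≢

Van-∑ : ∀ r F → (∀ k → Van r (fn F k)) → Van r (∑ F)
Van-∑ r F p n n≡ = ∑-zero-at F n λ k → p k n n≡

opaque
  unfolding X

  X-off : ∀ e n → n ≢ e → X e n ≡ + 0
  X-off zero    zero    n≢ = ⊥-elim (n≢ refl)
  X-off zero    (suc n) n≢ = refl
  X-off (suc e) zero    n≢ = refl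
  X-off (suc e) (suc n) n≢ = X-off e n (n≢ ∘ cong suc)

  X-on : ∀ e → X e e ≡ + 1
  X-on zero    = refl
  X-on (suc e) = X-on e

Supp-X : ∀ e → Supp e (X e)
Supp-X e n n≢ = X-off e n λ { refl → n≢ refl }

Supp-const : ∀ x → Supp 0 (const x)
Supp-const x zero    n≢ = ⊥-elim (n≢ refl)
Supp-const x (suc n) n≢ = refl

Supp-⊕ : ∀ r {f g} → Supp r f → Supp r g → Supp r (f ⊕ g)
Supp-⊕ r {f} {g} p q n n≢ = trans (⊕-at f g n) (cong₂ _+ᶻ_ (p n n≢) (q n n≢))

Supp-⊝ : ∀ r {f} → Supp r f → Supp r (⊝ f)
Supp-⊝ r {f} p n n≢ = trans (⊝-at f n) (cong -ᶻ_ (p n n≢))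

Supp-% : ∀ r s {f} → r % 8 ≡ s % 8 → Supp r f → Supp s f
Supp-% r s e p n n≢ = p n λ d → n≢ (trans d e)

opaque
  unfolding _⊛_

  ⊛-0 : ∀ f g → (f ⊛ g) 0 ≡ f 0 *ᶻ g 0
  ⊛-0 f g = refl

  ⊛-single-at : ∀ f g a m → (∀ i j → i + j ≡ a + m → i ≢ a → f i *ᶻ g j ≡ + 0) → (f ⊛ g) (a + m) ≡ f a *ᶻ g m
  ⊛-single-at f g zero    zero    z = refl
  ⊛-single-at f g zero    (suc m) z = trans (cong (f 0 *ᶻ g (suc m) +ᶻ_)
    (⊛-zero-at (tail f) g m λ i j e → z (suc i) j (cong suc e) λ ())) (ℤP.+-identityʳ _)
  ⊛-single-at f g (suc a) m       z = trans (cong (_+ᶻ (tail f ⊛ g) (a + m)) (z 0 (suc (a + m)) refl λ ()))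
    (trans (ℤP.+-identityˡ _) (⊛-single-at (tail f) g a m λ i j e i≢ → z (suc i) j (cong suc e) (i≢ ∘ suc-injective)))

Van-cancel : ∀ a r {f g} → Ord a f → f a ≢ + 0 → Supp a f → Van (a + r) (f ⊛ g) → Van r g
Van-cancel a r {f} {g} o fa p v = λ n → go n n ≤-refl
  where
  go : ∀ b m → m ≤ b → m % 8 ≡ r % 8 → g m ≡ + 0
  others : ∀ b m → m ≤ b → m % 8 ≡ r % 8 → ∀ i j → i + j ≡ a + m → i ≢ a → f i *ᶻ g j ≡ + 0

  go b m l m≡ with ℤP.i*j≡0⇒i≡0∨j≡0 (f a) (trans (sym (⊛-single-at f g a m (others b m l m≡))) (v (a + m) (%8-cong-+ a m a r refl m≡)))
  ... | inj₁ z = ⊥-elim (fa z)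
  ... | inj₂ z = z

  others b m l m≡ i j e i≢ with i <? a
  ... | yes i<a = cong (_*ᶻ g j) (o i i<a)
  ... | no  i≮a with i % 8 ≟ a % 8
  ...   | no ne = cong (_*ᶻ g j) (p i ne)
  others zero m l m≡ i j e i≢ | no i≮a | yes d =
    ⊥-elim (<-irrefl (sym e) (subst (λ x → a + x < i + j) (sym (n≤0⇒n≡0 l)) (subst (_< i + j) (sym (+-identityʳ a)) (<-≤-trans (≤∧≢⇒< (≮⇒≥ i≮a) (i≢ ∘ sym)) (m≤m+n i j)))))
  others (suc b) m l m≡ i j e i≢ | no i≮a | yes d =
    trans (cong (f i *ᶻ_) (go b j (≤-pred (≤-trans j<m l)) (trans (%8-cancel i j a m d (cong (_% 8) e)) m≡))) (ℤP.*-zeroʳ (f i))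
    where
    j<m : j < m
    j<m = ≰⇒> λ m≤j → <-irrefl (sym e) (+-mono-<-≤ (≤∧≢⇒< (≮⇒≥ i≮a) (i≢ ∘ sym)) m≤j)

opaque
  unfolding ∑ _⊕_

  ∑-single-at : ∀ F n → (∀ k → k ≢ + 0 → fn F k n ≡ + 0) → ∑ F n ≡ fn F (+ 0) n
  ∑-single-at F n z = go (proj₁ (null F n))
    where
    go : ∀ N → ball (fn F) N n ≡ fn F (+ 0) n
    go zero    = refl
    go (suc N) = trans (cong₂ _+ᶻ_ (go N) (cong₂ _+ᶻ_ (z (+ suc N) λ ()) (z -[1+ N ] λ ()))) (ℤP.+-identityʳ _)

  ball-scale-at : ∀ x F G n → (∀ k → F k n ≡ x *ᶻ G k n) → ∀ N → ball F N n ≡ x *ᶻ ball G N n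
  ball-scale-at x F G n e zero    = e (+ 0)
  ball-scale-at x F G n e (suc N) = trans (cong₂ _+ᶻ_ (ball-scale-at x F G n e N) (cong₂ _+ᶻ_ (e _) (e _)))
    (lem x (ball G N n) (G (+ suc N) n) (G -[1+ N ] n))
    where
    lem : ∀ x a b c → x *ᶻ a +ᶻ (x *ᶻ b +ᶻ x *ᶻ c) ≡ x *ᶻ (a +ᶻ (b +ᶻ c))
    lem = ℤR.solve-∀

  ∑-scale-at : ∀ x F G n → (∀ k → fn F k n ≡ x *ᶻ fn G k n) → ∑ F n ≡ x *ᶻ ∑ G n
  ∑-scale-at x F G n e =
    let (B , p) = ∑-lim F n ; (B′ , p′) = ∑-lim G n
        N = B ⊔ B′
    in trans (sym (p N (m≤m⊔n B B′) n ≤-refl))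
      (trans (ball-scale-at x (fn F) (fn G) n e N) (cong (x *ᶻ_) (p′ N (m≤n⊔m B B′) n ≤-refl)))

euler-Supp : ∀ K → Supp 0 (euler 8 K)
euler-Supp zero    = Supp-const (+ 1)
euler-Supp (suc K) = Supp-⊛ 0 0 (euler-Supp K) (Supp-⊕ 0 (Supp-const (+ 1)) (Supp-⊝ 0 (Supp-% (8 * suc K) 0 (trans (cong (_% 8) (*-comm 8 (suc K))) (DivMod.m*n%n≡0 (suc K) 8)) (Supp-X (8 * suc K)))))

euler∞-Supp : Supp 0 (euler∞ 8)
euler∞-Supp n = euler-Supp n n

square-step : ∀ k → (4 * (suc (suc k) * suc (suc k))) % 8 ≡ (4 * (k * k)) % 8
square-step k = trans (cong (_% 8) (lem k)) (DivMod.[m+kn]%n≡m%n (4 * (k * k)) (2 * k + 2) 8)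
  where
  lem : ∀ k → 4 * (suc (suc k) * suc (suc k)) ≡ 4 * (k * k) + (2 * k + 2) * 8
  lem = ℕR.solve-∀

SgnClass : ℕ → Set
SgnClass k = (sgn k ≡ + 1 × (4 * (k * k)) % 8 ≡ 0) ⊎ (sgn k ≡ -[1+ 0 ] × (4 * (k * k)) % 8 ≡ 4)

sgn-class : ∀ k → SgnClass k
sgn-class zero = inj₁ (refl , refl)
sgn-class (suc zero) = inj₂ (refl , refl)
sgn-class (suc (suc k)) with sgn-class k
... | inj₁ (s , e) = inj₁ (trans (ℤP.neg-involutive (sgn k)) s , trans (square-step k) e)
... | inj₂ (s , e) = inj₂ (trans (ℤP.neg-involutive (sgn k)) s , trans (square-step k) e)

θ⁻-even : ∀ n → n % 8 ≢ 4 → θ⁻ n ≡ + 1 *ᶻ θ n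
θ⁻-even n n≢ = ∑-scale-at (+ 1) θ⁻-fam θ-fam n λ k → trans (const-⊛ (sgn ∣ k ∣) _ n) (go ∣ k ∣ (sgn-class ∣ k ∣))
  where
  go : ∀ k → SgnClass k → sgn k *ᶻ X (4 * (k * k)) n ≡ + 1 *ᶻ X (4 * (k * k)) n
  go k (inj₁ (s , _)) = cong (_*ᶻ X (4 * (k * k)) n) s
  go k (inj₂ (s , e)) = let z = Supp-X (4 * (k * k)) n (λ d → n≢ (trans d e)) in
    trans (cong (sgn k *ᶻ_) z) (trans (ℤP.*-zeroʳ (sgn k)) (sym (cong (+ 1 *ᶻ_) z)))

θ⁻-odd : ∀ n → n % 8 ≢ 0 → θ⁻ n ≡ -[1+ 0 ] *ᶻ θ n
θ⁻-odd n n≢ = ∑-scale-at -[1+ 0 ] θ⁻-fam θ-fam n λ k → trans (const-⊛ (sgn ∣ k ∣) _ n) (go ∣ k ∣ (sgn-class ∣ k ∣))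
  where
  go : ∀ k → SgnClass k → sgn k *ᶻ X (4 * (k * k)) n ≡ -[1+ 0 ] *ᶻ X (4 * (k * k)) n
  go k (inj₂ (s , _)) = cong (_*ᶻ X (4 * (k * k)) n) s
  go k (inj₁ (s , e)) = let z = Supp-X (4 * (k * k)) n (λ d → n≢ (trans d e)) in
    trans (cong (sgn k *ᶻ_) z) (trans (ℤP.*-zeroʳ (sgn k)) (sym (cong (-[1+ 0 ] *ᶻ_) z)))

self-neg⇒0 : ∀ {x} → x ≡ -ᶻ x → x ≡ + 0
self-neg⇒0 {+ zero} _ = refl

data θ-Class (n : ℕ) : Set where
  even  : n % 8 ≡ 0 → θ⁻ n ≡ θ n → θ-Class n
  odd   : n % 8 ≡ 4 → θ⁻ n ≡ -ᶻ θ n → θ-Class n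
  other : θ n ≡ + 0 → θ⁻ n ≡ + 0 → θ-Class n

θ-class : ∀ n → θ-Class n
θ-class n with n % 8 ≟ 0 | n % 8 ≟ 4
... | yes e | _     = even e (trans (θ⁻-even n λ d → case trans (sym e) d of λ ()) (ℤP.*-identityˡ (θ n)))
... | no n≢ | yes e = odd e (trans (θ⁻-odd n n≢) (ℤP.-1*i≡-i (θ n)))
... | no n≢ | no n≢′ = other θ≡0 (trans ev (trans (ℤP.*-identityˡ (θ n)) θ≡0))
  where
  ev = θ⁻-even n n≢′
  θ≡0 : θ n ≡ + 0
  θ≡0 = self-neg⇒0 (trans (sym (ℤP.*-identityˡ (θ n))) (trans (sym ev) (trans (θ⁻-odd n n≢) (ℤP.-1*i≡-i (θ n)))))

opaque
  unfolding _⊛_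

  ⊛-anti-at : ∀ f g f′ g′ n → (∀ i j → i + j ≡ n → f i *ᶻ g j ≡ -ᶻ (f′ i *ᶻ g′ j)) → (f ⊛ g) n ≡ -ᶻ (f′ ⊛ g′) n
  ⊛-anti-at f g f′ g′ zero    e = e 0 0 refl
  ⊛-anti-at f g f′ g′ (suc n) e = trans (cong₂ _+ᶻ_ (e 0 (suc n) refl) (⊛-anti-at (tail f) g (tail f′) g′ n λ i j d → e (suc i) j (cong suc d)))
    (sym (ℤP.neg-distrib-+ (f′ 0 *ᶻ g′ (suc n)) _))

θθ⁻-Supp : Supp 0 (θ ⊛ θ⁻)
θθ⁻-Supp n n≢ = self-neg⇒0 (trans (⊛-anti-at θ θ⁻ θ⁻ θ n (λ i j e → go i j e (θ-class i) (θ-class j))) (cong -ᶻ_ (at (⊛-comm θ⁻ θ) n)))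
  where
  go : ∀ i j → i + j ≡ n → θ-Class i → θ-Class j → θ i *ᶻ θ⁻ j ≡ -ᶻ (θ⁻ i *ᶻ θ j)
  go i j e (other a b) _ = trans (cong (_*ᶻ θ⁻ j) a) (sym (cong (λ x → -ᶻ (x *ᶻ θ j)) b))
  go i j e _ (other p q) = trans (cong (θ i *ᶻ_) q) (trans (ℤP.*-zeroʳ (θ i))
    (sym (trans (cong (λ x → -ᶻ (θ⁻ i *ᶻ x)) p) (cong -ᶻ_ (ℤP.*-zeroʳ (θ⁻ i))))))
  go i j refl (even a b) (even p q) = ⊥-elim (n≢ (%8-cong-+ i j 0 0 a p))
  go i j refl (odd a b) (odd p q) = ⊥-elim (n≢ (%8-cong-+ i j 4 4 a p))
  go i j e (even a b) (odd p q) = trans (cong (θ i *ᶻ_) q)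
    (trans (sym (ℤP.neg-distribʳ-* (θ i) (θ j))) (cong (λ x → -ᶻ (x *ᶻ θ j)) (sym b)))
  go i j e (odd a b) (even p q) = trans (cong (θ i *ᶻ_) q)
    (sym (trans (cong (λ x → -ᶻ (x *ᶻ θ j)) b) (trans (cong -ᶻ_ (sym (ℤP.neg-distribˡ-* (θ i) (θ j)))) (ℤP.neg-involutive _))))

K : Series
K = euler∞ 2 ⊛ ψ ⊛ θ

K≈ : K ≈ euler∞ 8 ⊛ (θ ⊛ θ⁻)
K≈ = ≈-trans (⊛-cong (≈-trans gauss₁ (≈-sym gauss₂)) ≈-refl)
  (solve 3 (λ e t u → e :* u :* t := e :* (t :* u)) ≈-refl (euler∞ 8) θ θ⁻)

K-Supp : Supp 0 K
K-Supp = Supp-≈ 0 K≈ (Supp-⊛ 0 0 euler∞-Supp θθ⁻-Supp)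

X-at-0 : ∀ e → e ≢ 0 → X e 0 ≡ + 0
X-at-0 e e≢ = X-off e 0 (e≢ ∘ sym)

K-head : K 0 ≢ + 0
K-head z = case trans (sym K0) z of λ ()
  where
  ψ0 : ψ 0 ≡ + 1
  ψ0 = trans (∑-single-at ψ-fam 0 λ { (+ zero) k≢ → ⊥-elim (k≢ refl) ; (+ suc k) _ → X-at-0 (suc k * suc (suc k)) λ () ; -[1+ k ] _ → refl }) (X-on 0)
  θ0 : θ 0 ≡ + 1
  θ0 = trans (∑-single-at θ-fam 0 λ { (+ zero) k≢ → ⊥-elim (k≢ refl) ; (+ suc k) _ → X-at-0 (4 * (suc k * suc k)) λ () ; -[1+ k ] _ → X-at-0 (4 * (suc k * suc k)) λ () }) (X-on 0)
  K0 : K 0 ≡ + 1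
  K0 = trans (⊛-0 (euler∞ 2 ⊛ ψ) θ) (cong₂ _*ᶻ_ (trans (⊛-0 (euler∞ 2) ψ) (cong (+ 1 *ᶻ_) ψ0)) θ0)

-- Theta convolutions

∑-flip : ∀ H F → (∀ k → fn H k ≈ fn F (+ 1 -ᶻ k)) → ∑ H ≈ ∑ F
∑-flip H F e = ≈-trans (∑-reflect H (shiftFam (+ 1) F) λ k → ≈-trans (e k) (≡⇒≈ (cong (fn F) (ℤP.+-comm (+ 1) (-ᶻ k)))))
                       (∑-shift (+ 1) (shiftFam (+ 1) F) F λ _ → ≈-refl)

scaleFam : Series → Fam → Fam
scaleFam g F = fam (λ k → g ⊛ fn F k) λ n → let (B , z) = null F n in
  B , λ k l i i≤n → Ord-⊛ʳ {suc n} g (λ j j≤n → z k l j (≤-pred j≤n)) i (s≤s i≤n)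

∑-⊝ : ∀ H F → (∀ k → fn H k ≈ ⊝ fn F k) → ∑ H ≈ ⊝ ∑ F
∑-⊝ H F e = ≈-trans (∑-⊛ H (⊝ 𝟙) F λ k → ≈-trans (e k) (solve 1 (λ f → :- f := (:- con (+ 1)) :* f) ≈-refl (fn F k)))
  (solve 1 (λ f → (:- con (+ 1)) :* f := :- f) ≈-refl (∑ F))

self-neg≈𝟘 : ∀ {f} → f ≈ ⊝ f → f ≈ 𝟘
self-neg≈𝟘 {f} e = mk≈ λ n → trans (self-neg⇒0 (trans (at e n) (⊝-at f n))) (sym (𝟘-at n))

tri : ℤ → ℕ
tri k = ∣ k *ᶻ (k -ᶻ + 1) ∣

+tri : ∀ k → + tri k ≡ k *ᶻ (k -ᶻ + 1)
+tri (+ zero)  = refl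
+tri (+ suc n) = trans (cong +_ (ℤP.abs-* (+ suc n) (+ n))) (ℤP.pos-* (suc n) n)
+tri -[1+ n ]  = refl

+sq : ∀ k → + (∣ k ∣ * ∣ k ∣) ≡ k *ᶻ k
+sq (+ n)    = ℤP.pos-* n n
+sq -[1+ n ] = refl

tri-bound : ∀ k → ∣ k ∣ ≤ 1 + tri k
tri-bound (+ zero)  = z≤n
tri-bound (+ suc n) = s≤s (subst (n ≤_) (sym (ℤP.abs-* (+ suc n) (+ n))) (m≤m+n n (n * n)))
tri-bound -[1+ n ]  = m≤n⇒m≤1+n (subst (suc n ≤_) (sym (ℤP.abs-* -[1+ n ] -[1+ suc (n + 0) ])) (m≤m*n (suc n) (suc (suc (n + 0)))))

tri-flip : ∀ k → tri (+ 1 -ᶻ k) ≡ tri k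
tri-flip k = cong ∣_∣ (lem k)
  where
  lem : ∀ k → (+ 1 -ᶻ k) *ᶻ ((+ 1 -ᶻ k) -ᶻ + 1) ≡ k *ᶻ (k -ᶻ + 1)
  lem = ℤR.solve-∀

sgn-flip : ∀ k → sgn ∣ + 1 -ᶻ k ∣ ≡ -ᶻ sgn ∣ k ∣
sgn-flip (+ zero)        = refl
sgn-flip (+ suc zero)    = refl
sgn-flip (+ suc (suc n)) = sym (ℤP.neg-involutive (sgn (suc n)))
sgn-flip -[1+ n ]        = refl

hat-unhat : ∀ u x y i → + x ≡ + y +ᶻ i → X y ⊛ hat u i ≈ X x ⊛ unhat u i
hat-unhat u x y (+ n) e = X-merge y n (u n) (sym (ℤP.+-injective (trans e (sym (ℤP.pos-+ y n)))))
hat-unhat u x y -[1+ n ] e = ≈-trans (X-merge y (suc n) (u (suc n)) refl)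
  (≈-sym (X-merge x (2 * suc n) (u (suc n)) (ℤP.+-injective (begin
    + (x + 2 * suc n)                        ≡⟨ ℤP.pos-+ x (2 * suc n) ⟩
    + x +ᶻ + (2 * suc n)                     ≡⟨ cong₂ _+ᶻ_ e (ℤP.pos-* 2 (suc n)) ⟩
    (+ y +ᶻ -ᶻ (+ suc n)) +ᶻ + 2 *ᶻ + suc n  ≡⟨ lem (+ y) (+ suc n) ⟩
    + y +ᶻ + suc n                           ≡⟨ sym (ℤP.pos-+ y (suc n)) ⟩
    + (y + suc n) ∎))))
  where
  open ≡-Reasoning
  lem : ∀ y n → (y +ᶻ -ᶻ n) +ᶻ + 2 *ᶻ n ≡ y +ᶻ n
  lem = ℤR.solve-∀

hat-even : ∀ u i → hat u (-ᶻ i) ≈ hat u i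
hat-even u i = ≡⇒≈ (cong (λ n → X n ⊛ u n) (ℤP.∣-i∣≡∣i∣ i))

-- Ĥ m = Qᵐ H m. Evenness is visible on Ĥ, the reflection i ↦ -3 - i on H, and the two together give a recursion in m.
module Conv (s′ : ℕ) where

  s : ℕ
  s = suc s′

  t : ℤ → Series
  t k = const (sgn ∣ k ∣) ⊛ X (s * tri k)

  tFam : (ℤ → Series) → Fam
  tFam V = ordFam 1 1 (λ k → t k ⊛ V k) λ k → s * tri k ,
    Ord-⊛ˡ (V k) (Ord-⊛ʳ (const (sgn ∣ k ∣)) (Ord-Xa _)) ,
    ≤-trans (tri-bound k) (s≤s (≤-trans (m≤n*m (tri k) s) (m≤m+n _ 0)))

  t-flip : ∀ k → t (+ 1 -ᶻ k) ≈ ⊝ t k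
  t-flip k = ≈-trans (⊛-cong (≈-trans (≡⇒≈ (cong const (sgn-flip k))) (const-neg (sgn ∣ k ∣))) (X-cong (cong (s *_) (tri-flip k))))
    (solve 2 (λ a b → (:- a) :* b := :- (a :* b)) ≈-refl (const (sgn ∣ k ∣)) (X (s * tri k)))

  ∑t-flip : ∀ V W → (∀ k → W k ≈ V (+ 1 -ᶻ k)) → ∑ (tFam V) ≈ ⊝ ∑ (tFam W)
  ∑t-flip V W e = ≈-trans (≈-sym (∑-flip F (tFam V) λ k → ≈-refl)) (∑-⊝ F (tFam W) λ k →
      ≈-trans (⊛-cong (t-flip k) (≈-sym (e k))) (solve 2 (λ a b → (:- a) :* b := :- (a :* b)) ≈-refl (t k) (W k)))
    where
    F : Fam
    F = ordFam 2 1 (λ k → fn (tFam V) (+ 1 -ᶻ k)) λ k → s * tri (+ 1 -ᶻ k) ,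
      Ord-⊛ˡ (V (+ 1 -ᶻ k)) (Ord-⊛ʳ (const (sgn ∣ + 1 -ᶻ k ∣)) (Ord-Xa _)) ,
      subst (λ x → ∣ k ∣ ≤ 2 + 1 * (s * x)) (sym (tri-flip k))
        (≤-trans (tri-bound k) (s≤s (m≤n⇒m≤1+n (≤-trans (m≤n*m (tri k) s) (m≤m+n _ 0)))))

  ∑t-const : ∀ f → ∑ (tFam λ _ → f) ≈ 𝟘
  ∑t-const f = self-neg≈𝟘 (∑t-flip (λ _ → f) (λ _ → f) λ _ → ≈-refl)

  ĥFam : (ℕ → Series) → ℤ → Fam
  ĥFam u m = ordFam 0 1 (λ k → const (sgn ∣ k ∣) ⊛ X (s * (∣ k ∣ * ∣ k ∣)) ⊛ hat u (m -ᶻ + s *ᶻ k)) λ k →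
    s * (∣ k ∣ * ∣ k ∣) , Ord-⊛ˡ (hat u (m -ᶻ + s *ᶻ k)) (Ord-⊛ʳ (const (sgn ∣ k ∣)) (Ord-Xa _)) ,
    ≤-trans (n≤n² ∣ k ∣) (≤-trans (m≤n*m (∣ k ∣ * ∣ k ∣) s) (m≤m+n _ 0))

  Ĥ H : (ℕ → Series) → ℤ → Series
  Ĥ u m = ∑ (ĥFam u m)
  H u m = ∑ (tFam λ k → unhat u (m -ᶻ + s *ᶻ k))

  Ĥ-H : ∀ u x y m → + x ≡ + y +ᶻ m → X y ⊛ Ĥ u m ≈ X x ⊛ H u m
  Ĥ-H u x y m e = ≈-trans (≈-sym (∑-⊛ F (X y) (ĥFam u m) λ _ → ≈-refl)) (∑-⊛ F (X x) (tFam λ k → unhat u (m -ᶻ + s *ᶻ k)) termwise)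
    where
    open ≈-Reasoning
    F : Fam
    F = scaleFam (X y) (ĥFam u m)
    lem : ∀ s m y k → (y +ᶻ m) +ᶻ s *ᶻ (k *ᶻ (k -ᶻ + 1)) ≡ (y +ᶻ s *ᶻ (k *ᶻ k)) +ᶻ (m -ᶻ s *ᶻ k)
    lem = ℤR.solve-∀
    exponents : ∀ k → + (x + s * tri k) ≡ + (y + s * (∣ k ∣ * ∣ k ∣)) +ᶻ (m -ᶻ + s *ᶻ k)
    exponents k = trans (ℤP.pos-+ x (s * tri k))
      (trans (cong₂ _+ᶻ_ e (trans (ℤP.pos-* s (tri k)) (cong (+ s *ᶻ_) (+tri k))))
      (trans (lem (+ s) m (+ y) k)
      (cong (_+ᶻ (m -ᶻ + s *ᶻ k)) (sym (trans (ℤP.pos-+ y _) (cong (+ y +ᶻ_) (trans (ℤP.pos-* s (∣ k ∣ * ∣ k ∣)) (cong (+ s *ᶻ_) (+sq k)))))))))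
    termwise : ∀ k → X y ⊛ (const (sgn ∣ k ∣) ⊛ X (s * (∣ k ∣ * ∣ k ∣)) ⊛ hat u (m -ᶻ + s *ᶻ k)) ≈
                     X x ⊛ (t k ⊛ unhat u (m -ᶻ + s *ᶻ k))
    termwise k = begin
      X y ⊛ (const (sgn ∣ k ∣) ⊛ X (s * (∣ k ∣ * ∣ k ∣)) ⊛ hat u i)
        ≈⟨ solve 4 (λ a b d h → a :* (b :* d :* h) := b :* (a :* d :* h)) ≈-refl (X y) (const (sgn ∣ k ∣)) (X (s * (∣ k ∣ * ∣ k ∣))) (hat u i) ⟩
      const (sgn ∣ k ∣) ⊛ (X y ⊛ X (s * (∣ k ∣ * ∣ k ∣)) ⊛ hat u i)
        ≈⟨ ⊛-congˡ (≈-trans (⊛-cong (X-+ _ _) ≈-refl) (≈-trans (hat-unhat u _ _ i (exponents k)) (⊛-cong (≈-sym (X-+ _ _)) ≈-refl))) ⟩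
      const (sgn ∣ k ∣) ⊛ (X x ⊛ X (s * tri k) ⊛ unhat u i)
        ≈⟨ solve 4 (λ a b d h → b :* (a :* d :* h) := a :* (b :* d :* h)) ≈-refl (X x) (const (sgn ∣ k ∣)) (X (s * tri k)) (unhat u i) ⟩
      X x ⊛ (t k ⊛ unhat u i) ∎
      where
      i : ℤ
      i = m -ᶻ + s *ᶻ k

  Ĥ-even : ∀ u m → Ĥ u (-ᶻ m) ≈ Ĥ u m
  Ĥ-even u m = ∑-reflect (ĥFam u (-ᶻ m)) (ĥFam u m) λ k →
    ⊛-cong (≡⇒≈ (cong (λ n → const (sgn n) ⊛ X (s * (n * n))) (sym (ℤP.∣-i∣≡∣i∣ k))))
           (≈-trans (≡⇒≈ (cong (hat u) (lem (+ s) m k))) (hat-even u (m -ᶻ + s *ᶻ (-ᶻ k))))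
    where
    lem : ∀ s m k → -ᶻ m -ᶻ s *ᶻ k ≡ -ᶻ (m -ᶻ s *ᶻ (-ᶻ k))
    lem = ℤR.solve-∀

  H-reflection : ∀ u (R : ℤ → Series) → (∀ i → unhat u i ⊕ unhat u (-[1+ 2 ] -ᶻ i) ≈ R i) → ∀ m →
                 H u m ≈ ∑ (tFam λ k → R (m -ᶻ + s *ᶻ k)) ⊕ H u ((+ s -ᶻ + 3) -ᶻ m)
  H-reflection u R r m = begin
    H u m
      ≈⟨ solve 2 (λ a b → a := (a :+ b) :- b) ≈-refl (H u m) (∑ (tFam W)) ⟩
    (H u m ⊕ ∑ (tFam W)) ⊖ ∑ (tFam W)
      ≈⟨ ⊖-cong (≈-sym (∑-⊕ (tFam λ k → R (m -ᶻ + s *ᶻ k)) (tFam λ k → unhat u (m -ᶻ + s *ᶻ k)) (tFam W) λ k →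
           ≈-trans (⊛-congˡ (≈-sym (r (m -ᶻ + s *ᶻ k))))
                   (solve 3 (λ a b d → a :* (b :+ d) := a :* b :+ a :* d) ≈-refl (t k) (unhat u (m -ᶻ + s *ᶻ k)) (W k)))) ≈-refl ⟩
    ∑ (tFam λ k → R (m -ᶻ + s *ᶻ k)) ⊖ ∑ (tFam W)
      ≈⟨ ⊕-congˡ (≈-sym (∑t-flip (λ k → unhat u (((+ s -ᶻ + 3) -ᶻ m) -ᶻ + s *ᶻ k)) W λ k → ≡⇒≈ (cong (unhat u) (lem (+ s) m k)))) ⟩
    ∑ (tFam λ k → R (m -ᶻ + s *ᶻ k)) ⊕ H u ((+ s -ᶻ + 3) -ᶻ m) ∎
    where
    open ≈-Reasoning
    W : ℤ → Series
    W k = unhat u (-[1+ 2 ] -ᶻ (m -ᶻ + s *ᶻ k))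
    lem : ∀ s m k → -[1+ 2 ] -ᶻ (m -ᶻ s *ᶻ k) ≡ ((s -ᶻ + 3) -ᶻ m) -ᶻ s *ᶻ (+ 1 -ᶻ k)
    lem = ℤR.solve-∀

Ord-⊔ : ∀ {a b f} → Ord a f → Ord b f → Ord (a ⊔ b) f
Ord-⊔ {a} {b} o o′ i l with ≤-total a b
... | inj₁ a≤b = o′ i (subst (i <_) (m≤n⇒m⊔n≡n a≤b) l)
... | inj₂ b≤a = o i (subst (i <_) (m≥n⇒m⊔n≡m b≤a) l)

weightedFam : (ℤ → ℤ) → (ℕ → Series) → Fam
weightedFam w u = ordFam 0 1 (λ m → const (w m) ⊛ hat u m) λ m →
  ∣ m ∣ , Ord-⊛ʳ (const (w m)) (Ord-X ∣ m ∣ (u ∣ m ∣)) , m≤m+n ∣ m ∣ 0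

weighted : (ℤ → ℤ) → (ℕ → Series) → Series
weighted w u = ∑ (weightedFam w u)

module Shear (s′ : ℕ) (w : ℤ → ℤ) (u : ℕ → Series) where

  open Conv s′

  G₁ G₂ : ℤ → ℤ → Series
  G₁ k M = const (w M) ⊛ (const (sgn ∣ k ∣) ⊛ X (s * (∣ k ∣ * ∣ k ∣)) ⊛ hat u (M -ᶻ + s *ᶻ k))
  G₂ k m = const (w (m +ᶻ + s *ᶻ k)) ⊛ (const (sgn ∣ k ∣) ⊛ X (s * (∣ k ∣ * ∣ k ∣)) ⊛ hat u m)

  s∣k∣≤sk² : ∀ k → s * ∣ k ∣ ≤ s * (∣ k ∣ * ∣ k ∣)
  s∣k∣≤sk² k = *-monoʳ-≤ s (n≤n² ∣ k ∣)

  ∣k∣≤sk² : ∀ k → ∣ k ∣ ≤ s * (∣ k ∣ * ∣ k ∣)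
  ∣k∣≤sk² k = ≤-trans (m≤n*m ∣ k ∣ s) (s∣k∣≤sk² k)

  order : ∀ x k i → Ord (s * (∣ k ∣ * ∣ k ∣) ⊔ ∣ i ∣) (const x ⊛ (const (sgn ∣ k ∣) ⊛ X (s * (∣ k ∣ * ∣ k ∣)) ⊛ hat u i))
  order x k i = Ord-⊛ʳ (const x) (Ord-⊔
    (Ord-⊛ˡ (hat u i) (Ord-⊛ʳ (const (sgn ∣ k ∣)) (Ord-Xa _)))
    (Ord-⊛ʳ (const (sgn ∣ k ∣) ⊛ X (s * (∣ k ∣ * ∣ k ∣))) (Ord-X ∣ i ∣ (u ∣ i ∣))))

  ≤2a : ∀ {b a} → b ≤ a → b ≤ 0 + 2 * a
  ≤2a {b} {a} l = ≤-trans l (m≤m+n a _)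

  F₁ F₂ : Fam₂
  F₁ = ordFam₂ 0 2 G₁ λ k M → let a = s * (∣ k ∣ * ∣ k ∣) ; b = ∣ M -ᶻ + s *ᶻ k ∣ in
    a ⊔ b , order (w M) k (M -ᶻ + s *ᶻ k) , ≤2a (≤-trans (∣k∣≤sk² k) (m≤m⊔n a b)) ,
    ≤-trans (abs-bound M (-ᶻ (+ s *ᶻ k)))
      (subst (λ x → b + x ≤ 2 * (a ⊔ b)) (sym (trans (ℤP.∣-i∣≡∣i∣ (+ s *ᶻ k)) (ℤP.abs-* (+ s) k)))
        (+-mono-≤ (m≤n⊔m a b) (≤-trans (s∣k∣≤sk² k) (≤-trans (m≤m⊔n a b) (m≤m+n (a ⊔ b) 0)))))
  F₂ = ordFam₂ 0 2 G₂ λ k m → let a = s * (∣ k ∣ * ∣ k ∣) ; b = ∣ m ∣ in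
    a ⊔ b , order (w (m +ᶻ + s *ᶻ k)) k m , ≤2a (≤-trans (∣k∣≤sk² k) (m≤m⊔n a b)) , ≤2a (m≤n⊔m a b)

  ĤFam : Fam
  ĤFam = fam (λ M → const (w M) ⊛ Ĥ u M) λ n → let (B , z) = null (rows (flip₂ F₁)) n in
    B , λ M l i i≤n → trans (at (≈-sym (row-≈ M)) i) (z M l i i≤n)
    where
    row-≈ : ∀ M → ∑ (row (flip₂ F₁) M) ≈ const (w M) ⊛ Ĥ u M
    row-≈ M = ∑-⊛ (row (flip₂ F₁) M) (const (w M)) (ĥFam u M) λ k → ≈-refl

  ∑wĤ : Series
  ∑wĤ = ∑ ĤFam

  shear : ∑wĤ ≈ ∑ (rows F₂)
  shear = begin
    ∑ ĤFam            ≈⟨ ∑-cong ĤFam (rows (flip₂ F₁)) (λ M → ≈-sym (∑-⊛ (row (flip₂ F₁) M) (const (w M)) (ĥFam u M) λ k → ≈-refl)) ⟩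
    ∑ (rows (flip₂ F₁)) ≈⟨ ≈-sym (∑-swap F₁) ⟩
    ∑ (rows F₁)        ≈⟨ ∑-cong (rows F₁) (rows F₂) (λ k → ≈-sym (∑-shift (+ s *ᶻ k) (row F₂ k) (row F₁ k) λ m →
                            ⊛-congˡ (⊛-congˡ (≡⇒≈ (cong (hat u) (sym (lem m (+ s *ᶻ k)))))))) ⟩
    ∑ (rows F₂) ∎
    where
    open ≈-Reasoning
    lem : ∀ m d → (m +ᶻ d) -ᶻ d ≡ m
    lem = ℤR.solve-∀

ℤ-induction : (Q : ℤ → Set) → Q (+ 0) → (∀ k → Q k → Q (k +ᶻ + 1)) → (∀ k → Q (k +ᶻ + 1) → Q k) → ∀ k → Q k
ℤ-induction Q z up down (+ zero)  = z
ℤ-induction Q z up down (+ suc n) = subst Q (cong +_ (+-comm n 1)) (up (+ n) (ℤ-induction Q z up down (+ n)))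
ℤ-induction Q z up down -[1+ zero ]  = down -[1+ 0 ] z
ℤ-induction Q z up down -[1+ suc n ] = down -[1+ suc n ] (ℤ-induction Q z up down -[1+ n ])

AntiPeriodic : (ℤ → ℤ) → Set
AntiPeriodic w = ∀ m → w (m +ᶻ + 4) ≡ -ᶻ w m

sgn-suc : ∀ k → sgn ∣ k +ᶻ + 1 ∣ ≡ -ᶻ sgn ∣ k ∣
sgn-suc k = trans (cong (sgn ∘ ∣_∣) (lem k)) (trans (sgn-flip (-ᶻ k)) (cong (λ x → -ᶻ sgn x) (ℤP.∣-i∣≡∣i∣ k)))
  where
  lem : ∀ k → k +ᶻ + 1 ≡ + 1 -ᶻ (-ᶻ k)
  lem = ℤR.solve-∀

antiperiodic-multiple : ∀ w → AntiPeriodic w → ∀ k m → w (m +ᶻ + 4 *ᶻ k) ≡ sgn ∣ k ∣ *ᶻ w m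
antiperiodic-multiple w p k m = ℤ-induction (λ k → w (m +ᶻ + 4 *ᶻ k) ≡ sgn ∣ k ∣ *ᶻ w m) base up down k
  where
  base : w (m +ᶻ + 0) ≡ + 1 *ᶻ w m
  base = trans (cong w (ℤP.+-identityʳ m)) (sym (ℤP.*-identityˡ (w m)))
  lem : ∀ m k → m +ᶻ + 4 *ᶻ (k +ᶻ + 1) ≡ (m +ᶻ + 4 *ᶻ k) +ᶻ + 4
  lem = ℤR.solve-∀
  step : ∀ k → w (m +ᶻ + 4 *ᶻ (k +ᶻ + 1)) ≡ -ᶻ w (m +ᶻ + 4 *ᶻ k)
  step k = trans (cong w (lem m k)) (p _)
  rhs : ∀ k → sgn ∣ k +ᶻ + 1 ∣ *ᶻ w m ≡ -ᶻ (sgn ∣ k ∣ *ᶻ w m)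
  rhs k = trans (cong (_*ᶻ w m) (sgn-suc k)) (sym (ℤP.neg-distribˡ-* (sgn ∣ k ∣) (w m)))
  up : ∀ k → w (m +ᶻ + 4 *ᶻ k) ≡ sgn ∣ k ∣ *ᶻ w m → w (m +ᶻ + 4 *ᶻ (k +ᶻ + 1)) ≡ sgn ∣ k +ᶻ + 1 ∣ *ᶻ w m
  up k e = trans (step k) (trans (cong -ᶻ_ e) (sym (rhs k)))
  down : ∀ k → w (m +ᶻ + 4 *ᶻ (k +ᶻ + 1)) ≡ sgn ∣ k +ᶻ + 1 ∣ *ᶻ w m → w (m +ᶻ + 4 *ᶻ k) ≡ sgn ∣ k ∣ *ᶻ w m
  down k e = ℤP.neg-injective (trans (sym (step k)) (trans e (rhs k)))

sgn² : ∀ n → sgn n *ᶻ sgn n ≡ + 1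
sgn² zero    = refl
sgn² (suc n) = trans (lem (sgn n)) (sgn² n)
  where
  lem : ∀ x → (-ᶻ x) *ᶻ (-ᶻ x) ≡ x *ᶻ x
  lem = ℤR.solve-∀

θ-weighted : ∀ w u → AntiPeriodic w → θ ⊛ weighted w u ≈ Shear.∑wĤ 3 w u
θ-weighted w u p = ≈-sym (begin
  ∑wĤ                     ≈⟨ shear ⟩
  ∑ (rows F₂)             ≈⟨ ∑-⊛ (rows F₂) (weighted w u) θ-fam (λ k →
                               ≈-trans (∑-⊛ (row F₂ k) (X (4 * (∣ k ∣ * ∣ k ∣))) (weightedFam w u) (termwise k)) (⊛-comm _ _)) ⟩
  weighted w u ⊛ θ        ≈⟨ ⊛-comm _ _ ⟩
  θ ⊛ weighted w u ∎)
  where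
  open ≈-Reasoning
  open Shear 3 w u
  sign : ∀ k m → const (w (m +ᶻ + 4 *ᶻ k)) ⊛ const (sgn ∣ k ∣) ≈ const (w m)
  sign k m = ≈-trans (≈-sym (const-* _ _)) (≡⇒≈ (cong const
    (trans (cong (_*ᶻ sgn ∣ k ∣) (antiperiodic-multiple w p k m))
    (trans (lem (sgn ∣ k ∣) (w m)) (trans (cong (_*ᶻ w m) (sgn² ∣ k ∣)) (ℤP.*-identityˡ (w m)))))))
    where
    lem : ∀ x y → x *ᶻ y *ᶻ x ≡ x *ᶻ x *ᶻ y
    lem = ℤR.solve-∀
  termwise : ∀ k m → G₂ k m ≈ X (4 * (∣ k ∣ * ∣ k ∣)) ⊛ (const (w m) ⊛ hat u m)
  termwise k m = ≈-trans
    (solve 4 (λ a b x h → a :* (b :* x :* h) := x :* (a :* b :* h)) ≈-refl (const (w (m +ᶻ + 4 *ᶻ k))) (const (sgn ∣ k ∣)) (X (4 * (∣ k ∣ * ∣ k ∣))) (hat u m))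
    (⊛-congˡ (⊛-cong (sign k m) ≈-refl))

OddVan : Series → Set
OddVan f = ∀ n → n % 2 ≡ 1 → f n ≡ + 0

%2≢1⇒≡0 : ∀ n → n % 2 ≢ 1 → n % 2 ≡ 0
%2≢1⇒≡0 n n≢ with n % 2 | DivMod.m%n<n n 2
... | zero         | _                     = refl
... | suc zero     | _                     = ⊥-elim (n≢ refl)
... | suc (suc _)  | s≤s (s≤s ())

OddVan-⊛ : ∀ {f g} → OddVan f → OddVan g → OddVan (f ⊛ g)
OddVan-⊛ {f} {g} p q n n≡ = ⊛-zero-at f g n go
  where
  go : ∀ i j → i + j ≡ n → f i *ᶻ g j ≡ + 0
  go i j refl with i % 2 ≟ 1 | j % 2 ≟ 1
  ... | yes e | _     = cong (_*ᶻ g j) (p i e)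
  ... | no _  | yes e = trans (cong (f i *ᶻ_) (q j e)) (ℤP.*-zeroʳ (f i))
  ... | no d  | no e  = case trans (sym n≡) (trans (DivMod.%-distribˡ-+ i j 2) (cong₂ (λ x y → (x + y) % 2) (%2≢1⇒≡0 i d) (%2≢1⇒≡0 j e))) of λ ()

OddVan-⊕ : ∀ {f g} → OddVan f → OddVan g → OddVan (f ⊕ g)
OddVan-⊕ {f} {g} p q n n≡ = trans (⊕-at f g n) (cong₂ _+ᶻ_ (p n n≡) (q n n≡))

OddVan-const : ∀ x → OddVan (const x)
OddVan-const x (suc n) _ = refl

OddVan-X : ∀ e → OddVan (X (2 * e))
OddVan-X e n n≡ = X-off (2 * e) n λ { refl → case trans (sym n≡) (trans (cong (_% 2) (*-comm 2 e)) (DivMod.m*n%n≡0 e 2)) of λ () }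

c-OddVan : ∀ n k → OddVan (c n k)
c-OddVan n       zero    = OddVan-const (+ 1)
c-OddVan zero    (suc k) = OddVan-const (+ 0)
c-OddVan (suc n) (suc k) = OddVan-⊕ (c-OddVan n k) (OddVan-⊛ (OddVan-X (suc k)) (c-OddVan n (suc k)))

φ-OddVan : ∀ m → OddVan (φ m)
φ-OddVan m n n≡ = ∑-zero-at (weightedφ 0 m) n λ where
  (+ k)    → OddVan-⊛ (OddVan-X (1 * k)) (c-OddVan (m + 2 * k) k) n n≡
  -[1+ k ] → 𝟘-at n

unhatφ-OddVan : ∀ i → OddVan (unhat φ i)
unhatφ-OddVan (+ n)    = φ-OddVan n
unhatφ-OddVan -[1+ n ] = OddVan-⊛ (OddVan-X (suc n)) (φ-OddVan (suc n))

P-OddVan : OddVan P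
P-OddVan = OddVan-⊕ (φ-OddVan 0) (OddVan-⊛ (OddVan-X 3) (φ-OddVan 3))

-- The indicator of the residue classes 0 and 1 modulo 4.
ι₀ : ℕ → ℤ
ι₀ 0 = + 1
ι₀ 1 = + 1
ι₀ 2 = + 0
ι₀ 3 = + 0
ι₀ (suc (suc (suc (suc n)))) = ι₀ n

ι : ℤ → ℤ
ι (+ n)    = ι₀ n
ι -[1+ n ] = ι₀ (2 + n)

ι-flip : ∀ x → ι (+ 1 -ᶻ x) ≡ ι x
ι-flip (+ 0)           = refl
ι-flip (+ 1)           = refl
ι-flip (+ suc (suc n)) = refl
ι-flip -[1+ n ]        = refl

ι-+4 : ∀ x → ι (x +ᶻ + 4) ≡ ι x
ι-+4 (+ n)    = cong ι₀ (+-comm n 4)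
ι-+4 -[1+ 0 ] = refl
ι-+4 -[1+ 1 ] = refl
ι-+4 -[1+ 2 ] = refl
ι-+4 -[1+ 3 ] = refl
ι-+4 -[1+ suc (suc (suc (suc n))) ] = refl

ι-+4k : ∀ k x → ι (x +ᶻ + 4 *ᶻ k) ≡ ι x
ι-+4k k x = ℤ-induction (λ k → ι (x +ᶻ + 4 *ᶻ k) ≡ ι x) (cong ι (ℤP.+-identityʳ x))
  (λ k e → trans (step k) e) (λ k e → trans (sym (step k)) e) k
  where
  lem : ∀ x k → x +ᶻ + 4 *ᶻ (k +ᶻ + 1) ≡ (x +ᶻ + 4 *ᶻ k) +ᶻ + 4
  lem = ℤR.solve-∀
  step : ∀ k → ι (x +ᶻ + 4 *ᶻ (k +ᶻ + 1)) ≡ ι (x +ᶻ + 4 *ᶻ k)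
  step k = trans (cong ι (lem x k)) (ι-+4 (x +ᶻ + 4 *ᶻ k))

ι-sum : ∀ x → ι x +ᶻ ι (x -ᶻ + 1) +ᶻ ι (x -ᶻ + 2) +ᶻ ι (x -ᶻ + 3) ≡ + 2
ι-sum (+ 0) = refl
ι-sum (+ 1) = refl
ι-sum (+ 2) = refl
ι-sum (+ suc (suc (suc n))) = go n
  where
  go : ∀ n → ι₀ (3 + n) +ᶻ ι₀ (2 + n) +ᶻ ι₀ (1 + n) +ᶻ ι₀ n ≡ + 2
  go 0 = refl
  go 1 = refl
  go 2 = refl
  go 3 = refl
  go (suc (suc (suc (suc n)))) = go n
ι-sum -[1+ n ] = go n
  where
  go : ∀ n → ι₀ (2 + n) +ᶻ ι₀ (3 + (n + 0)) +ᶻ ι₀ (3 + (n + 1)) +ᶻ ι₀ (3 + (n + 2)) ≡ + 2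
  go 0 = refl
  go 1 = refl
  go 2 = refl
  go 3 = refl
  go (suc (suc (suc (suc n)))) = go n

proj : ℤ → Series → Series
proj j f n = ι (j +ᶻ + n) *ᶻ f n

proj-cong : ∀ {j j′ f} → (∀ n → ι (j +ᶻ + n) ≡ ι (j′ +ᶻ + n)) → proj j f ≈ proj j′ f
proj-cong {f = f} e = mk≈ λ n → cong (_*ᶻ f n) (e n)

proj-X : ∀ j e f → proj j (X e ⊛ f) ≈ X e ⊛ proj (j +ᶻ + e) f
proj-X j e f = mk≈ go
  where
  go : ∀ n → proj j (X e ⊛ f) n ≡ (X e ⊛ proj (j +ᶻ + e) f) n
  go n with n <? e
  ... | yes l = trans (cong (ι (j +ᶻ + n) *ᶻ_) (X-⊛-< e f n l))
                (trans (ℤP.*-zeroʳ (ι (j +ᶻ + n))) (sym (X-⊛-< e (proj (j +ᶻ + e) f) n l)))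
  ... | no n≮e = subst (λ n → proj j (X e ⊛ f) n ≡ (X e ⊛ proj (j +ᶻ + e) f) n) (m+[n∸m]≡n (≮⇒≥ n≮e)) (at-shift (n ∸ e))
    where
    at-shift : ∀ m → proj j (X e ⊛ f) (e + m) ≡ (X e ⊛ proj (j +ᶻ + e) f) (e + m)
    at-shift m = trans (cong₂ _*ᶻ_ (cong ι (trans (cong (j +ᶻ_) (ℤP.pos-+ e m)) (sym (ℤP.+-assoc j (+ e) (+ m))))) (X-⊛-≥ e f m))
                       (sym (X-⊛-≥ e (proj (j +ᶻ + e) f) m))

-- Qⁿ εₙ is the part of Qⁿ φₙ with exponents ≡ 0, 1 (mod 4); this projection removes δ from the reflection formula.
ε : ℕ → Series
ε n = proj (+ n) (φ n)

unhat-ε : ∀ i → unhat ε i ≈ proj i (unhat φ i)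
unhat-ε (+ n)    = ≈-refl
unhat-ε -[1+ n ] = ≈-sym (≈-trans (proj-X -[1+ n ] (2 * suc n) (φ (suc n)))
  (⊛-congˡ (≡⇒≈ (cong (λ j → proj j (φ (suc n))) (trans (cong (-ᶻ (+ suc n) +ᶻ_) (ℤP.pos-* 2 (suc n))) (lem (+ suc n)))))))
  where
  lem : ∀ x → -ᶻ x +ᶻ + 2 *ᶻ x ≡ x
  lem = ℤR.solve-∀

proj-δ : ∀ i k → ι (i +ᶻ + k) *ᶻ δ i k ≡ + 0
proj-δ (+ n) k           = trans (cong (ι (+ n +ᶻ + k) *ᶻ_) (𝟘-at k)) (ℤP.*-zeroʳ (ι (+ n +ᶻ + k)))
proj-δ -[1+ 0 ] zero     = refl
proj-δ -[1+ 0 ] (suc k)  = ℤP.*-zeroʳ (ι (-[1+ 0 ] +ᶻ + suc k))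
proj-δ -[1+ 1 ] zero     = refl
proj-δ -[1+ 1 ] (suc k)  = ℤP.*-zeroʳ (ι (-[1+ 1 ] +ᶻ + suc k))
proj-δ -[1+ suc (suc n) ] k = trans (cong (ι (-[1+ 2 + n ] +ᶻ + k) *ᶻ_) (𝟘-at k)) (ℤP.*-zeroʳ (ι (-[1+ 2 + n ] +ᶻ + k)))

ε-reflection : ∀ i → unhat ε i ⊕ unhat ε (-[1+ 2 ] -ᶻ i) ≈ proj i P
ε-reflection i = ≈-trans (⊕-cong (unhat-ε i) (unhat-ε i′)) (mk≈ λ n → trans (⊕-at (proj i (unhat φ i)) (proj i′ (unhat φ i′)) n) (go n))
  where
  open ≡-Reasoning
  i′ : ℤ
  i′ = -[1+ 2 ] -ᶻ i
  go : ∀ n → proj i (unhat φ i) n +ᶻ proj i′ (unhat φ i′) n ≡ proj i P n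
  go n with n % 2 ≟ 1
  ... | yes e = trans (cong₂ _+ᶻ_ (trans (cong (ι (i +ᶻ + n) *ᶻ_) (unhatφ-OddVan i n e)) (ℤP.*-zeroʳ (ι (i +ᶻ + n))))
                                  (trans (cong (ι (i′ +ᶻ + n) *ᶻ_) (unhatφ-OddVan i′ n e)) (ℤP.*-zeroʳ (ι (i′ +ᶻ + n)))))
                      (sym (trans (cong (ι (i +ᶻ + n) *ᶻ_) (P-OddVan n e)) (ℤP.*-zeroʳ (ι (i +ᶻ + n)))))
  ... | no d = begin
    ι (i +ᶻ + n) *ᶻ a +ᶻ ι (i′ +ᶻ + n) *ᶻ b   ≡⟨ cong (λ x → ι (i +ᶻ + n) *ᶻ a +ᶻ x *ᶻ b) same ⟩
    ι (i +ᶻ + n) *ᶻ a +ᶻ ι (i +ᶻ + n) *ᶻ b    ≡⟨ sym (ℤP.*-distribˡ-+ (ι (i +ᶻ + n)) a b) ⟩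
    ι (i +ᶻ + n) *ᶻ (a +ᶻ b)                 ≡⟨ cong (ι (i +ᶻ + n) *ᶻ_) (trans (sym (⊕-at (unhat φ i) (unhat φ i′) n))
                                                  (trans (at (φ-reflection i) n) (trans (⊕-at P (⊝ δ i) n) (cong (P n +ᶻ_) (⊝-at (δ i) n))))) ⟩
    ι (i +ᶻ + n) *ᶻ (P n -ᶻ δ i n)           ≡⟨ lem₁ (ι (i +ᶻ + n)) (P n) (δ i n) ⟩
    ι (i +ᶻ + n) *ᶻ P n -ᶻ ι (i +ᶻ + n) *ᶻ δ i n ≡⟨ cong (λ x → ι (i +ᶻ + n) *ᶻ P n -ᶻ x) (proj-δ i n) ⟩
    ι (i +ᶻ + n) *ᶻ P n -ᶻ + 0               ≡⟨ ℤP.+-identityʳ _ ⟩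
    ι (i +ᶻ + n) *ᶻ P n ∎
    where
    a b h : ℤ
    a = unhat φ i n
    b = unhat φ i′ n
    h = + (n / 2)
    lem₁ : ∀ x p d → x *ᶻ (p -ᶻ d) ≡ x *ᶻ p -ᶻ x *ᶻ d
    lem₁ = ℤR.solve-∀
    lem₂ : ∀ i h → (-[1+ 2 ] -ᶻ i) +ᶻ h *ᶻ + 2 ≡ (+ 1 -ᶻ (i +ᶻ h *ᶻ + 2)) +ᶻ + 4 *ᶻ (h -ᶻ + 1)
    lem₂ = ℤR.solve-∀
    n≡ : + n ≡ h *ᶻ + 2
    n≡ = trans (cong +_ (trans (DivMod.m≡m%n+[m/n]*n n 2) (cong (_+ (n / 2) * 2) (%2≢1⇒≡0 n d)))) (ℤP.pos-* (n / 2) 2)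
    same : ι (i′ +ᶻ + n) ≡ ι (i +ᶻ + n)
    same = trans (cong (λ x → ι (i′ +ᶻ x)) n≡) (trans (cong ι (lem₂ i h))
      (trans (ι-+4k (h -ᶻ + 1) (+ 1 -ᶻ (i +ᶻ h *ᶻ + 2))) (trans (ι-flip (i +ᶻ h *ᶻ + 2)) (cong (λ x → ι (i +ᶻ x)) (sym n≡)))))

open Conv 3 using (t; tFam; ∑t-flip; ∑t-const) renaming (Ĥ to Ĥ₄; H to H₄; Ĥ-H to Ĥ-H₄; Ĥ-even to Ĥ-even₄; H-reflection to H-reflection₄)

Hε-reflection : ∀ m → H₄ ε m ≈ H₄ ε (+ 1 -ᶻ m)
Hε-reflection m = ≈-trans (H-reflection₄ ε (λ i → proj i P) ε-reflection m) (𝟘-⊕ _ (≈-trans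
  (∑-cong (tFam λ k → proj (m -ᶻ + 4 *ᶻ k) P) (tFam λ _ → proj m P) λ k → ⊛-congˡ (proj-cong {m -ᶻ + 4 *ᶻ k} {m} λ n →
     trans (cong ι (lem m k (+ n))) (ι-+4k (-ᶻ k) (m +ᶻ + n))))
  (∑t-const (proj m P))))
  where
  lem : ∀ m k n → (m -ᶻ + 4 *ᶻ k) +ᶻ n ≡ (m +ᶻ n) +ᶻ + 4 *ᶻ (-ᶻ k)
  lem = ℤR.solve-∀

C : Series
C = Ĥ₄ ε (+ 0)

H₄-neg : ∀ n → X n ⊛ Ĥ₄ ε (+ n) ≈ H₄ ε (-ᶻ (+ n))
H₄-neg n = ≈-trans (⊛-congˡ (≈-sym (Ĥ-even₄ ε (+ n))))
  (≈-trans (Ĥ-H₄ ε 0 n (-ᶻ (+ n)) (sym (ℤP.+-inverseʳ (+ n)))) (X0-⊛ _))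

Ĥε-square : ∀ n → Ĥ₄ ε (+ n) ≈ X (n * n) ⊛ C
Ĥε-square zero    = ≈-sym (X0-⊛ C)
Ĥε-square (suc n) = begin
  Ĥ₄ ε (+ suc n)                    ≈⟨ ≈-sym (X0-⊛ _) ⟩
  X 0 ⊛ Ĥ₄ ε (+ suc n)              ≈⟨ Ĥ-H₄ ε (suc n) 0 (+ suc n) refl ⟩
  X (suc n) ⊛ H₄ ε (+ suc n)        ≈⟨ ⊛-congˡ (≈-trans (Hε-reflection (+ suc n)) (≡⇒≈ (cong (H₄ ε) (lem₁ (+ n))))) ⟩
  X (suc n) ⊛ H₄ ε (-ᶻ (+ n))       ≈⟨ ⊛-congˡ (≈-sym (H₄-neg n)) ⟩
  X (suc n) ⊛ (X n ⊛ Ĥ₄ ε (+ n))    ≈⟨ ⊛-congˡ (⊛-congˡ (Ĥε-square n)) ⟩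
  X (suc n) ⊛ (X n ⊛ (X (n * n) ⊛ C)) ≈⟨ ⊛-congˡ (X-merge n (n * n) C refl) ⟩
  X (suc n) ⊛ (X (n + n * n) ⊛ C)   ≈⟨ X-merge (suc n) (n + n * n) C (lem₂ n) ⟩
  X (suc n * suc n) ⊛ C ∎
  where
  open ≈-Reasoning
  lem₁ : ∀ x → + 1 -ᶻ (+ 1 +ᶻ x) ≡ -ᶻ x
  lem₁ = ℤR.solve-∀
  lem₂ : ∀ n → suc n + (n + n * n) ≡ suc n * suc n
  lem₂ = ℕR.solve-∀

Ĥε-squareᶻ : ∀ m → Ĥ₄ ε m ≈ X (∣ m ∣ * ∣ m ∣) ⊛ C
Ĥε-squareᶻ (+ n)    = Ĥε-square n
Ĥε-squareᶻ -[1+ n ] = ≈-trans (Ĥ-even₄ ε (+ suc n)) (Ĥε-square (suc n))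

unhatOrder : ℤ → ℕ
unhatOrder (+ n)    = 0
unhatOrder -[1+ n ] = 2 * suc n

unhat-Ord : ∀ u i → Ord (unhatOrder i) (unhat u i)
unhat-Ord u (+ n)    i ()
unhat-Ord u -[1+ n ] = Ord-X (2 * suc n) (u (suc n))

unhatOrder-bound : ∀ m n → n ≤ ∣ m ∣ + unhatOrder (m -ᶻ + n)
unhatOrder-bound m n = go (m -ᶻ + n) (lem m (+ n))
  where
  lem : ∀ m n → m ≡ n +ᶻ (m -ᶻ n)
  lem = ℤR.solve-∀
  go : ∀ i → m ≡ + n +ᶻ i → n ≤ ∣ m ∣ + unhatOrder i
  go (+ l) refl    = ≤-trans (m≤m+n n l) (m≤m+n (n + l) 0)
  go -[1+ l ] refl = ≤-trans (abs-bound (+ n) -[1+ l ]) (+-monoʳ-≤ ∣ + n +ᶻ -[1+ l ] ∣ (m≤m+n (suc l) _))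

tailFam : (ℕ → Series) → ℤ → Fam
tailFam u m = natFam ∣ m ∣ 1 (λ n → unhat u (m -ᶻ + n)) λ n →
  unhatOrder (m -ᶻ + n) , unhat-Ord u (m -ᶻ + n) ,
  ≤-trans (unhatOrder-bound m n) (+-monoʳ-≤ ∣ m ∣ (m≤m+n _ 0))

tailSum : (ℕ → Series) → ℤ → Series
tailSum u m = ∑ (tailFam u m)

tailSum-peel : ∀ u m → tailSum u m ≈ unhat u m ⊕ tailSum u (m -ᶻ + 1)
tailSum-peel u m = ≈-trans (∑-peel (tailFam u m) (tailFam u (m -ᶻ + 1))
    (λ n → ≡⇒≈ (cong (unhat u) (lem m (+ n)))) (λ _ → ≈-refl) (λ _ → ≈-refl))
  (⊕-cong (≡⇒≈ (cong (unhat u) (ℤP.+-identityʳ m))) ≈-refl)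
  where
  lem : ∀ m n → m -ᶻ (+ 1 +ᶻ n) ≡ (m -ᶻ + 1) -ᶻ n
  lem = ℤR.solve-∀

S : ℤ → Series
S = tailSum ε

S-cong : ∀ {m n} → m ≡ n → S m ≈ S n
S-cong refl = ≈-refl

four : ℤ → Series
four m = unhat ε m ⊕ unhat ε (m -ᶻ + 1) ⊕ unhat ε (m -ᶻ + 2) ⊕ unhat ε (m -ᶻ + 3)

S-four : ∀ m → S m ≈ four m ⊕ S (m -ᶻ + 4)
S-four m = begin
  S m ≈⟨ tailSum-peel ε m ⟩
  e₀ ⊕ S (m -ᶻ + 1) ≈⟨ ⊕-congˡ (next (+ 1)) ⟩
  e₀ ⊕ (e₁ ⊕ S (m -ᶻ + 2)) ≈⟨ ⊕-congˡ (⊕-congˡ (next (+ 2))) ⟩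
  e₀ ⊕ (e₁ ⊕ (e₂ ⊕ S (m -ᶻ + 3))) ≈⟨ ⊕-congˡ (⊕-congˡ (⊕-congˡ (next (+ 3)))) ⟩
  e₀ ⊕ (e₁ ⊕ (e₂ ⊕ (e₃ ⊕ S (m -ᶻ + 4))))
    ≈⟨ solve 5 (λ a b d e f → a :+ (b :+ (d :+ (e :+ f))) := a :+ b :+ d :+ e :+ f) ≈-refl e₀ e₁ e₂ e₃ (S (m -ᶻ + 4)) ⟩
  four m ⊕ S (m -ᶻ + 4) ∎
  where
  open ≈-Reasoning
  e₀ e₁ e₂ e₃ : Series
  e₀ = unhat ε m
  e₁ = unhat ε (m -ᶻ + 1)
  e₂ = unhat ε (m -ᶻ + 2)
  e₃ = unhat ε (m -ᶻ + 3)
  lem : ∀ m d → (m -ᶻ d) -ᶻ + 1 ≡ m -ᶻ (d +ᶻ + 1)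
  lem = ℤR.solve-∀
  next : ∀ d → S (m -ᶻ d) ≈ unhat ε (m -ᶻ d) ⊕ S (m -ᶻ (d +ᶻ + 1))
  next d = ≈-trans (tailSum-peel ε (m -ᶻ d)) (⊕-congˡ (S-cong (lem m d)))

four-pair : ∀ m → four m ⊕ four (-ᶻ m) ≈ const (+ 2) ⊛ P
four-pair m = begin
  four m ⊕ four (-ᶻ m)
    ≈⟨ solve 8 (λ a b d e p q r s → (a :+ b :+ d :+ e) :+ (p :+ q :+ r :+ s) := (a :+ s) :+ (b :+ r) :+ (d :+ q) :+ (e :+ p)) ≈-refl
         (U m) (U (m -ᶻ + 1)) (U (m -ᶻ + 2)) (U (m -ᶻ + 3)) (U (-ᶻ m)) (U (-ᶻ m -ᶻ + 1)) (U (-ᶻ m -ᶻ + 2)) (U (-ᶻ m -ᶻ + 3)) ⟩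
  (U m ⊕ U (-ᶻ m -ᶻ + 3)) ⊕ (U (m -ᶻ + 1) ⊕ U (-ᶻ m -ᶻ + 2)) ⊕ (U (m -ᶻ + 2) ⊕ U (-ᶻ m -ᶻ + 1)) ⊕ (U (m -ᶻ + 3) ⊕ U (-ᶻ m))
    ≈⟨ ⊕-cong (⊕-cong (⊕-cong (pair m (l₀ m)) (pair (m -ᶻ + 1) (l₁ m))) (pair (m -ᶻ + 2) (l₂ m))) (pair (m -ᶻ + 3) (l₃ m)) ⟩
  proj m P ⊕ proj (m -ᶻ + 1) P ⊕ proj (m -ᶻ + 2) P ⊕ proj (m -ᶻ + 3) P
    ≈⟨ mk≈ at-n ⟩
  const (+ 2) ⊛ P ∎
  where
  open ≈-Reasoning
  U : ℤ → Series
  U = unhat ε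
  pair : ∀ i {j} → j ≡ -[1+ 2 ] -ᶻ i → U i ⊕ U j ≈ proj i P
  pair i refl = ε-reflection i
  l₀ : ∀ m → -ᶻ m -ᶻ + 3 ≡ -[1+ 2 ] -ᶻ m
  l₀ = ℤR.solve-∀
  l₁ : ∀ m → -ᶻ m -ᶻ + 2 ≡ -[1+ 2 ] -ᶻ (m -ᶻ + 1)
  l₁ = ℤR.solve-∀
  l₂ : ∀ m → -ᶻ m -ᶻ + 1 ≡ -[1+ 2 ] -ᶻ (m -ᶻ + 2)
  l₂ = ℤR.solve-∀
  l₃ : ∀ m → -ᶻ m ≡ -[1+ 2 ] -ᶻ (m -ᶻ + 3)
  l₃ = ℤR.solve-∀
  swap : ∀ m d n → (m -ᶻ d) +ᶻ n ≡ (m +ᶻ n) -ᶻ d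
  swap = ℤR.solve-∀
  dist : ∀ a b c d p → a *ᶻ p +ᶻ b *ᶻ p +ᶻ c *ᶻ p +ᶻ d *ᶻ p ≡ (a +ᶻ b +ᶻ c +ᶻ d) *ᶻ p
  dist = ℤR.solve-∀
  at-n : ∀ n → (proj m P ⊕ proj (m -ᶻ + 1) P ⊕ proj (m -ᶻ + 2) P ⊕ proj (m -ᶻ + 3) P) n ≡ (const (+ 2) ⊛ P) n
  at-n n = trans (⊕-at _ _ n) (trans (cong (_+ᶻ proj (m -ᶻ + 3) P n) (trans (⊕-at _ _ n) (cong (_+ᶻ proj (m -ᶻ + 2) P n) (⊕-at _ _ n))))
    (trans (dist (ι (m +ᶻ + n)) (ι ((m -ᶻ + 1) +ᶻ + n)) (ι ((m -ᶻ + 2) +ᶻ + n)) (ι ((m -ᶻ + 3) +ᶻ + n)) (P n))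
    (trans (cong (_*ᶻ P n) (trans
        (cong₂ _+ᶻ_ (cong₂ _+ᶻ_ (cong (λ x → ι (m +ᶻ + n) +ᶻ ι x) (swap m (+ 1) (+ n))) (cong ι (swap m (+ 2) (+ n)))) (cong ι (swap m (+ 3) (+ n))))
        (ι-sum (m +ᶻ + n))))
      (sym (const-⊛ (+ 2) P n)))))

four-0 : four (+ 0) ≈ P
four-0 = mk≈ λ n → ℤP.*-cancelˡ-≡ (+ 2) (four (+ 0) n) (P n)
  (trans (lem (four (+ 0) n)) (trans (sym (⊕-at (four (+ 0)) (four (+ 0)) n)) (trans (at (four-pair (+ 0)) n) (const-⊛ (+ 2) P n))))
  where
  lem : ∀ x → + 2 *ᶻ x ≡ x +ᶻ x
  lem = ℤR.solve-∀

S-difference : ∀ k → S (-ᶻ (+ 4 *ᶻ k)) ⊖ S (+ 4 *ᶻ k -ᶻ + 4) ≈ ⊝ (const (+ 2 *ᶻ k -ᶻ + 1) ⊛ P)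
S-difference = ℤ-induction (λ k → D k ≈ E k) base up down
  where
  open ≈-Reasoning
  D E : ℤ → Series
  D k = S (-ᶻ (+ 4 *ᶻ k)) ⊖ S (+ 4 *ᶻ k -ᶻ + 4)
  E k = ⊝ (const (+ 2 *ᶻ k -ᶻ + 1) ⊛ P)
  base : D (+ 0) ≈ E (+ 0)
  base = ≈-trans (⊖-cong (≈-trans (S-four (+ 0)) (⊕-cong four-0 ≈-refl)) ≈-refl)
    (solve 2 (λ p s → (p :+ s) :- s := :- (con -[1+ 0 ] :* p)) ≈-refl P (S (-[1+ 3 ])))
  e₁ : ∀ k → -ᶻ (+ 4 *ᶻ (k +ᶻ + 1)) ≡ -ᶻ (+ 4 *ᶻ k) -ᶻ + 4
  e₁ = ℤR.solve-∀
  e₂ : ∀ k → + 4 *ᶻ (k +ᶻ + 1) -ᶻ + 4 ≡ + 4 *ᶻ k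
  e₂ = ℤR.solve-∀
  e₃ : ∀ k → + 2 *ᶻ (k +ᶻ + 1) -ᶻ + 1 ≡ (+ 2 *ᶻ k -ᶻ + 1) +ᶻ + 2
  e₃ = ℤR.solve-∀
  D-step : ∀ k → D k ≈ D (k +ᶻ + 1) ⊕ const (+ 2) ⊛ P
  D-step k = begin
    S (-ᶻ x) ⊖ S (x -ᶻ + 4)
      ≈⟨ solve 3 (λ a b f → a :- b := (a :- (f :+ b)) :+ f) ≈-refl (S (-ᶻ x)) (S (x -ᶻ + 4)) (four x) ⟩
    (S (-ᶻ x) ⊖ (four x ⊕ S (x -ᶻ + 4))) ⊕ four x
      ≈⟨ ⊕-cong (⊖-cong (S-four (-ᶻ x)) (≈-sym (S-four x))) ≈-refl ⟩
    ((four (-ᶻ x) ⊕ S (-ᶻ x -ᶻ + 4)) ⊖ S x) ⊕ four x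
      ≈⟨ solve 4 (λ f a b g → ((f :+ a) :- b) :+ g := (a :- b) :+ (g :+ f)) ≈-refl (four (-ᶻ x)) (S (-ᶻ x -ᶻ + 4)) (S x) (four x) ⟩
    (S (-ᶻ x -ᶻ + 4) ⊖ S x) ⊕ (four x ⊕ four (-ᶻ x))
      ≈⟨ ⊕-cong (⊖-cong (S-cong (sym (e₁ k))) (S-cong (sym (e₂ k)))) (four-pair x) ⟩
    D (k +ᶻ + 1) ⊕ const (+ 2) ⊛ P ∎
    where
    x : ℤ
    x = + 4 *ᶻ k
  E-step : ∀ k → E k ≈ E (k +ᶻ + 1) ⊕ const (+ 2) ⊛ P
  E-step k = ≈-trans (solve 2 (λ c p → :- (c :* p) := :- ((c :+ con (+ 2)) :* p) :+ con (+ 2) :* p) ≈-refl (const (+ 2 *ᶻ k -ᶻ + 1)) P)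
    (⊕-cong (⊝-cong (⊛-cong (≈-trans (≈-sym (const-+ _ _)) (≡⇒≈ (cong const (sym (e₃ k))))) ≈-refl)) ≈-refl)
  cancel : ∀ {f g} h → f ⊕ h ≈ g ⊕ h → f ≈ g
  cancel {f} {g} h e = ≈-trans (solve 2 (λ f h → f := (f :+ h) :- h) ≈-refl f h)
    (≈-trans (⊖-cong e ≈-refl) (solve 2 (λ g h → (g :+ h) :- h := g) ≈-refl g h))
  up : ∀ k → D k ≈ E k → D (k +ᶻ + 1) ≈ E (k +ᶻ + 1)
  up k e = cancel (const (+ 2) ⊛ P) (≈-trans (≈-sym (D-step k)) (≈-trans e (E-step k)))
  down : ∀ k → D (k +ᶻ + 1) ≈ E (k +ᶻ + 1) → D k ≈ E k
  down k e = ≈-trans (D-step k) (≈-trans (⊕-cong e ≈-refl) (≈-sym (E-step k)))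

module TailSwap where

  G : ℤ → ℤ → Series
  G (+ n)    k = t k ⊛ unhat ε (-ᶻ (+ n) -ᶻ + 4 *ᶻ k)
  G -[1+ n ] k = 𝟘

  swap : ∀ x y → -ᶻ x -ᶻ y ≡ -ᶻ y -ᶻ x
  swap = ℤR.solve-∀

  bound : ∀ a b k n → ∣ k ∣ ≤ 1 + tri k → 4 * tri k ≤ a → n ≤ ∣ -ᶻ (+ 4 *ᶻ k) ∣ + b → b ≤ a → n ≤ 4 + 2 * a
  bound a b k n k≤ 4t≤a n≤ b≤a = begin
    n                              ≤⟨ n≤ ⟩
    ∣ -ᶻ (+ 4 *ᶻ k) ∣ + b          ≡⟨ cong (_+ b) (trans (ℤP.∣-i∣≡∣i∣ (+ 4 *ᶻ k)) (ℤP.abs-* (+ 4) k)) ⟩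
    4 * ∣ k ∣ + b                  ≤⟨ +-mono-≤ (*-monoʳ-≤ 4 k≤) b≤a ⟩
    4 * (1 + tri k) + a            ≡⟨ lem (tri k) a ⟩
    4 + (a + 4 * tri k)            ≤⟨ +-monoʳ-≤ 4 (+-monoʳ-≤ a (≤-trans 4t≤a (m≤m+n a 0))) ⟩
    4 + 2 * a                      ∎
    where
    open ≤-Reasoning
    lem : ∀ t a → 4 * (1 + t) + a ≡ 4 + (a + 4 * t)
    lem = ℕR.solve-∀

  k-bound : ∀ a k → 4 * tri k ≤ a → ∣ k ∣ ≤ 4 + 2 * a
  k-bound a k l = ≤-trans (tri-bound k) (+-mono-≤ (s≤s (z≤n {3})) (≤-trans (m≤n*m (tri k) 4) (≤-trans l (m≤m+n a _))))

  order : ∀ j k → ∃ λ a → Ord a (G j k) × ∣ j ∣ ≤ 4 + 2 * a × ∣ k ∣ ≤ 4 + 2 * a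
  order (+ n) k = a , Ord-⊔ (Ord-⊛ˡ (unhat ε i) (Ord-⊛ʳ (const (sgn ∣ k ∣)) (Ord-Xa _))) (Ord-⊛ʳ (t k) (unhat-Ord ε i)) ,
      bound a (unhatOrder i) k n (tri-bound k) l
        (subst (λ x → n ≤ ∣ -ᶻ (+ 4 *ᶻ k) ∣ + unhatOrder x) (swap (+ 4 *ᶻ k) (+ n)) (unhatOrder-bound (-ᶻ (+ 4 *ᶻ k)) n)) (m≤n⊔m (4 * tri k) (unhatOrder i)) ,
      k-bound a k l
    where
    i : ℤ
    i = -ᶻ (+ n) -ᶻ + 4 *ᶻ k
    a : ℕ
    a = 4 * tri k ⊔ unhatOrder i
    l : 4 * tri k ≤ a
    l = m≤m⊔n (4 * tri k) (unhatOrder i)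
  order -[1+ n ] k = a , Ord-𝟘 ≈-refl , ≤-trans (m≤m+n (suc n) (4 * tri k)) (≤-trans (m≤m+n a _) (m≤n+m (2 * a) 4)) ,
      k-bound a k (m≤n+m (4 * tri k) (suc n))
    where
    a : ℕ
    a = suc n + 4 * tri k

  F : Fam₂
  F = ordFam₂ 4 2 G order

  rows-ψC : ∑ (rows F) ≈ C ⊛ ψ
  rows-ψC = ∑-⊛ (rows F) C ψ-fam λ where
      (+ n)    → ≈-trans (∑-cong (row F (+ n)) (tFam λ k → unhat ε (-ᶻ (+ n) -ᶻ + 4 *ᶻ k)) λ _ → ≈-refl)
                 (≈-trans (≈-sym (H₄-neg n)) (≈-trans (⊛-congˡ (Ĥε-square n))
                 (≈-trans (X-merge n (n * n) C (sym (*-suc n n))) (⊛-comm _ _))))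
      -[1+ n ] → ≈-trans (mk≈ λ i → trans (∑-zero-at (row F -[1+ n ]) i λ _ → 𝟘-at i) (sym (𝟘-at i))) (≈-sym (⊛-𝟘 C ≈-refl))

  columns : ∑ (rows (flip₂ F)) ≈ ∑ (tFam λ k → S (-ᶻ (+ 4 *ᶻ k)))
  columns = ∑-cong (rows (flip₂ F)) (tFam λ k → S (-ᶻ (+ 4 *ᶻ k))) λ k →
    ∑-⊛ (row (flip₂ F) k) (t k) (tailFam ε (-ᶻ (+ 4 *ᶻ k))) λ where
      (+ n)    → ⊛-congˡ (≡⇒≈ (cong (unhat ε) (swap (+ n) (+ 4 *ᶻ k))))
      -[1+ n ] → ≈-sym (⊛-𝟘 (t k) ≈-refl)

  ψC : C ⊛ ψ ≈ ∑ (tFam λ k → S (-ᶻ (+ 4 *ᶻ k)))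
  ψC = ≈-trans (≈-sym rows-ψC) (≈-trans (∑-swap F) columns)

J : Series
J = ∑ (tFam λ k → const (+ 2 *ᶻ k -ᶻ + 1))

2ψC : const (+ 2) ⊛ (C ⊛ ψ) ≈ ⊝ (P ⊛ J)
2ψC = begin
  const (+ 2) ⊛ (C ⊛ ψ)        ≈⟨ ⊛-congˡ TailSwap.ψC ⟩
  const (+ 2) ⊛ ∑ (tFam V)     ≈⟨ solve 1 (λ v → con (+ 2) :* v := v :+ v) ≈-refl (∑ (tFam V)) ⟩
  ∑ (tFam V) ⊕ ∑ (tFam V)      ≈⟨ ⊕-congˡ (∑t-flip V W λ k → S-cong (lem k)) ⟩
  ∑ (tFam V) ⊕ ⊝ ∑ (tFam W)    ≈⟨ ⊕-congˡ (≈-sym (∑-⊝ (tFam λ k → ⊝ W k) (tFam W) λ k → solve 2 (λ t w → t :* (:- w) := :- (t :* w)) ≈-refl (t k) (W k))) ⟩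
  ∑ (tFam V) ⊕ ∑ (tFam λ k → ⊝ W k) ≈⟨ ≈-sym (∑-⊕ (tFam λ k → V k ⊖ W k) (tFam V) (tFam λ k → ⊝ W k) λ k → solve 3 (λ t v w → t :* (v :- w) := t :* v :+ t :* (:- w)) ≈-refl (t k) (V k) (W k)) ⟩
  ∑ (tFam λ k → V k ⊖ W k)     ≈⟨ ∑-⊛ (tFam λ k → V k ⊖ W k) (⊝ P) (tFam λ k → const (+ 2 *ᶻ k -ᶻ + 1)) (λ k →
                                    ≈-trans (⊛-congˡ (S-difference k)) (solve 3 (λ t c p → t :* (:- (c :* p)) := (:- p) :* (t :* c)) ≈-refl (t k) (const (+ 2 *ᶻ k -ᶻ + 1)) P)) ⟩
  ⊝ P ⊛ J                      ≈⟨ solve 2 (λ p j → (:- p) :* j := :- (p :* j)) ≈-refl P J ⟩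
  ⊝ (P ⊛ J) ∎
  where
  open ≈-Reasoning
  V W : ℤ → Series
  V k = S (-ᶻ (+ 4 *ᶻ k))
  W k = S (+ 4 *ᶻ k -ᶻ + 4)
  lem : ∀ k → + 4 *ᶻ k -ᶻ + 4 ≡ -ᶻ (+ 4 *ᶻ (+ 1 -ᶻ k))
  lem = ℤR.solve-∀

-- Weights modulo 8

w₀ℕ w₁ℕ : ℕ → ℤ
w₀ℕ 0 = + 1
w₀ℕ 1 = + 0
w₀ℕ 2 = + 0
w₀ℕ 3 = + 0
w₀ℕ (suc (suc (suc (suc n)))) = -ᶻ w₀ℕ n
w₁ℕ 0 = + 0
w₁ℕ 1 = + 1
w₁ℕ 2 = + 0
w₁ℕ 3 = -[1+ 0 ]
w₁ℕ (suc (suc (suc (suc n)))) = -ᶻ w₁ℕ n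

w₀ w₁ : ℤ → ℤ
w₀ m = w₀ℕ ∣ m ∣
w₁ m = w₁ℕ ∣ m ∣

w₀-even : ∀ m → w₀ (-ᶻ m) ≡ w₀ m
w₀-even m = cong w₀ℕ (ℤP.∣-i∣≡∣i∣ m)

w₀-anti : AntiPeriodic w₀
w₀-anti (+ n)    = cong w₀ℕ (+-comm n 4)
w₀-anti -[1+ 0 ] = refl
w₀-anti -[1+ 1 ] = refl
w₀-anti -[1+ 2 ] = refl
w₀-anti -[1+ 3 ] = refl
w₀-anti -[1+ suc (suc (suc (suc n))) ] = sym (ℤP.neg-involutive (w₀ℕ (suc n)))

w₁-anti : AntiPeriodic w₁
w₁-anti (+ n)    = cong w₁ℕ (+-comm n 4)
w₁-anti -[1+ 0 ] = refl
w₁-anti -[1+ 1 ] = refl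
w₁-anti -[1+ 2 ] = refl
w₁-anti -[1+ 3 ] = refl
w₁-anti -[1+ suc (suc (suc (suc n))) ] = sym (ℤP.neg-involutive (w₁ℕ (suc n)))

anti-ext : ∀ f g → AntiPeriodic f → AntiPeriodic g → (∀ r → r < 4 → f (+ r) ≡ g (+ r)) → ∀ m → f m ≡ g m
anti-ext f g p q e = go
  where
  up : ∀ m → f m ≡ g m → f (m +ᶻ + 4) ≡ g (m +ᶻ + 4)
  up m d = trans (p m) (trans (cong -ᶻ_ d) (sym (q m)))
  down : ∀ m → f (m +ᶻ + 4) ≡ g (m +ᶻ + 4) → f m ≡ g m
  down m d = ℤP.neg-injective (trans (sym (p m)) (trans d (q m)))
  go : ∀ m → f m ≡ g m
  go (+ 0) = e 0 (s≤s z≤n)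
  go (+ 1) = e 1 (s≤s (s≤s z≤n))
  go (+ 2) = e 2 (s≤s (s≤s (s≤s z≤n)))
  go (+ 3) = e 3 (s≤s (s≤s (s≤s (s≤s z≤n))))
  go (+ suc (suc (suc (suc n)))) = subst (λ x → f (+ x) ≡ g (+ x)) (+-comm n 4) (up (+ n) (go (+ n)))
  go -[1+ 0 ] = down -[1+ 0 ] (go (+ 3))
  go -[1+ 1 ] = down -[1+ 1 ] (go (+ 2))
  go -[1+ 2 ] = down -[1+ 2 ] (go (+ 1))
  go -[1+ 3 ] = down -[1+ 3 ] (go (+ 0))
  go -[1+ suc (suc (suc (suc n))) ] = down -[1+ suc (suc (suc (suc n))) ] (go -[1+ n ])

-- The analogue for w₀ of cos (x + y) + cos (x - y) = 2 cos x cos y.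
w-addition : ∀ m k → w₀ (m +ᶻ k) +ᶻ w₀ (m -ᶻ k) ≡ + 2 *ᶻ (w₀ m *ᶻ w₀ k) +ᶻ w₁ m *ᶻ w₁ k
w-addition m k = anti-ext (λ m → L m k) (λ m → R m k) L-anti R-anti base m
  where
  L R : ℤ → ℤ → ℤ
  L m k = w₀ (m +ᶻ k) +ᶻ w₀ (m -ᶻ k)
  R m k = + 2 *ᶻ (w₀ m *ᶻ w₀ k) +ᶻ w₁ m *ᶻ w₁ k
  s₁ : ∀ m k → (m +ᶻ + 4) +ᶻ k ≡ (m +ᶻ k) +ᶻ + 4
  s₁ = ℤR.solve-∀
  s₂ : ∀ m k → m +ᶻ (k +ᶻ + 4) ≡ (m +ᶻ k) +ᶻ + 4
  s₂ = ℤR.solve-∀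
  s₃ : ∀ m k → m -ᶻ k ≡ (m -ᶻ (k +ᶻ + 4)) +ᶻ + 4
  s₃ = ℤR.solve-∀
  n₁ : ∀ a b → -ᶻ a +ᶻ -ᶻ b ≡ -ᶻ (a +ᶻ b)
  n₁ = ℤR.solve-∀
  n₂ : ∀ a b c d → + 2 *ᶻ (-ᶻ a *ᶻ b) +ᶻ -ᶻ c *ᶻ d ≡ -ᶻ (+ 2 *ᶻ (a *ᶻ b) +ᶻ c *ᶻ d)
  n₂ = ℤR.solve-∀
  n₃ : ∀ a b c d → + 2 *ᶻ (a *ᶻ -ᶻ b) +ᶻ c *ᶻ -ᶻ d ≡ -ᶻ (+ 2 *ᶻ (a *ᶻ b) +ᶻ c *ᶻ d)
  n₃ = ℤR.solve-∀
  w₀-shift : ∀ {x} y → x ≡ y +ᶻ + 4 → w₀ x ≡ -ᶻ w₀ y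
  w₀-shift y refl = w₀-anti y
  L-anti : AntiPeriodic (λ m → L m k)
  L-anti m = trans (cong₂ _+ᶻ_ (w₀-shift (m +ᶻ k) (s₁ m k)) (w₀-shift (m -ᶻ k) (s₁ m (-ᶻ k)))) (n₁ (w₀ (m +ᶻ k)) (w₀ (m -ᶻ k)))
  R-anti : AntiPeriodic (λ m → R m k)
  R-anti m = trans (cong₂ (λ x y → + 2 *ᶻ (x *ᶻ w₀ k) +ᶻ y *ᶻ w₁ k) (w₀-anti m) (w₁-anti m)) (n₂ (w₀ m) (w₀ k) (w₁ m) (w₁ k))
  L-anti′ : ∀ m → AntiPeriodic (L m)
  L-anti′ m k = trans (cong₂ _+ᶻ_ (w₀-shift (m +ᶻ k) (s₂ m k))
      (trans (sym (ℤP.neg-involutive _)) (cong -ᶻ_ (sym (w₀-shift (m -ᶻ (k +ᶻ + 4)) (s₃ m k))))))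
    (n₁ (w₀ (m +ᶻ k)) (w₀ (m -ᶻ k)))
  R-anti′ : ∀ m → AntiPeriodic (R m)
  R-anti′ m k = trans (cong₂ (λ x y → + 2 *ᶻ (w₀ m *ᶻ x) +ᶻ w₁ m *ᶻ y) (w₀-anti k) (w₁-anti k)) (n₃ (w₀ m) (w₀ k) (w₁ m) (w₁ k))
  base′ : ∀ r → r < 4 → ∀ q → q < 4 → L (+ r) (+ q) ≡ R (+ r) (+ q)
  base′ 0 _ 0 _ = refl
  base′ 0 _ 1 _ = refl
  base′ 0 _ 2 _ = refl
  base′ 0 _ 3 _ = refl
  base′ 1 _ 0 _ = refl
  base′ 1 _ 1 _ = refl
  base′ 1 _ 2 _ = refl
  base′ 1 _ 3 _ = refl
  base′ 2 _ 0 _ = refl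
  base′ 2 _ 1 _ = refl
  base′ 2 _ 2 _ = refl
  base′ 2 _ 3 _ = refl
  base′ 3 _ 0 _ = refl
  base′ 3 _ 1 _ = refl
  base′ 3 _ 2 _ = refl
  base′ 3 _ 3 _ = refl
  base′ (suc (suc (suc (suc r)))) (s≤s (s≤s (s≤s (s≤s ())))) q _
  base′ 0 _ (suc (suc (suc (suc q)))) (s≤s (s≤s (s≤s (s≤s ()))))
  base′ 1 _ (suc (suc (suc (suc q)))) (s≤s (s≤s (s≤s (s≤s ()))))
  base′ 2 _ (suc (suc (suc (suc q)))) (s≤s (s≤s (s≤s (s≤s ()))))
  base′ 3 _ (suc (suc (suc (suc q)))) (s≤s (s≤s (s≤s (s≤s ()))))
  base : ∀ r → r < 4 → L (+ r) k ≡ R (+ r) k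
  base r l = anti-ext (L (+ r)) (R (+ r)) (L-anti′ (+ r)) (R-anti′ (+ r)) (base′ r l) k

SquareClass : ℕ → (ℤ → ℤ) → Set
SquareClass r w = ∀ m → (w m ≡ + 0) ⊎ ((∣ m ∣ * ∣ m ∣) % 8 ≡ r % 8)

w₀-multiple : ∀ n → (w₀ℕ n ≡ + 0) ⊎ (∃ λ l → n ≡ 4 * l)
w₀-multiple 0 = inj₂ (0 , refl)
w₀-multiple 1 = inj₁ refl
w₀-multiple 2 = inj₁ refl
w₀-multiple 3 = inj₁ refl
w₀-multiple (suc (suc (suc (suc n)))) with w₀-multiple n
... | inj₁ z       = inj₁ (cong -ᶻ_ z)
... | inj₂ (l , e) = inj₂ (suc l , trans (cong (λ x → 4 + x) e) (sym (*-suc 4 l)))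

w₁-odd : ∀ n → (w₁ℕ n ≡ + 0) ⊎ (∃ λ l → n ≡ 1 + 2 * l)
w₁-odd 0 = inj₁ refl
w₁-odd 1 = inj₂ (0 , refl)
w₁-odd 2 = inj₁ refl
w₁-odd 3 = inj₂ (1 , refl)
w₁-odd (suc (suc (suc (suc n)))) with w₁-odd n
... | inj₁ z       = inj₁ (cong -ᶻ_ z)
... | inj₂ (l , e) = inj₂ (2 + l , trans (cong (λ x → 4 + x) e) (lem l))
  where
  lem : ∀ l → 4 + (1 + 2 * l) ≡ 1 + 2 * (2 + l)
  lem = ℕR.solve-∀

pronic-even : ∀ n → ∃ λ h → n * suc n ≡ 2 * h
pronic-even zero    = 0 , refl
pronic-even (suc n) = let (h , e) = pronic-even n in suc n + h , trans (lem n) (trans (cong (λ x → x + 2 * suc n) e) (lem′ n h))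
  where
  lem : ∀ n → suc n * suc (suc n) ≡ n * suc n + 2 * suc n
  lem = ℕR.solve-∀
  lem′ : ∀ n h → 2 * h + 2 * suc n ≡ 2 * (suc n + h)
  lem′ = ℕR.solve-∀

w₀-SquareClass : SquareClass 0 w₀
w₀-SquareClass m with w₀-multiple ∣ m ∣
... | inj₁ z       = inj₁ z
... | inj₂ (l , e) = inj₂ (trans (cong (λ x → (x * x) % 8) e) (trans (cong (_% 8) (lem l)) (DivMod.m*n%n≡0 (2 * (l * l)) 8)))
  where
  lem : ∀ l → 4 * l * (4 * l) ≡ 2 * (l * l) * 8
  lem = ℕR.solve-∀

w₁-SquareClass : SquareClass 1 w₁
w₁-SquareClass m with w₁-odd ∣ m ∣
... | inj₁ z       = inj₁ z
... | inj₂ (l , e) = inj₂ (trans (cong (λ x → (x * x) % 8) e) (trans (cong (_% 8) (trans (lem l) (cong (λ x → 1 + 4 * x) (proj₂ (pronic-even l)))))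
    (trans (cong (_% 8) (lem′ (proj₁ (pronic-even l)))) (DivMod.[m+kn]%n≡m%n 1 (proj₁ (pronic-even l)) 8))))
  where
  lem : ∀ l → (1 + 2 * l) * (1 + 2 * l) ≡ 1 + 4 * (l * suc l)
  lem = ℕR.solve-∀
  lem′ : ∀ h → 1 + 4 * (2 * h) ≡ 1 + h * 8
  lem′ = ℕR.solve-∀

tri-even : ∀ k → ∃ λ h → tri k ≡ 2 * h
tri-even (+ zero)  = 0 , refl
tri-even (+ suc n) = let (h , e) = pronic-even n in h , trans (ℤP.abs-* (+ suc n) (+ n)) (trans (*-comm (suc n) n) e)
tri-even -[1+ n ]  = let (h , e) = pronic-even (suc n) in h , trans (ℤP.abs-* -[1+ n ] -[1+ suc (n + 0) ]) (trans (cong (λ x → suc n * suc (suc x)) (+-identityʳ n)) e)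

J-Supp : Supp 0 J
J-Supp = Supp-∑ 0 (tFam λ k → const (+ 2 *ᶻ k -ᶻ + 1)) λ k →
  Supp-⊛ 0 0 (Supp-⊛ 0 0 (Supp-const (sgn ∣ k ∣)) (Supp-% (4 * tri k) 0 (class k) (Supp-X (4 * tri k)))) (Supp-const (+ 2 *ᶻ k -ᶻ + 1))
  where
  lem : ∀ h → 4 * (2 * h) ≡ h * 8
  lem = ℕR.solve-∀
  class : ∀ k → (4 * tri k) % 8 ≡ 0
  class k = let (h , e) = tri-even k in trans (cong (λ x → (4 * x) % 8) e) (trans (cong (_% 8) (lem h)) (DivMod.m*n%n≡0 h 8))

squareFam : (ℤ → ℤ) → Fam
squareFam w = ordFam 0 1 (λ m → const (w m) ⊛ X (∣ m ∣ * ∣ m ∣)) λ m →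
  ∣ m ∣ * ∣ m ∣ , Ord-⊛ʳ (const (w m)) (Ord-Xa _) , ≤-trans (n≤n² ∣ m ∣) (m≤m+n _ 0)

const-0-⊛ : ∀ {x} f → x ≡ + 0 → const x ⊛ f ≈ 𝟘
const-0-⊛ {x} f refl = ≈-trans (⊛-comm (const (+ 0)) f) (⊛-𝟘 f ≈-refl)

𝟘-Supp : ∀ r {f} → f ≈ 𝟘 → Supp r f
𝟘-Supp r e n _ = trans (at e n) (𝟘-at n)

square-term-Supp : ∀ r w → SquareClass r w → ∀ m → Supp r (const (w m) ⊛ X (∣ m ∣ * ∣ m ∣))
square-term-Supp r w p m with p m
... | inj₁ z = 𝟘-Supp r (const-0-⊛ _ z)
... | inj₂ e = Supp-⊛ 0 r (Supp-const (w m)) (Supp-% (∣ m ∣ * ∣ m ∣) r e (Supp-X _))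

square-Supp : ∀ r w → SquareClass r w → Supp r (∑ (squareFam w))
square-Supp r w p = Supp-∑ r (squareFam w) (square-term-Supp r w p)

Kε-weighted : ∀ w → AntiPeriodic w → K ⊛ (const (+ 2) ⊛ weighted w ε) ≈ ⊝ (J ⊛ ∑ (squareFam w))
Kε-weighted w p = begin
  euler∞ 2 ⊛ ψ ⊛ θ ⊛ (const (+ 2) ⊛ weighted w ε)
    ≈⟨ solve 4 (λ e f g a → e :* f :* g :* (con (+ 2) :* a) := e :* f :* con (+ 2) :* (g :* a)) ≈-refl (euler∞ 2) ψ θ (weighted w ε) ⟩
  euler∞ 2 ⊛ ψ ⊛ const (+ 2) ⊛ (θ ⊛ weighted w ε)
    ≈⟨ ⊛-congˡ (≈-trans (θ-weighted w ε p) (∑-⊛ (Shear.ĤFam 3 w ε) C (squareFam w) λ M →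
         ≈-trans (⊛-congˡ (Ĥε-squareᶻ M)) (solve 3 (λ a b d → a :* (b :* d) := d :* (a :* b)) ≈-refl (const (w M)) (X (∣ M ∣ * ∣ M ∣)) C))) ⟩
  euler∞ 2 ⊛ ψ ⊛ const (+ 2) ⊛ (C ⊛ ∑ (squareFam w))
    ≈⟨ solve 4 (λ e f a b → e :* f :* con (+ 2) :* (a :* b) := e :* (con (+ 2) :* (a :* f)) :* b) ≈-refl (euler∞ 2) ψ C (∑ (squareFam w)) ⟩
  euler∞ 2 ⊛ (const (+ 2) ⊛ (C ⊛ ψ)) ⊛ ∑ (squareFam w)
    ≈⟨ ⊛-cong (⊛-congˡ 2ψC) ≈-refl ⟩
  euler∞ 2 ⊛ ⊝ (P ⊛ J) ⊛ ∑ (squareFam w)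
    ≈⟨ solve 4 (λ e p j s → e :* (:- (p :* j)) :* s := (e :* p) :* (:- (j :* s))) ≈-refl (euler∞ 2) P J (∑ (squareFam w)) ⟩
  (euler∞ 2 ⊛ P) ⊛ ⊝ (J ⊛ ∑ (squareFam w))
    ≈⟨ ⊛-cong euler-P ≈-refl ⟩
  𝟙 ⊛ ⊝ (J ⊛ ∑ (squareFam w))
    ≈⟨ ⊛-identityˡ _ ⟩
  ⊝ (J ⊛ ∑ (squareFam w)) ∎
  where open ≈-Reasoning

Supp⇒Van : ∀ r q {f} → r % 8 ≢ q % 8 → Supp r f → Van q f
Supp⇒Van r q r≢q p n n≡q = p n λ n≡r → r≢q (trans (sym n≡r) n≡q)

Van-2 : ∀ r {f} → Van r (const (+ 2) ⊛ f) → Van r f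
Van-2 r {f} p n e with ℤP.i*j≡0⇒i≡0∨j≡0 (+ 2) (trans (sym (const-⊛ (+ 2) f n)) (p n e))
... | inj₂ z = z

ε-weighted-Van : ∀ r q w → AntiPeriodic w → SquareClass r w → r % 8 ≢ q % 8 → Van q (weighted w ε)
ε-weighted-Van r q w p c r≢q = Van-2 q (Van-cancel 0 q (λ _ ()) K-head K-Supp
  (Van-≈ q (Kε-weighted w p) (Supp⇒Van r q r≢q (Supp-⊝ r (Supp-⊛ 0 r J-Supp (square-Supp r w c))))))

ε-weighted-proj : ∀ w n → weighted w ε n ≡ ι (+ n) *ᶻ weighted w φ n
ε-weighted-proj w n = ∑-scale-at (ι (+ n)) (weightedFam w ε) (weightedFam w φ) n λ m →
  trans (const-⊛ (w m) (hat ε m) n)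
  (trans (cong (w m *ᶻ_) (trans (sym (at (proj-X (+ 0) ∣ m ∣ (φ ∣ m ∣)) n)) (cong (_*ᶻ hat φ m n) (cong ι (ℤP.+-identityˡ (+ n))))))
  (trans (lem (w m) (ι (+ n)) (hat φ m n)) (cong (ι (+ n) *ᶻ_) (sym (const-⊛ (w m) (hat φ m) n)))))
  where
  lem : ∀ a b c → a *ᶻ (b *ᶻ c) ≡ b *ᶻ (a *ᶻ c)
  lem = ℤR.solve-∀

ι₀-%8 : ∀ n → ι₀ n ≡ ι₀ (n % 8)
ι₀-%8 n = trans (cong ι₀ (trans (DivMod.m≡m%n+[m/n]*n n 8) (+-comm (n % 8) _))) (go (n / 8) (n % 8))
  where
  go : ∀ k r → ι₀ (k * 8 + r) ≡ ι₀ r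
  go zero    r = refl
  go (suc k) r = go k r

φ-weighted-Van : ∀ r q w → AntiPeriodic w → SquareClass r w → r % 8 ≢ q % 8 → ι₀ (q % 8) ≡ + 1 → Van q (weighted w φ)
φ-weighted-Van r q w p c r≢q ιq n n≡ = trans (sym (ℤP.*-identityˡ _))
  (trans (cong (_*ᶻ weighted w φ n) (sym (trans (ι₀-%8 n) (trans (cong ι₀ n≡) ιq))))
  (trans (sym (ε-weighted-proj w n)) (ε-weighted-Van r q w p c r≢q n n≡)))

A₀ A₁ : Series
A₀ = weighted w₀ φ
A₁ = weighted w₁ φ

A₀-Van₄ : Van 4 A₀
A₀-Van₄ = φ-weighted-Van 0 4 w₀ w₀-anti w₀-SquareClass (λ ()) refl

A₁-Van₅ : Van 5 A₁
A₁-Van₅ = φ-weighted-Van 1 5 w₁ w₁-anti w₁-SquareClass (λ ()) refl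

open Conv 0 using () renaming (t to t₁; tFam to tFam₁; ∑t-const to ∑t₁-const; Ĥ to Ĥ₁; H to H₁; Ĥ-H to Ĥ-H₁; Ĥ-even to Ĥ-even₁; H-reflection to H-reflection₁)

corrFam : ℤ → Fam
corrFam m = tFam₁ λ k → ⊝ δ (m -ᶻ + 1 *ᶻ k)

Hφ-reflection : ∀ m → H₁ φ m ≈ ∑ (corrFam m) ⊕ H₁ φ (-[1+ 1 ] -ᶻ m)
Hφ-reflection m = ≈-trans (H-reflection₁ φ (λ i → P ⊖ δ i) φ-reflection m) (⊕-cong
  (≈-trans (∑-⊕ (tFam₁ λ k → P ⊖ δ (m -ᶻ + 1 *ᶻ k)) (tFam₁ λ _ → P) (corrFam m) λ k →
      solve 3 (λ t p d → t :* (p :- d) := t :* p :+ t :* (:- d)) ≈-refl (t₁ k) P (δ (m -ᶻ + 1 *ᶻ k)))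
    (𝟘-⊕ _ (∑t₁-const P))) ≈-refl)

Ĥφ-step : ∀ n → Ĥ₁ φ (+ n) ≈ X n ⊛ ∑ (corrFam (+ n)) ⊕ X (2 * n + 2) ⊛ Ĥ₁ φ (+ (n + 2))
Ĥφ-step n = begin
  Ĥ₁ φ (+ n)                           ≈⟨ ≈-sym (X0-⊛ _) ⟩
  X 0 ⊛ Ĥ₁ φ (+ n)                     ≈⟨ Ĥ-H₁ φ n 0 (+ n) refl ⟩
  X n ⊛ H₁ φ (+ n)                     ≈⟨ ⊛-congˡ (Hφ-reflection (+ n)) ⟩
  X n ⊛ (∑ (corrFam (+ n)) ⊕ H₁ φ (-[1+ 1 ] -ᶻ + n))
    ≈⟨ solve 3 (λ x a b → x :* (a :+ b) := x :* a :+ x :* b) ≈-refl (X n) (∑ (corrFam (+ n))) (H₁ φ (-[1+ 1 ] -ᶻ + n)) ⟩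
  X n ⊛ ∑ (corrFam (+ n)) ⊕ X n ⊛ H₁ φ (-[1+ 1 ] -ᶻ + n)
    ≈⟨ ⊕-congˡ (⊛-congˡ (≈-trans (≡⇒≈ (cong (H₁ φ) (trans (lem₁ (+ n)) (cong -ᶻ_ (sym (ℤP.pos-+ n 2))))))
         (≈-trans (≈-sym (X0-⊛ _)) (≈-sym (Ĥ-H₁ φ 0 (n + 2) (-ᶻ (+ (n + 2))) (sym (ℤP.+-inverseʳ (+ (n + 2))))))))) ⟩
  X n ⊛ ∑ (corrFam (+ n)) ⊕ X n ⊛ (X (n + 2) ⊛ Ĥ₁ φ (-ᶻ (+ (n + 2))))
    ≈⟨ ⊕-congˡ (≈-trans (X-merge n (n + 2) _ (lem₂ n)) (⊛-congˡ (Ĥ-even₁ φ (+ (n + 2))))) ⟩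
  X n ⊛ ∑ (corrFam (+ n)) ⊕ X (2 * n + 2) ⊛ Ĥ₁ φ (+ (n + 2)) ∎
  where
  open ≈-Reasoning
  lem₁ : ∀ n → -[1+ 1 ] -ᶻ n ≡ -ᶻ (n +ᶻ + 2)
  lem₁ = ℤR.solve-∀
  lem₂ : ∀ n → n + (n + 2) ≡ 2 * n + 2
  lem₂ = ℕR.solve-∀

Supp-𝟙 : Supp 0 (⊝ 𝟙)
Supp-𝟙 = Supp-⊝ 0 (Supp-const (+ 1))

corr-Van : ∀ ν n → n % 8 ≢ 0 → n % 8 ≢ (2 + 4 * ν) % 8 → (X (2 * ν) ⊛ ∑ (corrFam (+ (2 * ν)))) n ≡ + 0
corr-Van ν n n≢0 n≢2 = trans (sym (at (∑-⊛ F (X (2 * ν)) (corrFam (+ (2 * ν))) λ _ → ≈-refl) n))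
  (∑-zero-at F n λ k → go k (+ (2 * ν) -ᶻ + 1 *ᶻ k) (lem (+ (2 * ν)) k))
  where
  F : Fam
  F = scaleFam (X (2 * ν)) (corrFam (+ (2 * ν)))
  lem : ∀ m k → k ≡ m -ᶻ (m -ᶻ + 1 *ᶻ k)
  lem = ℤR.solve-∀
  p₁ : ∀ ν → 2 * ν + (2 * ν + 1) * (2 * ν) ≡ 4 * (ν * suc ν)
  p₁ = ℕR.solve-∀
  p₁′ : ∀ h → 4 * (2 * h) ≡ h * 8
  p₁′ = ℕR.solve-∀
  zero-term : ∀ k {d} → d ≈ 𝟘 → (X (2 * ν) ⊛ (t₁ k ⊛ ⊝ d)) n ≡ + 0
  zero-term k {d} e = trans (at (⊛-𝟘 (X (2 * ν)) (⊛-𝟘 (t₁ k) (≈-trans (⊝-cong e) (solve 0 (:- con (+ 0) := con (+ 0)) ≈-refl)))) n) (𝟘-at n)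
  supported : ∀ k → n % 8 ≢ (2 * ν + 1 * tri k) % 8 → (X (2 * ν) ⊛ (t₁ k ⊛ ⊝ 𝟙)) n ≡ + 0
  supported k n≢ = Supp-⊛ (2 * ν) (1 * tri k + 0) (Supp-X (2 * ν)) (Supp-⊛ (1 * tri k) 0 (Supp-⊛ 0 (1 * tri k) (Supp-const (sgn ∣ k ∣)) (Supp-X _)) Supp-𝟙) n
    (λ e → n≢ (trans e (cong (λ x → (2 * ν + x) % 8) (+-identityʳ (1 * tri k)))))
  e₁ : (2 * ν + 1 * tri (+ (2 * ν) -ᶻ -[1+ 0 ])) % 8 ≡ 0
  e₁ = trans (cong (λ x → (2 * ν + x) % 8) (trans (*-identityˡ _) (trans (ℤP.abs-* (+ (2 * ν + 1)) ((+ (2 * ν + 1)) -ᶻ + 1))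
         (cong (λ x → (2 * ν + 1) * ∣ x ∣) (s (+ (2 * ν)))))))
       (trans (cong (_% 8) (trans (p₁ ν) (trans (cong (4 *_) (proj₂ (pronic-even ν))) (p₁′ (proj₁ (pronic-even ν)))))) (DivMod.m*n%n≡0 (proj₁ (pronic-even ν)) 8))
    where
    s : ∀ x → (x +ᶻ + 1) -ᶻ + 1 ≡ x
    s = ℤR.solve-∀
  e₂ : (2 * ν + 1 * tri (+ (2 * ν) -ᶻ -[1+ 1 ])) % 8 ≡ (2 + 4 * ν) % 8
  e₂ = trans (cong (λ x → (2 * ν + x) % 8) (trans (*-identityˡ _) (trans (ℤP.abs-* (+ (2 * ν + 2)) ((+ (2 * ν + 2)) -ᶻ + 1))
         (cong (λ x → (2 * ν + 2) * ∣ x ∣) (trans (s (+ (2 * ν))) (sym (ℤP.pos-+ (2 * ν) 1)))))))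
       (trans (cong (_% 8) (q ν)) (trans (cong (λ x → (2 + 4 * ν + 4 * x) % 8) (proj₂ (pronic-even ν)))
         (trans (cong (λ x → (2 + 4 * ν + x) % 8) (p₁′ (proj₁ (pronic-even ν)))) (DivMod.[m+kn]%n≡m%n (2 + 4 * ν) (proj₁ (pronic-even ν)) 8))))
    where
    s : ∀ x → (x +ᶻ + 2) -ᶻ + 1 ≡ x +ᶻ + 1
    s = ℤR.solve-∀
    q : ∀ ν → 2 * ν + (2 * ν + 2) * (2 * ν + 1) ≡ 2 + 4 * ν + 4 * (ν * suc ν)
    q = ℕR.solve-∀
  go : ∀ k i → k ≡ + (2 * ν) -ᶻ i → (X (2 * ν) ⊛ (t₁ k ⊛ ⊝ δ i)) n ≡ + 0
  go k (+ l) e    = zero-term k ≈-refl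
  go k -[1+ 0 ] e = supported k λ d → n≢0 (trans d (trans (cong (λ x → (2 * ν + 1 * tri x) % 8) e) e₁))
  go k -[1+ 1 ] e = supported k λ d → n≢2 (trans d (trans (cong (λ x → (2 * ν + 1 * tri x) % 8) e) e₂))
  go k -[1+ suc (suc l) ] e = zero-term k ≈-refl

Ĥφ-Van : ∀ b n → n ≤ b → ∀ ν → n % 8 ≢ 0 → n % 8 ≢ (2 + 4 * ν) % 8 → Ĥ₁ φ (+ (2 * ν)) n ≡ + 0
Ĥφ-Van b n n≤b ν n≢0 n≢2 = trans (at (Ĥφ-step (2 * ν)) n) (trans (⊕-at _ _ n) (cong₂ _+ᶻ_ (corr-Van ν n n≢0 n≢2) (rest b n≤b)))
  where
  N : ℕ
  N = 2 * (2 * ν) + 2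
  N≡ : ∀ ν → 2 * (2 * ν) + 2 ≡ 2 + 4 * ν
  N≡ = ℕR.solve-∀
  s₁ : ∀ ν → 2 * ν + 2 ≡ 2 * suc ν
  s₁ = ℕR.solve-∀
  s₂ : ∀ ν → 2 * (2 * ν) + 2 + (2 + 4 * suc ν) ≡ suc ν * 8
  s₂ = ℕR.solve-∀
  rest : ∀ b → n ≤ b → (X N ⊛ Ĥ₁ φ (+ (2 * ν + 2))) n ≡ + 0
  rest b n≤b with n <? N
  ... | yes l = X-⊛-< N _ n l
  rest zero n≤b | no l = ⊥-elim (l (≤-<-trans n≤b (≤-trans (s≤s z≤n) (m≤n+m 2 (2 * (2 * ν))))))
  rest (suc b) n≤b | no l = trans (cong (X N ⊛ Ĥ₁ φ (+ (2 * ν + 2))) (sym n≡)) (trans (X-⊛-≥ N _ m)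
      (trans (at (≡⇒≈ (cong (λ x → Ĥ₁ φ (+ x)) (s₁ ν))) m)
      (Ĥφ-Van b m (≤-pred (≤-trans (≤-trans (s≤s (m≤n+m m (N ∸ 1))) (≤-reflexive (trans (cong (_+ m) N-pos) n≡))) n≤b)) (suc ν)
        (λ m≡0 → n≢2 (trans (cong (_% 8) (sym n≡)) (trans (%8-cong-+ N m (2 + 4 * ν) 0 (cong (_% 8) (N≡ ν)) m≡0) (cong (_% 8) (+-identityʳ (2 + 4 * ν))))))
        (λ m≡2 → n≢0 (trans (cong (_% 8) (sym n≡)) (trans (%8-cong-+ N m N (2 + 4 * suc ν) refl m≡2) (trans (cong (_% 8) (s₂ ν)) (DivMod.m*n%n≡0 (suc ν) 8))))))))
    where
    m : ℕ
    m = n ∸ N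
    n≡ : N + m ≡ n
    n≡ = m+[n∸m]≡n (≮⇒≥ l)
    N-pos : suc (N ∸ 1) ≡ N
    N-pos = m+[n∸m]≡n {1} {N} (≤-trans (s≤s z≤n) (m≤n+m 2 (2 * (2 * ν))))

module S₁ = Shear 0 w₀ φ

∑w₀Ĥ-Van : ∀ r → r % 8 ≢ 0 → r % 8 ≢ 2 → Van r S₁.∑wĤ
∑w₀Ĥ-Van r r≢0 r≢2 = Van-∑ r S₁.ĤFam λ M n n≡ → go M n n≡ (w₀-multiple ∣ M ∣)
  where
  q : ∀ l → 4 * l ≡ 2 * (2 * l)
  q = ℕR.solve-∀
  q′ : ∀ l → 2 + 4 * (2 * l) ≡ 2 + l * 8
  q′ = ℕR.solve-∀
  Ĥ-abs : ∀ M → Ĥ₁ φ M ≈ Ĥ₁ φ (+ ∣ M ∣)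
  Ĥ-abs (+ n)    = ≈-refl
  Ĥ-abs -[1+ n ] = Ĥ-even₁ φ (+ suc n)
  go : ∀ M n → n % 8 ≡ r % 8 → _ → (const (w₀ M) ⊛ Ĥ₁ φ M) n ≡ + 0
  go M n n≡ (inj₁ z) = trans (at (const-0-⊛ (Ĥ₁ φ M) z) n) (𝟘-at n)
  go M n n≡ (inj₂ (l , e)) = trans (const-⊛ (w₀ M) (Ĥ₁ φ M) n) (trans (cong (w₀ M *ᶻ_)
    (trans (at (Ĥ-abs M) n) (trans (at (≡⇒≈ (cong (λ x → Ĥ₁ φ (+ x)) (trans e (q l)))) n)
      (Ĥφ-Van n n ≤-refl (2 * l) (λ d → r≢0 (trans (sym n≡) d))
        (λ d → r≢2 (trans (sym n≡) (trans d (trans (cong (_% 8) (q′ l)) (DivMod.[m+kn]%n≡m%n 2 l 8)))))))))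
    (ℤP.*-zeroʳ (w₀ M)))

Θ-fam : (ℤ → ℤ) → Fam
Θ-fam w = ordFam 0 1 (λ k → const (sgn ∣ k ∣) ⊛ (const (w k) ⊛ X (∣ k ∣ * ∣ k ∣))) λ k →
  ∣ k ∣ * ∣ k ∣ , Ord-⊛ʳ (const (sgn ∣ k ∣)) (Ord-⊛ʳ (const (w k)) (Ord-Xa _)) , ≤-trans (n≤n² ∣ k ∣) (m≤m+n _ 0)

Θ₀ Θ₁ : Series
Θ₀ = ∑ (Θ-fam w₀)
Θ₁ = ∑ (Θ-fam w₁)

Θ-Supp : ∀ r w → SquareClass r w → Supp r (∑ (Θ-fam w))
Θ-Supp r w p = Supp-∑ r (Θ-fam w) λ k → Supp-⊛ 0 r (Supp-const (sgn ∣ k ∣)) (square-term-Supp r w p k)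

module Symmetrise where

  open S₁ using (F₂)

  inner : ∀ k → Fam
  inner k = weightedFam (λ m → w₀ (m +ᶻ + 1 *ᶻ k)) φ

  row≈ : ∀ k → ∑ (row F₂ k) ≈ (const (sgn ∣ k ∣) ⊛ X (∣ k ∣ * ∣ k ∣)) ⊛ ∑ (inner k)
  row≈ k = ∑-⊛ (row F₂ k) (const (sgn ∣ k ∣) ⊛ X (∣ k ∣ * ∣ k ∣)) (inner k) λ m → ≈-trans
    (⊛-congˡ (⊛-cong (⊛-congˡ (X-cong (*-identityˡ _))) ≈-refl))
    (solve 3 (λ a b h → a :* (b :* h) := b :* (a :* h)) ≈-refl (const (w₀ (m +ᶻ + 1 *ᶻ k))) (const (sgn ∣ k ∣) ⊛ X (∣ k ∣ * ∣ k ∣)) (hat φ m))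

  inner-reflect : ∀ k → ∑ (inner k) ≈ weighted (λ m → w₀ (m -ᶻ k)) φ
  inner-reflect k = ∑-reflect (inner k) (weightedFam (λ m → w₀ (m -ᶻ k)) φ) λ m →
    ⊛-cong (≡⇒≈ (cong const (trans (sym (w₀-even (m +ᶻ + 1 *ᶻ k))) (cong w₀ (lem m k))))) (≈-sym (hat-even φ m))
    where
    lem : ∀ m k → -ᶻ (m +ᶻ + 1 *ᶻ k) ≡ -ᶻ m -ᶻ k
    lem = ℤR.solve-∀

  inner-double : ∀ k → const (+ 2) ⊛ ∑ (inner k) ≈ const (+ 2 *ᶻ w₀ k) ⊛ A₀ ⊕ const (w₁ k) ⊛ A₁
  inner-double k = begin
    const (+ 2) ⊛ ∑ (inner k)    ≈⟨ solve 1 (λ a → con (+ 2) :* a := a :+ a) ≈-refl (∑ (inner k)) ⟩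
    ∑ (inner k) ⊕ ∑ (inner k)    ≈⟨ ⊕-congˡ (inner-reflect k) ⟩
    ∑ (inner k) ⊕ weighted (λ m → w₀ (m -ᶻ k)) φ
      ≈⟨ ≈-sym (∑-⊕ (weightedFam v φ) (inner k) (weightedFam (λ m → w₀ (m -ᶻ k)) φ) λ m →
           ≈-trans (⊛-cong (const-+ _ _) ≈-refl) (⊛-distribʳ _ _ _)) ⟩
    weighted v φ
      ≈⟨ ∑-⊕ (weightedFam v φ) (weightedFam v₀ φ) (weightedFam v₁ φ) (λ m →
           ≈-trans (⊛-cong (≈-trans (≡⇒≈ (cong const (trans (cong (λ x → w₀ (m +ᶻ x) +ᶻ w₀ (m -ᶻ k)) (ℤP.*-identityˡ k)) (trans (w-addition m k) (cong (_+ᶻ w₁ m *ᶻ w₁ k) (lem (w₀ m) (w₀ k))))))) (const-+ _ _)) ≈-refl) (⊛-distribʳ _ _ _)) ⟩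
    weighted v₀ φ ⊕ weighted v₁ φ
      ≈⟨ ⊕-cong (∑-⊛ (weightedFam v₀ φ) (const (+ 2 *ᶻ w₀ k)) (weightedFam w₀ φ) (λ m → ≈-trans (⊛-cong (const-* _ _) ≈-refl) (⊛-assoc _ _ _)))
                (∑-⊛ (weightedFam v₁ φ) (const (w₁ k)) (weightedFam w₁ φ) (λ m → ≈-trans (⊛-cong (≈-trans (const-* _ _) (⊛-comm _ _)) ≈-refl) (⊛-assoc _ _ _))) ⟩
    const (+ 2 *ᶻ w₀ k) ⊛ A₀ ⊕ const (w₁ k) ⊛ A₁ ∎
    where
    open ≈-Reasoning
    v v₀ v₁ : ℤ → ℤ
    v m  = w₀ (m +ᶻ + 1 *ᶻ k) +ᶻ w₀ (m -ᶻ k)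
    v₀ m = + 2 *ᶻ w₀ k *ᶻ w₀ m
    v₁ m = w₁ m *ᶻ w₁ k
    lem : ∀ a b → + 2 *ᶻ (a *ᶻ b) ≡ + 2 *ᶻ b *ᶻ a
    lem = ℤR.solve-∀

  relation : const (+ 2) ⊛ S₁.∑wĤ ≈ const (+ 2) ⊛ (Θ₀ ⊛ A₀) ⊕ Θ₁ ⊛ A₁
  relation = begin
    const (+ 2) ⊛ S₁.∑wĤ       ≈⟨ ⊛-congˡ S₁.shear ⟩
    const (+ 2) ⊛ ∑ (rows F₂)  ≈⟨ ≈-sym (∑-⊛ L (const (+ 2)) (rows F₂) λ _ → ≈-refl) ⟩
    ∑ L                        ≈⟨ ∑-⊕ L R₀ R₁ split ⟩
    ∑ R₀ ⊕ ∑ R₁                ≈⟨ ⊕-cong (∑-⊛ R₀ (const (+ 2) ⊛ A₀) (Θ-fam w₀) λ _ → ≈-refl) (∑-⊛ R₁ A₁ (Θ-fam w₁) λ _ → ≈-refl) ⟩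
    const (+ 2) ⊛ A₀ ⊛ Θ₀ ⊕ A₁ ⊛ Θ₁
      ≈⟨ solve 4 (λ a b d e → con (+ 2) :* a :* b :+ d :* e := con (+ 2) :* (b :* a) :+ e :* d) ≈-refl A₀ Θ₀ A₁ Θ₁ ⟩
    const (+ 2) ⊛ (Θ₀ ⊛ A₀) ⊕ Θ₁ ⊛ A₁ ∎
    where
    open ≈-Reasoning
    L R₀ R₁ : Fam
    L  = scaleFam (const (+ 2)) (rows F₂)
    R₀ = scaleFam (const (+ 2) ⊛ A₀) (Θ-fam w₀)
    R₁ = scaleFam A₁ (Θ-fam w₁)
    split : ∀ k → fn L k ≈ fn R₀ k ⊕ fn R₁ k
    split k = begin
      const (+ 2) ⊛ ∑ (row F₂ k) ≈⟨ ⊛-congˡ (row≈ k) ⟩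
      const (+ 2) ⊛ (σ ⊛ x ⊛ ∑ (inner k)) ≈⟨ solve 3 (λ s x a → con (+ 2) :* (s :* x :* a) := s :* x :* (con (+ 2) :* a)) ≈-refl σ x (∑ (inner k)) ⟩
      σ ⊛ x ⊛ (const (+ 2) ⊛ ∑ (inner k)) ≈⟨ ⊛-congˡ (≈-trans (inner-double k) (⊕-cong (⊛-cong (const-* _ _) ≈-refl) ≈-refl)) ⟩
      σ ⊛ x ⊛ (const (+ 2) ⊛ const (w₀ k) ⊛ A₀ ⊕ const (w₁ k) ⊛ A₁)
        ≈⟨ solve 6 (λ s x u a v b → s :* x :* (con (+ 2) :* u :* a :+ v :* b) := con (+ 2) :* a :* (s :* (u :* x)) :+ b :* (s :* (v :* x))) ≈-refl
             σ x (const (w₀ k)) A₀ (const (w₁ k)) A₁ ⟩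
      fn R₀ k ⊕ fn R₁ k ∎
      where
      σ x : Series
      σ = const (sgn ∣ k ∣)
      x = X (∣ k ∣ * ∣ k ∣)

relation-Van : ∀ r → r % 8 ≢ 0 → r % 8 ≢ 2 → Van r (const (+ 2) ⊛ (Θ₀ ⊛ A₀) ⊕ Θ₁ ⊛ A₁)
relation-Van r r≢0 r≢2 = Van-≈ r (≈-sym Symmetrise.relation) (Van-⊛ 0 r (Supp-const (+ 2)) (∑w₀Ĥ-Van r r≢0 r≢2))

Van-⊕ˡ : ∀ r {f g} → Van r (f ⊕ g) → Van r g → Van r f
Van-⊕ˡ r {f} {g} p q n e = trans (sym (ℤP.+-identityʳ (f n))) (trans (cong (f n +ᶻ_) (sym (q n e))) (trans (sym (⊕-at f g n)) (p n e)))

Van-⊕ʳ : ∀ r {f g} → Van r (f ⊕ g) → Van r f → Van r g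
Van-⊕ʳ r {f} {g} p q = Van-⊕ˡ r (Van-≈ r (⊕-comm g f) p) q

Θ₀-head : Θ₀ 0 ≢ + 0
Θ₀-head z = case trans (sym Θ₀0) z of λ ()
  where
  Θ₀0 : Θ₀ 0 ≡ + 1
  Θ₀0 = trans (∑-single-at (Θ-fam w₀) 0 off) (trans (const-⊛ (+ 1) _ 0) (trans (ℤP.*-identityˡ _) (trans (const-⊛ (+ 1) (X 0) 0) (trans (ℤP.*-identityˡ _) (X-on 0)))))
    where
    off : ∀ k → k ≢ + 0 → fn (Θ-fam w₀) k 0 ≡ + 0
    off k k≢ = Ord-⊛ʳ (const (sgn ∣ k ∣)) (Ord-⊛ʳ (const (w₀ k)) (Ord-Xa (∣ k ∣ * ∣ k ∣))) 0
      (≤-trans (n≢0⇒n>0 (k≢ ∘ ℤP.∣i∣≡0⇒i≡0)) (n≤n² ∣ k ∣))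

Θ₁-Ord : Ord 1 Θ₁
Θ₁-Ord zero    _        = Θ-Supp 1 w₁ w₁-SquareClass 0 λ ()
Θ₁-Ord (suc _) (s≤s ())

Θ₁-head : Θ₁ 1 ≢ + 0
Θ₁-head z = case trans (sym Θ₁1) z of λ ()
  where
  off : ∀ k → 2 ≤ ∣ k ∣ → fn (Θ-fam w₁) k 1 ≡ + 0
  off k l = Ord-⊛ʳ (const (sgn ∣ k ∣)) (Ord-⊛ʳ (const (w₁ k)) (Ord-Xa (∣ k ∣ * ∣ k ∣))) 1 (≤-trans l (n≤n² ∣ k ∣))
  val : ∀ k → fn (Θ-fam w₁) k 1 ≡ sgn ∣ k ∣ *ᶻ (w₁ k *ᶻ X (∣ k ∣ * ∣ k ∣) 1)
  val k = trans (const-⊛ (sgn ∣ k ∣) _ 1) (cong (sgn ∣ k ∣ *ᶻ_) (const-⊛ (w₁ k) _ 1))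
  one : ∀ k → ∣ k ∣ ≡ 1 → fn (Θ-fam w₁) k 1 ≡ -[1+ 0 ]
  one k e = trans (val k) (trans (cong (λ n → sgn n *ᶻ (w₁ℕ n *ᶻ X (n * n) 1)) e) (cong (λ x → -[1+ 0 ] *ᶻ (+ 1 *ᶻ x)) (X-on 1)))
  Θ₁1 : Θ₁ 1 ≡ -[1+ 1 ]
  Θ₁1 = trans (sym (∑-at (Θ-fam w₁) 1 2 off 2 ≤-refl)) (trans (⊕-at _ _ 1) (cong₂ _+ᶻ_
    (trans (⊕-at _ _ 1) (cong₂ _+ᶻ_ (val (+ 0)) (trans (⊕-at _ _ 1) (cong₂ _+ᶻ_ (one (+ 1) refl) (one -[1+ 0 ] refl)))))
    (trans (⊕-at _ _ 1) (cong₂ _+ᶻ_ (off (+ 2) ≤-refl) (off -[1+ 1 ] ≤-refl)))))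

A₀-Van₆ : Van 6 A₀
A₀-Van₆ = Van-cancel 0 6 (λ _ ()) Θ₀-head (Θ-Supp 0 w₀ w₀-SquareClass)
  (Van-2 6 (Van-⊕ˡ 6 (relation-Van 6 (λ ()) (λ ())) (Van-⊛ 1 5 (Θ-Supp 1 w₁ w₁-SquareClass) A₁-Van₅)))

A₁-Van₃ : Van 3 A₁
A₁-Van₃ = Van-cancel 1 3 Θ₁-Ord Θ₁-head (Θ-Supp 1 w₁ w₁-SquareClass)
  (Van-⊕ʳ 4 (relation-Van 4 (λ ()) (λ ())) (Van-⊛ 0 4 (Supp-const (+ 2)) (Van-⊛ 0 4 (Θ-Supp 0 w₀ w₀-SquareClass) A₀-Van₄)))

-- Odd Durfee symbols of fixed rank

V-term : ℕ → ℕ → ℕ → ℕ → Series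
V-term r i j D = X (2 * (D * (D + r))) ⊛ (c i (D + r) ⊛ c j D)

D≤D[D+r] : ∀ D r → D ≤ 2 * (D * (D + r))
D≤D[D+r] D r = ≤-trans (n≤n² D) (≤-trans (*-monoʳ-≤ D (m≤m+n D r)) (m≤m+n _ _))

V-fam : ℕ → ℕ → ℕ → Fam
V-fam r i j = natFam 0 1 (V-term r i j) λ D →
  2 * (D * (D + r)) , Ord-X _ _ , ≤-trans (D≤D[D+r] D r) (m≤m+n _ 0)

vandermonde : ∀ j i r → ∑ (V-fam r i j) ≈ c (i + j) (j + r)
vandermonde zero i r = ≈-trans (∑-single (V-fam r i 0) off)
  (≈-trans (X0-⊛ _) (≈-trans (⊛-comm _ _) (≈-trans (⊛-identityˡ _) (c-cong r (sym (+-identityʳ i))))))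
  where
  off : ∀ k → k ≢ + 0 → fn (V-fam r i 0) k ≈ 𝟘
  off (+ zero)  k≢ = ⊥-elim (k≢ refl)
  off (+ suc D) _  = ⊛-𝟘 (X _) (⊛-𝟘 (c i (suc D + r)) ≈-refl)
  off -[1+ D ]  _  = ≈-refl
vandermonde (suc j) i r = begin
  ∑ (V-fam r i (suc j))                          ≈⟨ ∑-⊕ (V-fam r i (suc j)) (V-fam r i j) (shiftFam -[1+ 0 ] G) split ⟩
  ∑ (V-fam r i j) ⊕ ∑ (shiftFam -[1+ 0 ] G)      ≈⟨ ⊕-cong (vandermonde j i r) (≈-trans (∑-shift -[1+ 0 ] (shiftFam -[1+ 0 ] G) G λ _ → ≈-refl)
                                                      (≈-trans (∑-⊛ G (X (2 * suc (j + r))) (V-fam (suc r) i j) λ { (+ D) → ≈-refl ; -[1+ D ] → ≈-sym (⊛-𝟘 (X (2 * suc (j + r))) ≈-refl) })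
                                                        (⊛-congˡ (vandermonde j i (suc r))))) ⟩
  c (i + j) (j + r) ⊕ X (2 * suc (j + r)) ⊛ c (i + j) (j + suc r) ≈⟨ ⊕-congˡ (⊛-congˡ (≡⇒≈ (cong (c (i + j)) (+-suc j r)))) ⟩
  c (suc (i + j)) (suc (j + r))                  ≈⟨ c-cong (suc (j + r)) (sym (+-suc i j)) ⟩
  c (i + suc j) (suc j + r) ∎
  where
  open ≈-Reasoning
  g : ℕ → Series
  g E = X (2 * suc (j + r)) ⊛ V-term (suc r) i j E
  G : Fam
  G = natFam 0 1 g λ E → 2 * (E * (E + suc r)) , Ord-⊛ʳ (X (2 * suc (j + r))) (Ord-X _ _) , ≤-trans (D≤D[D+r] E (suc r)) (m≤m+n _ 0)
  lem : ∀ E r d → 2 * (suc E * (suc E + r)) + 2 * d ≡ 2 * suc (E + d + r) + 2 * (E * (E + suc r))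
  lem = ℕR.solve-∀
  powers : ∀ E → X (2 * (suc E * (suc E + r))) ⊛ (c i (suc E + r) ⊛ (X (2 * (j ∸ E)) ⊛ c j E)) ≈ g E
  powers E with E ≤? j
  ... | yes l = begin
    X (2 * (suc E * (suc E + r))) ⊛ (c i (suc E + r) ⊛ (X (2 * (j ∸ E)) ⊛ c j E))
      ≈⟨ solve 4 (λ x a y b → x :* (a :* (y :* b)) := x :* (y :* (a :* b))) ≈-refl (X (2 * (suc E * (suc E + r)))) (c i (suc E + r)) (X (2 * (j ∸ E))) (c j E) ⟩
    X (2 * (suc E * (suc E + r))) ⊛ (X (2 * (j ∸ E)) ⊛ (c i (suc E + r) ⊛ c j E))
      ≈⟨ ≈-trans (X-merge _ _ _ (trans (lem E r (j ∸ E)) (cong (λ x → 2 * suc (x + r) + 2 * (E * (E + suc r))) (m+[n∸m]≡n l)))) (≈-sym (X-merge (2 * suc (j + r)) (2 * (E * (E + suc r))) _ refl)) ⟩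
    X (2 * suc (j + r)) ⊛ (X (2 * (E * (E + suc r))) ⊛ (c i (suc E + r) ⊛ c j E))
      ≈⟨ ⊛-congˡ (⊛-congˡ (⊛-cong (≡⇒≈ (cong (c i) (sym (+-suc E r)))) ≈-refl)) ⟩
    g E ∎
  ... | no E≰j = ≈-trans (⊛-𝟘 (X (2 * (suc E * (suc E + r)))) (⊛-𝟘 (c i (suc E + r)) (⊛-𝟘 (X (2 * (j ∸ E))) z)))
                 (≈-sym (⊛-𝟘 (X (2 * suc (j + r))) (⊛-𝟘 (X (2 * (E * (E + suc r)))) (⊛-𝟘 (c i (E + suc r)) z))))
    where
    z : c j E ≈ 𝟘
    z = c-zero j E (≰⇒> E≰j)
  split : ∀ k → fn (V-fam r i (suc j)) k ≈ fn (V-fam r i j) k ⊕ extend g (k +ᶻ -[1+ 0 ])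
  split (+ zero)  = ≈-sym (⊕-𝟘 _ ≈-refl)
  split -[1+ D ]  = ≈-sym (⊕-𝟘 𝟘 ≈-refl)
  split (+ suc E) = begin
    X (2 * (suc E * (suc E + r))) ⊛ (c i (suc E + r) ⊛ c (suc j) (suc E))
      ≈⟨ ⊛-congˡ (⊛-congˡ (c-pascal j E)) ⟩
    X (2 * (suc E * (suc E + r))) ⊛ (c i (suc E + r) ⊛ (c j (suc E) ⊕ X (2 * (j ∸ E)) ⊛ c j E))
      ≈⟨ solve 4 (λ x a b d → x :* (a :* (b :+ d)) := x :* (a :* b) :+ x :* (a :* d)) ≈-refl (X (2 * (suc E * (suc E + r)))) (c i (suc E + r)) (c j (suc E)) (X (2 * (j ∸ E)) ⊛ c j E) ⟩
    V-term r i j (suc E) ⊕ X (2 * (suc E * (suc E + r))) ⊛ (c i (suc E + r) ⊛ (X (2 * (j ∸ E)) ⊛ c j E))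
      ≈⟨ ⊕-congˡ (powers E) ⟩
    V-term r i j (suc E) ⊕ g E ∎

-- Generating function of the rows of length l with odd entries at most 2D+1.
rowSeries : ℕ → ℕ → Series
rowSeries D l = X l ⊛ c (D + l) l

symbolSeries : ℕ → ℕ → ℕ → Series
symbolSeries D i j = X (2 * D * D + 2 * D + 1) ⊛ (rowSeries D i ⊛ rowSeries D j)

symbolSeries-comm : ∀ D i j → symbolSeries D i j ≈ symbolSeries D j i
symbolSeries-comm D i j = ⊛-congˡ (⊛-comm _ _)

symbolOrder : ℕ → ℕ → ℕ → ℕ
symbolOrder D i j = 2 * D * D + 2 * D + 1 + (i + j)

symbolSeries≈ : ∀ D i j → symbolSeries D i j ≈ X (symbolOrder D i j) ⊛ (c (D + i) i ⊛ c (D + j) j)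
symbolSeries≈ D i j = ≈-trans (⊛-congˡ (≈-trans
    (solve 4 (λ x a y b → (x :* a) :* (y :* b) := (x :* y) :* (a :* b)) ≈-refl (X i) (c (D + i) i) (X j) (c (D + j) j))
    (⊛-cong (X-+ i j) ≈-refl)))
  (X-merge _ (i + j) _ refl)

symbol-Ord : ∀ D i j → Ord (symbolOrder D i j) (symbolSeries D i j)
symbol-Ord D i j = Ord-≈ (symbolSeries≈ D i j) (Ord-X _ _)

D≤symbolOrder : ∀ D i j → D ≤ symbolOrder D i j
D≤symbolOrder D i j = ≤-trans (m≤m+n D (D + 0)) (≤-trans (m≤n+m (2 * D) (2 * D * D)) (≤-trans (m≤m+n (2 * D * D + 2 * D) 1) (m≤m+n _ (i + j))))

i≤symbolOrder : ∀ D i j → i ≤ symbolOrder D i j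
i≤symbolOrder D i j = ≤-trans (m≤m+n i j) (m≤n+m (i + j) (2 * D * D + 2 * D + 1))

j≤symbolOrder : ∀ D i j → j ≤ symbolOrder D i j
j≤symbolOrder D i j = ≤-trans (m≤n+m j i) (m≤n+m (i + j) (2 * D * D + 2 * D + 1))

module FixedRank (μ : ℕ) where

  -- The symbol series with rows of length μ+t and t, re-indexed by k = D+t.
  h : ℕ → ℕ → Series
  h D k = X (1 + μ + 2 * k) ⊛ V-term 0 (μ + k) k D

  h-zero : ∀ D k → k < D → h D k ≈ 𝟘
  h-zero D k l = ⊛-𝟘 (X (1 + μ + 2 * k)) (⊛-𝟘 (X _) (⊛-𝟘 (c (μ + k) (D + 0)) (c-zero k D l)))

  symbol≈h : ∀ D t → symbolSeries D (μ + t) t ≈ h D (D + t)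
  symbol≈h D t = begin
    symbolSeries D (μ + t) t ≈⟨ symbolSeries≈ D (μ + t) t ⟩
    X (symbolOrder D (μ + t) t) ⊛ (c (D + (μ + t)) (μ + t) ⊛ c (D + t) t)
      ≈⟨ ⊛-cong (≈-trans (X-cong (lem D μ t)) (≈-sym (X-+ _ _)))
           (⊛-cong (≈-trans (≈-sym (c-sym D (μ + t))) (≈-trans (c-cong D (lem′ D μ t)) (≡⇒≈ (cong (c (μ + (D + t))) (sym (+-identityʳ D)))))) (≈-sym (c-sym D t))) ⟩
    X (1 + μ + 2 * (D + t)) ⊛ X (2 * (D * (D + 0))) ⊛ (c (μ + (D + t)) (D + 0) ⊛ c (D + t) D)
      ≈⟨ ⊛-assoc _ _ _ ⟩
    h D (D + t) ∎
    where
    open ≈-Reasoning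
    lem : ∀ D μ t → 2 * D * D + 2 * D + 1 + (μ + t + t) ≡ 1 + μ + 2 * (D + t) + 2 * (D * (D + 0))
    lem = ℕR.solve-∀
    lem′ : ∀ D μ t → D + (μ + t) ≡ μ + (D + t)
    lem′ = ℕR.solve-∀

  hFam : ℕ → Fam
  hFam D = natFam 0 1 (h D) λ k → 1 + μ + 2 * k , Ord-X _ _ ,
    ≤-trans (m≤m+n k (k + 0)) (≤-trans (m≤n+m (2 * k) (1 + μ)) (m≤m+n _ 0))

  h₂ : ℤ → ℤ → Series
  h₂ (+ D)    k = extend (h D) k
  h₂ -[1+ D ] k = 𝟘

  H₂ : Fam₂
  H₂ = ordFam₂ 0 1 h₂ λ where
    (+ D) (+ k) → let a = 1 + μ + 2 * k ; b = 2 * (D * (D + 0)) in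
      a ⊔ b , Ord-⊔ (Ord-X _ _) (Ord-⊛ʳ (X (1 + μ + 2 * k)) (Ord-X _ _)) ,
      ≤-trans (D≤D[D+r] D 0) (≤-trans (m≤n⊔m a b) (m≤m+n _ 0)) ,
      ≤-trans (m≤m+n k (k + 0)) (≤-trans (m≤n+m (2 * k) (1 + μ)) (≤-trans (m≤m⊔n a b) (m≤m+n _ 0)))
    (+ D) -[1+ k ] → D + suc k , Ord-𝟘 ≈-refl , ≤-trans (m≤m+n D (suc k)) (m≤m+n _ 0) , ≤-trans (m≤n+m (suc k) D) (m≤m+n _ 0)
    -[1+ D ] k → suc D + ∣ k ∣ , Ord-𝟘 ≈-refl , ≤-trans (m≤m+n (suc D) ∣ k ∣) (m≤m+n _ 0) , ≤-trans (m≤n+m ∣ k ∣ (suc D)) (m≤m+n _ 0)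

  columns : ∑ (rows (flip₂ H₂)) ≈ X 1 ⊛ (X μ ⊛ φ μ)
  columns = ≈-trans (∑-⊛ (rows (flip₂ H₂)) (X (1 + μ)) (weightedφ 0 μ) col) (≈-sym (X-merge 1 μ (φ μ) refl))
    where
    lem : ∀ k → k + k ≡ 2 * k
    lem = ℕR.solve-∀
    col : ∀ k → ∑ (row (flip₂ H₂) k) ≈ X (1 + μ) ⊛ fn (weightedφ 0 μ) k
    col (+ k) = ≈-trans (∑-⊛ (row (flip₂ H₂) (+ k)) (X (1 + μ + 2 * k)) (V-fam 0 (μ + k) k)
        λ { (+ D) → ≈-refl ; -[1+ D ] → ≈-sym (⊛-𝟘 (X (1 + μ + 2 * k)) ≈-refl) })
      (≈-trans (⊛-congˡ (≈-trans (vandermonde k (μ + k) 0) (≈-trans (≡⇒≈ (cong (c (μ + k + k)) (+-identityʳ k))) (c-cong k (trans (+-assoc μ k k) (cong (λ x → μ + x) (lem k)))))))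
      (≈-sym (X-merge (1 + μ) (2 * (1 * k)) _ (cong (λ x → 1 + μ + 2 * x) (*-identityˡ k)))))
    col -[1+ k ] = ≈-trans (mk≈ λ i → trans (∑-zero-at (row (flip₂ H₂) -[1+ k ]) i λ { (+ D) → 𝟘-at i ; -[1+ D ] → 𝟘-at i }) (sym (𝟘-at i)))
      (≈-sym (⊛-𝟘 (X (1 + μ)) ≈-refl))

  rankFam : ℕ → Fam
  rankFam D = natFam 0 1 (λ t → symbolSeries D (μ + t) t) λ t →
    symbolOrder D (μ + t) t , symbol-Ord D (μ + t) t , ≤-trans (j≤symbolOrder D (μ + t) t) (m≤m+n _ 0)

  rank-row : ∀ D → ∑ (rankFam D) ≈ ∑ (hFam D)
  rank-row D = ∑-shift (+ D) (rankFam D) (hFam D) go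
    where
    below : ∀ i → i ℤ.< + D → extend (h D) i ≈ 𝟘
    below (+ k)    (ℤ.+<+ l) = h-zero D k l
    below -[1+ k ] _         = ≈-refl
    go : ∀ t → fn (rankFam D) t ≈ extend (h D) (t +ᶻ + D)
    go (+ t)    = ≈-trans (symbol≈h D t) (≡⇒≈ (cong (h D) (+-comm D t)))
    go -[1+ t ] = ≈-sym (below (D ℤ.⊖ suc t) (ℤP.m⊖1+n<m D (suc t)))

  rankRow : ℤ → Series
  rankRow (+ D)    = ∑ (rankFam D)
  rankRow -[1+ D ] = 𝟘

  rank-total : ∀ F → (∀ D → fn F D ≈ rankRow D) → ∑ F ≈ X 1 ⊛ (X μ ⊛ φ μ)
  rank-total F e = ≈-trans (∑-cong F (rows H₂) λ D → ≈-trans (e D) (same D)) (≈-trans (∑-swap H₂) columns)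
    where
    same : ∀ D → rankRow D ≈ ∑ (row H₂ D)
    same (+ D)    = ≈-trans (rank-row D) (∑-cong (hFam D) (row H₂ (+ D)) λ _ → ≈-refl)
    same -[1+ D ] = mk≈ λ i → trans (𝟘-at i) (sym (∑-zero-at (row H₂ -[1+ D ]) i λ _ → 𝟘-at i))

sumTo : ℕ → (ℕ → ℤ) → ℤ
sumTo zero    f = f 0
sumTo (suc N) f = sumTo N f +ᶻ f (suc N)

sumTo-cong : ∀ N {f g} → (∀ k → f k ≡ g k) → sumTo N f ≡ sumTo N g
sumTo-cong zero    e = e 0
sumTo-cong (suc N) e = cong₂ _+ᶻ_ (sumTo-cong N e) (e (suc N))

∑-sumTo : ∀ F n → (∀ k → fn F -[1+ k ] n ≡ + 0) → (∀ k → n < k → fn F (+ k) n ≡ + 0) → ∑ F n ≡ sumTo n (λ k → fn F (+ k) n)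
∑-sumTo F n neg big = trans (sym (∑-at F n (suc n) z (suc n) ≤-refl))
  (trans (go (suc n)) (trans (cong (sumTo n (λ k → fn F (+ k) n) +ᶻ_) (big (suc n) ≤-refl)) (ℤP.+-identityʳ _)))
  where
  z : ∀ k → suc n ≤ ∣ k ∣ → fn F k n ≡ + 0
  z (+ k)    l = big k l
  z -[1+ k ] _ = neg k
  go : ∀ N → ball (fn F) N n ≡ sumTo N (λ k → fn F (+ k) n)
  go zero    = refl
  go (suc N) = trans (⊕-at _ _ n) (cong₂ _+ᶻ_ (go N) (trans (⊕-at _ _ n) (trans (cong (fn F (+ suc N) n +ᶻ_) (neg N)) (ℤP.+-identityʳ _))))

symbolᶻ : ℕ → ℤ → ℤ → Series
symbolᶻ D (+ i)    (+ j)    = symbolSeries D i j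
symbolᶻ D (+ i)    -[1+ j ] = 𝟘
symbolᶻ D -[1+ i ] j        = 𝟘

symbolᶻ-neg : ∀ D i j → symbolᶻ D i -[1+ j ] ≈ 𝟘
symbolᶻ-neg D (+ i)    j = ≈-refl
symbolᶻ-neg D -[1+ i ] j = ≈-refl

symbolᶻ-comm : ∀ D i j → symbolᶻ D i j ≈ symbolᶻ D j i
symbolᶻ-comm D (+ i)    (+ j)    = symbolSeries-comm D i j
symbolᶻ-comm D (+ i)    -[1+ j ] = ≈-refl
symbolᶻ-comm D -[1+ i ] (+ j)    = ≈-refl
symbolᶻ-comm D -[1+ i ] -[1+ j ] = ≈-refl

symbolᶻ-Ord : ∀ D i j → ∃ λ a → Ord a (symbolᶻ D i j) × D ≤ a × ∣ i ∣ ≤ a × ∣ j ∣ ≤ a × ∣ i -ᶻ j ∣ ≤ a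
symbolᶻ-Ord D (+ i) (+ j) = symbolOrder D i j , symbol-Ord D i j , D≤symbolOrder D i j , i≤symbolOrder D i j , j≤symbolOrder D i j ,
  ≤-trans (subst (λ x → ∣ + i -ᶻ + j ∣ ≤ i + x) (ℤP.∣-i∣≡∣i∣ (+ j)) (ℤP.∣i+j∣≤∣i∣+∣j∣ (+ i) (-ᶻ (+ j)))) (m≤n+m (i + j) (2 * D * D + 2 * D + 1))
symbolᶻ-Ord D i@(+ _) j@(-[1+ _ ]) = D + (∣ i ∣ + ∣ j ∣) , Ord-𝟘 ≈-refl , m≤m+n D _ , ≤-trans (m≤m+n ∣ i ∣ ∣ j ∣) (m≤n+m _ D) , ≤-trans (m≤n+m ∣ j ∣ ∣ i ∣) (m≤n+m _ D) ,
  ≤-trans (subst (λ x → ∣ i -ᶻ j ∣ ≤ ∣ i ∣ + x) (ℤP.∣-i∣≡∣i∣ j) (ℤP.∣i+j∣≤∣i∣+∣j∣ i (-ᶻ j))) (m≤n+m (∣ i ∣ + ∣ j ∣) D)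
symbolᶻ-Ord D i@(-[1+ _ ]) j = D + (∣ i ∣ + ∣ j ∣) , Ord-𝟘 ≈-refl , m≤m+n D _ , ≤-trans (m≤m+n ∣ i ∣ ∣ j ∣) (m≤n+m _ D) , ≤-trans (m≤n+m ∣ j ∣ ∣ i ∣) (m≤n+m _ D) ,
  ≤-trans (subst (λ x → ∣ i -ᶻ j ∣ ≤ ∣ i ∣ + x) (ℤP.∣-i∣≡∣i∣ j) (ℤP.∣i+j∣≤∣i∣+∣j∣ i (-ᶻ j))) (m≤n+m (∣ i ∣ + ∣ j ∣) D)

m+j-j : ∀ m j → (m +ᶻ j) -ᶻ j ≡ m
m+j-j = ℤR.solve-∀

rankSumFam : ℕ → ℤ → Fam
rankSumFam D m = ordFam 0 1 (λ j → symbolᶻ D (m +ᶻ j) j) λ j →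
  let (a , o , _ , _ , l , _) = symbolᶻ-Ord D (m +ᶻ j) j in a , o , ≤-trans l (m≤m+n a 0)

rankSum : ℕ → ℤ → Series
rankSum D m = ∑ (rankSumFam D m)

rankSum-Ord : ∀ D m → Ord (D ⊔ ∣ m ∣) (rankSum D m)
rankSum-Ord D m i l = ∑-zero-at (rankSumFam D m) i λ j →
  let (a , o , D≤a , _ , _ , m≤a) = symbolᶻ-Ord D (m +ᶻ j) j
  in o i (<-≤-trans l (⊔-lub D≤a (subst (λ x → ∣ x ∣ ≤ a) (m+j-j m j) m≤a)))

rankSum-+ : ∀ D μ → rankSum D (+ μ) ≈ ∑ (FixedRank.rankFam μ D)
rankSum-+ D μ = ∑-cong (rankSumFam D (+ μ)) (FixedRank.rankFam μ D) λ where
  (+ t)    → ≈-refl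
  -[1+ t ] → symbolᶻ-neg D (+ μ +ᶻ -[1+ t ]) t

rankSum-even : ∀ D x → rankSum D x ≈ rankSum D (-ᶻ x)
rankSum-even D x = ∑-shift x (rankSumFam D x) (rankSumFam D (-ᶻ x)) λ j →
  ≈-trans (symbolᶻ-comm D (x +ᶻ j) j) (≡⇒≈ (trans (cong (λ y → symbolᶻ D y (x +ᶻ j)) (lem x j)) (cong (symbolᶻ D (-ᶻ x +ᶻ (j +ᶻ x))) (ℤP.+-comm x j))))
  where
  lem : ∀ x j → j ≡ -ᶻ x +ᶻ (j +ᶻ x)
  lem = ℤR.solve-∀

abs-cases : ∀ m → (m ≡ + ∣ m ∣) ⊎ (m ≡ -ᶻ (+ ∣ m ∣))
abs-cases (+ n)    = inj₁ refl
abs-cases -[1+ n ] = inj₂ refl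

rankSum-± : ∀ D m μ → (m ≡ + μ) ⊎ (m ≡ -ᶻ (+ μ)) → rankSum D m ≈ ∑ (FixedRank.rankFam μ D)
rankSum-± D m μ (inj₁ refl) = rankSum-+ D μ
rankSum-± D m μ (inj₂ refl) = ≈-trans (≈-sym (rankSum-even D (+ μ))) (rankSum-+ D μ)

rankSum-abs : ∀ D m → rankSum D m ≈ ∑ (FixedRank.rankFam ∣ m ∣ D)
rankSum-abs D m = rankSum-± D m ∣ m ∣ (abs-cases m)

module Resum (w : ℤ → ℤ) where

  byRows : ℕ → Fam₂
  byRows D = ordFam₂ 0 1 (λ i j → const (w (i -ᶻ j)) ⊛ symbolᶻ D i j) λ i j →
    let (a , o , _ , l , l′ , _) = symbolᶻ-Ord D i j
    in a , Ord-⊛ʳ (const (w (i -ᶻ j))) o , ≤-trans l (m≤m+n a 0) , ≤-trans l′ (m≤m+n a 0)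

  byRank : ℕ → Fam₂
  byRank D = ordFam₂ 0 1 (λ m j → const (w m) ⊛ symbolᶻ D (m +ᶻ j) j) λ m j →
    let (a , o , _ , _ , l , l′) = symbolᶻ-Ord D (m +ᶻ j) j
    in a , Ord-⊛ʳ (const (w m)) o , ≤-trans (subst (λ x → ∣ x ∣ ≤ a) (m+j-j m j) l′) (m≤m+n a 0) , ≤-trans l (m≤m+n a 0)

  rows≈rank : ∀ D → ∑ (rows (byRows D)) ≈ ∑ (rows (byRank D))
  rows≈rank D = ≈-trans (∑-swap (byRows D)) (≈-trans
    (∑-cong (rows (flip₂ (byRows D))) (rows (flip₂ (byRank D))) λ j →
      ≈-sym (∑-shift j (row (flip₂ (byRank D)) j) (row (flip₂ (byRows D)) j) λ m →
        ⊛-cong (≡⇒≈ (cong (λ x → const (w x)) (sym (m+j-j m j)))) ≈-refl))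
    (≈-sym (∑-swap (byRank D))))

  T : ℤ → ℤ → Series
  T (+ D)    m = const (w m) ⊛ rankSum D m
  T -[1+ D ] m = 𝟘

  TFam : Fam₂
  TFam = ordFam₂ 0 1 T λ where
    (+ D) m    → D ⊔ ∣ m ∣ , Ord-⊛ʳ (const (w m)) (rankSum-Ord D m) , ≤-trans (m≤m⊔n D ∣ m ∣) (m≤m+n _ 0) , ≤-trans (m≤n⊔m D ∣ m ∣) (m≤m+n _ 0)
    -[1+ D ] m → suc D + ∣ m ∣ , Ord-𝟘 ≈-refl , ≤-trans (m≤m+n (suc D) ∣ m ∣) (m≤m+n _ 0) , ≤-trans (m≤n+m ∣ m ∣ (suc D)) (m≤m+n _ 0)

  T-row : ∀ D → ∑ (row TFam (+ D)) ≈ ∑ (rows (byRows D))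
  T-row D = ≈-sym (≈-trans (rows≈rank D) (∑-cong (rows (byRank D)) (row TFam (+ D)) λ m →
    ∑-⊛ (row (byRank D) m) (const (w m)) (rankSumFam D m) λ _ → ≈-refl))

  T-column : ∀ m → ∑ (row (flip₂ TFam) m) ≈ X 1 ⊛ (const (w m) ⊛ hat φ m)
  T-column m = ≈-trans (∑-⊛ (row (flip₂ TFam) m) (const (w m)) R λ { (+ D) → ≈-refl ; -[1+ D ] → ≈-sym (⊛-𝟘 (const (w m)) ≈-refl) })
    (≈-trans (⊛-congˡ (FixedRank.rank-total ∣ m ∣ R λ { (+ D) → rankSum-abs D m ; -[1+ D ] → ≈-refl }))
      (solve 3 (λ a b d → a :* (b :* d) := b :* (a :* d)) ≈-refl (const (w m)) (X 1) (hat φ m)))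
    where
    R : Fam
    R = natFam 0 1 (λ D → rankSum D m) λ D → D ⊔ ∣ m ∣ , rankSum-Ord D m , ≤-trans (m≤m⊔n D ∣ m ∣) (m≤m+n _ 0)

  total : ∑ (rows TFam) ≈ X 1 ⊛ weighted w φ
  total = ≈-trans (∑-swap TFam) (∑-⊛ (rows (flip₂ TFam)) (X 1) (weightedFam w φ) T-column)

  byRows-at : ∀ D n → ∑ (rows (byRows D)) n ≡ sumTo n (λ i → sumTo n (λ j → w (+ i -ᶻ + j) *ᶻ symbolSeries D i j n))
  byRows-at D n = trans (∑-sumTo (rows (byRows D)) n (λ k → ∑-zero-at (row (byRows D) -[1+ k ]) n λ j → trans (at (⊛-𝟘 (const (w (-[1+ k ] -ᶻ j))) ≈-refl) n) (𝟘-at n))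
      (λ k n<k → ∑-zero-at (row (byRows D) (+ k)) n λ j → let (a , o , _ , l , _) = symbolᶻ-Ord D (+ k) j in Ord-⊛ʳ (const (w (+ k -ᶻ j))) o n (<-≤-trans n<k l)))
    (sumTo-cong n λ i → trans (∑-sumTo (row (byRows D) (+ i)) n (λ k → trans (at (⊛-𝟘 (const (w (+ i -ᶻ -[1+ k ]))) ≈-refl) n) (𝟘-at n))
        (λ k n<k → let (a , o , _ , _ , l , _) = symbolᶻ-Ord D (+ i) (+ k) in Ord-⊛ʳ (const (w (+ i -ᶻ + k))) o n (<-≤-trans n<k l)))
      (sumTo-cong n λ j → const-⊛ (w (+ i -ᶻ + j)) (symbolSeries D i j) n))

  total-at : ∀ n → (X 1 ⊛ weighted w φ) n ≡ sumTo n (λ D → sumTo n (λ i → sumTo n (λ j → w (+ i -ᶻ + j) *ᶻ symbolSeries D i j n)))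
  total-at n = trans (sym (at total n)) (trans
    (∑-sumTo (rows TFam) n (λ k → ∑-zero-at (row TFam -[1+ k ]) n λ _ → 𝟘-at n)
      (λ k n<k → ∑-zero-at (row TFam (+ k)) n λ m → Ord-⊛ʳ (const (w m)) (rankSum-Ord k m) n (<-≤-trans n<k (m≤m⊔n k ∣ m ∣))))
    (sumTo-cong n λ D → trans (at (T-row D) n) (byRows-at D n)))

-- Enumeration of odd Durfee symbols

ind : {A : Set} → Dec A → ℤ
ind d = if does d then + 1 else + 0

ind-yes : {A : Set} (d : Dec A) → A → ind d ≡ + 1
ind-yes (yes _) a = refl
ind-yes (no ¬a) a = ⊥-elim (¬a a)

ind-no : {A : Set} (d : Dec A) → ¬ A → ind d ≡ + 0
ind-no (yes a) ¬a = ⊥-elim (¬a a)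
ind-no (no _)  ¬a = refl

ind-⇔ : {A B : Set} (d : Dec A) (e : Dec B) → (A → B) → (B → A) → ind d ≡ ind e
ind-⇔ (yes a) e f g = sym (ind-yes e (f a))
ind-⇔ (no ¬a) e f g = sym (ind-no e (¬a ∘ g))

ind-× : {A B : Set} (d : Dec A) (e : Dec B) → ind (d ×-dec e) ≡ ind d *ᶻ ind e
ind-× (yes _) (yes _) = refl
ind-× (yes _) (no _)  = refl
ind-× (no _)  (yes _) = refl
ind-× (no _)  (no _)  = refl

∑ₗ : {A : Set} → (A → ℤ) → List A → ℤ
∑ₗ f []       = + 0
∑ₗ f (x ∷ xs) = f x +ᶻ ∑ₗ f xs

∑ₗ-cong : {A : Set} {f g : A → ℤ} → (∀ x → f x ≡ g x) → ∀ xs → ∑ₗ f xs ≡ ∑ₗ g xs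
∑ₗ-cong e []       = refl
∑ₗ-cong e (x ∷ xs) = cong₂ _+ᶻ_ (e x) (∑ₗ-cong e xs)

∑ₗ-++ : {A : Set} (f : A → ℤ) (xs ys : List A) → ∑ₗ f (xs ++ ys) ≡ ∑ₗ f xs +ᶻ ∑ₗ f ys
∑ₗ-++ f []       ys = sym (ℤP.+-identityˡ _)
∑ₗ-++ f (x ∷ xs) ys = trans (cong (f x +ᶻ_) (∑ₗ-++ f xs ys)) (sym (ℤP.+-assoc (f x) _ _))

∑ₗ-map : {A B : Set} (f : B → ℤ) (g : A → B) (xs : List A) → ∑ₗ f (map g xs) ≡ ∑ₗ (f ∘ g) xs
∑ₗ-map f g []       = refl
∑ₗ-map f g (x ∷ xs) = cong (f (g x) +ᶻ_) (∑ₗ-map f g xs)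

∑ₗ-concatMap : {A B : Set} (f : B → ℤ) (g : A → List B) (xs : List A) → ∑ₗ f (concatMap g xs) ≡ ∑ₗ (λ x → ∑ₗ f (g x)) xs
∑ₗ-concatMap f g []       = refl
∑ₗ-concatMap f g (x ∷ xs) = trans (∑ₗ-++ f (g x) (concatMap g xs)) (cong (∑ₗ f (g x) +ᶻ_) (∑ₗ-concatMap f g xs))

sumTo-suc : ∀ n f → sumTo (suc n) f ≡ f 0 +ᶻ sumTo n (f ∘ suc)
sumTo-suc zero    f = refl
sumTo-suc (suc n) f = trans (cong (_+ᶻ f (suc (suc n))) (sumTo-suc n f)) (ℤP.+-assoc (f 0) _ _)

∑ₗ-applyUpTo : ∀ f (g : ℕ → ℕ) n → ∑ₗ f (applyUpTo g (suc n)) ≡ sumTo n (f ∘ g)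
∑ₗ-applyUpTo f g zero    = ℤP.+-identityʳ (f (g 0))
∑ₗ-applyUpTo f g (suc n) = trans (cong (f (g 0) +ᶻ_) (∑ₗ-applyUpTo f (g ∘ suc) n)) (sym (sumTo-suc n (f ∘ g)))

∑ₗ-upTo : ∀ f n → ∑ₗ f (upTo (suc n)) ≡ sumTo n f
∑ₗ-upTo f n = ∑ₗ-applyUpTo f (λ x → x) n

∑ₗ-filter : {A : Set} {Q : A → Set} (Q? : ∀ x → Dec (Q x)) (f : A → ℤ) (xs : List A) →
            ∑ₗ f (filter Q? xs) ≡ ∑ₗ (λ x → ind (Q? x) *ᶻ f x) xs
∑ₗ-filter Q? f [] = refl
∑ₗ-filter Q? f (x ∷ xs) with does (Q? x)
... | true  = cong₂ _+ᶻ_ (sym (ℤP.*-identityˡ (f x))) (∑ₗ-filter Q? f xs)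
... | false = trans (∑ₗ-filter Q? f xs) (sym (ℤP.+-identityˡ _))

length-filter : {A : Set} {Q : A → Set} (Q? : ∀ x → Dec (Q x)) (xs : List A) → + length (filter Q? xs) ≡ ∑ₗ (λ x → ind (Q? x)) xs
length-filter Q? [] = refl
length-filter Q? (x ∷ xs) with does (Q? x)
... | true  = trans (ℤP.pos-+ 1 _) (cong (+ 1 +ᶻ_) (length-filter Q? xs))
... | false = trans (length-filter Q? xs) (sym (ℤP.+-identityˡ _))

∑ₗ-*ˡ : {A : Set} (a : ℤ) (f : A → ℤ) (xs : List A) → ∑ₗ (λ x → a *ᶻ f x) xs ≡ a *ᶻ ∑ₗ f xs
∑ₗ-*ˡ a f []       = sym (ℤP.*-zeroʳ a)
∑ₗ-*ˡ a f (x ∷ xs) = trans (cong (a *ᶻ f x +ᶻ_) (∑ₗ-*ˡ a f xs)) (sym (ℤP.*-distribˡ-+ a (f x) _))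

∑ˢ : {A : Set} → (A → Series) → List A → Series
∑ˢ f []       = 𝟘
∑ˢ f (x ∷ xs) = f x ⊕ ∑ˢ f xs

∑ˢ-at : {A : Set} (f : A → Series) (xs : List A) (n : ℕ) → ∑ˢ f xs n ≡ ∑ₗ (λ x → f x n) xs
∑ˢ-at f []       n = 𝟘-at n
∑ˢ-at f (x ∷ xs) n = trans (⊕-at (f x) _ n) (cong (f x n +ᶻ_) (∑ˢ-at f xs n))

∑ˢ-cong : {A : Set} {f g : A → Series} → (∀ x → f x ≈ g x) → ∀ xs → ∑ˢ f xs ≈ ∑ˢ g xs
∑ˢ-cong e []       = ≈-refl
∑ˢ-cong e (x ∷ xs) = ⊕-cong (e x) (∑ˢ-cong e xs)

∑ˢ-⊕ : {A : Set} (f g : A → Series) (xs : List A) → ∑ˢ (λ x → f x ⊕ g x) xs ≈ ∑ˢ f xs ⊕ ∑ˢ g xs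
∑ˢ-⊕ f g []       = ≈-sym (⊕-𝟘 𝟘 ≈-refl)
∑ˢ-⊕ f g (x ∷ xs) = ≈-trans (⊕-congˡ (∑ˢ-⊕ f g xs))
  (solve 4 (λ a b d e → (a :+ b) :+ (d :+ e) := (a :+ d) :+ (b :+ e)) ≈-refl (f x) (g x) (∑ˢ f xs) (∑ˢ g xs))

∑ˢ-⊛ˡ : {A : Set} (h : Series) (f : A → Series) (xs : List A) → ∑ˢ (λ x → h ⊛ f x) xs ≈ h ⊛ ∑ˢ f xs
∑ˢ-⊛ˡ h f []       = ≈-sym (⊛-𝟘 h ≈-refl)
∑ˢ-⊛ˡ h f (x ∷ xs) = ≈-trans (⊕-congˡ (∑ˢ-⊛ˡ h f xs)) (solve 3 (λ h a b → h :* a :+ h :* b := h :* (a :+ b)) ≈-refl h (f x) (∑ˢ f xs))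

∑ˢ-⊛ʳ : {A : Set} (h : Series) (f : A → Series) (xs : List A) → ∑ˢ (λ x → f x ⊛ h) xs ≈ ∑ˢ f xs ⊛ h
∑ˢ-⊛ʳ h f xs = ≈-trans (∑ˢ-cong (λ x → ⊛-comm (f x) h) xs) (≈-trans (∑ˢ-⊛ˡ h f xs) (⊛-comm h _))

∑ˢ-++ : {A : Set} (f : A → Series) (xs ys : List A) → ∑ˢ f (xs ++ ys) ≈ ∑ˢ f xs ⊕ ∑ˢ f ys
∑ˢ-++ f []       ys = ≈-sym (𝟘-⊕ _ ≈-refl)
∑ˢ-++ f (x ∷ xs) ys = ≈-trans (⊕-congˡ (∑ˢ-++ f xs ys)) (≈-sym (⊕-assoc (f x) _ _))

∑ˢ-map : {A B : Set} (f : B → Series) (g : A → B) (xs : List A) → ∑ˢ f (map g xs) ≈ ∑ˢ (f ∘ g) xs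
∑ˢ-map f g []       = ≈-refl
∑ˢ-map f g (x ∷ xs) = ⊕-congˡ (∑ˢ-map f g xs)

∑ˢ-concatMap : {A B : Set} (f : B → Series) (g : A → List B) (xs : List A) → ∑ˢ f (concatMap g xs) ≈ ∑ˢ (λ x → ∑ˢ f (g x)) xs
∑ˢ-concatMap f g []       = ≈-refl
∑ˢ-concatMap f g (x ∷ xs) = ≈-trans (∑ˢ-++ f (g x) (concatMap g xs)) (⊕-congˡ (∑ˢ-concatMap f g xs))

valid : ℕ → List ℕ → ℤ
valid D xs = ind (validRow? D xs)

≥-trans : ∀ {x y z} → x ≥ y → y ≥ z → x ≥ z
≥-trans p q = ≤-trans q p

head-bound : ∀ {x xs} → Linked _≥_ (x ∷ xs) → All (λ y → y ≤ x) xs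
head-bound [-]       = []
head-bound (p ∷ lnk) = Linked⇒All ≥-trans p lnk

link : ∀ {x xs} → All (λ y → y ≤ x) xs → Linked _≥_ xs → Linked _≥_ (x ∷ xs)
link []      []        = [-]
link (p ∷ _) [-]       = p ∷ [-]
link (p ∷ _) (q ∷ lnk) = p ∷ q ∷ lnk

bound-mono : ∀ {D E} xs → D ≤ E → All (λ x → x ≤ 2 * D + 1) xs → All (λ x → x ≤ 2 * E + 1) xs
bound-mono xs l = All.map λ p → ≤-trans p (+-monoˡ-≤ 1 (*-monoʳ-≤ 2 l))

odd-top : ∀ D → (2 * D + 1) % 2 ≡ 1
odd-top D = trans (cong (_% 2) (trans (+-comm (2 * D) 1) (cong suc (*-comm 2 D)))) (DivMod.[m+kn]%n≡m%n 1 D 2)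

valid-cons-top : ∀ D xs → valid D ((2 * D + 1) ∷ xs) ≡ valid D xs
valid-cons-top D xs = ind-⇔ (validRow? D ((2 * D + 1) ∷ xs)) (validRow? D xs)
  (λ { (lnk , _ ∷ odds , _ ∷ bs) → Linked.tail lnk , odds , bs })
  (λ { (lnk , odds , bs) → link bs lnk , odd-top D ∷ odds , ≤-refl ∷ bs })

valid-zero : ∀ x xs → valid 0 (x ∷ xs) ≡ ind (x ≟ 1) *ᶻ valid 0 xs
valid-zero x xs = go (x ≟ 1)
  where
  only-1 : ∀ x → x % 2 ≡ 1 → x ≤ 1 → x ≡ 1
  only-1 1 _ _ = refl
  only-1 (suc (suc _)) _ (s≤s ())
  go : (d : Dec (x ≡ 1)) → valid 0 (x ∷ xs) ≡ ind d *ᶻ valid 0 xs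
  go (yes refl) = trans (valid-cons-top 0 xs) (sym (ℤP.*-identityˡ (valid 0 xs)))
  go (no x≢1)   = ind-no (validRow? 0 (x ∷ xs)) λ { (_ , p ∷ _ , b ∷ _) → x≢1 (only-1 x p b) }

valid-suc : ∀ D x xs → valid (suc D) (x ∷ xs) ≡ valid D (x ∷ xs) +ᶻ ind (x ≟ 2 * suc D + 1) *ᶻ valid (suc D) xs
valid-suc D x xs = go (x ≟ 2 * suc D + 1)
  where
  top : 2 * D + 1 < 2 * suc D + 1
  top = +-monoˡ-< 1 (*-monoʳ-< 2 (n<1+n D))
  e : 2 * suc D + 1 ≡ suc (suc (2 * D + 1))
  e = cong (_+ 1) (*-suc 2 D)
  x≤ : x ≢ 2 * suc D + 1 → x % 2 ≡ 1 → x ≤ 2 * suc D + 1 → x ≤ 2 * D + 1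
  x≤ x≢ p l with m≤n⇒m<n∨m≡n (≤-pred (subst (x <_) e (≤∧≢⇒< l x≢)))
  ... | inj₁ x<   = ≤-pred x<
  ... | inj₂ refl = case trans (sym p) (trans (cong (_% 2) (lem D)) (DivMod.m*n%n≡0 (suc D) 2)) of λ ()
    where
    lem : ∀ D → suc (2 * D + 1) ≡ suc D * 2
    lem = ℕR.solve-∀
  shrink : x ≢ 2 * suc D + 1 → ValidRow (suc D) (x ∷ xs) → ValidRow D (x ∷ xs)
  shrink x≢ (lnk , odds@(p ∷ _) , b ∷ _) = lnk , odds , b′ ∷ All.map (λ q → ≤-trans q b′) (head-bound lnk)
    where
    b′ : x ≤ 2 * D + 1
    b′ = x≤ x≢ p b
  go : (d : Dec (x ≡ 2 * suc D + 1)) → valid (suc D) (x ∷ xs) ≡ valid D (x ∷ xs) +ᶻ ind d *ᶻ valid (suc D) xs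
  go (yes refl) = trans (valid-cons-top (suc D) xs) (sym (trans
    (cong (_+ᶻ + 1 *ᶻ valid (suc D) xs) (ind-no (validRow? D (x ∷ xs)) λ { (_ , _ , b ∷ _) → <⇒≱ top b }))
    (trans (ℤP.+-identityˡ _) (ℤP.*-identityˡ _))))
  go (no x≢) = trans (ind-⇔ (validRow? (suc D) (x ∷ xs)) (validRow? D (x ∷ xs)) (shrink x≢)
      (λ { (lnk , odds , bs) → lnk , odds , bound-mono (x ∷ xs) (n≤1+n D) bs }))
    (sym (ℤP.+-identityʳ _))

module Rows (n : ℕ) where

  rowTerm : ℕ → List ℕ → Series
  rowTerm D xs = const (valid D xs) ⊛ X (sum xs)

  rowPoly : ℕ → ℕ → Series
  rowPoly D l = ∑ˢ (rowTerm D) (listsOfLength n l)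

  entries : List ℕ
  entries = upTo (suc n)

  rowPoly-cons : ∀ D l → rowPoly D (suc l) ≈ ∑ˢ (λ x → ∑ˢ (λ xs → rowTerm D (x ∷ xs)) (listsOfLength n l)) entries
  rowPoly-cons D l = ≈-trans (∑ˢ-concatMap (rowTerm D) (λ x → map (x ∷_) (listsOfLength n l)) entries)
    (∑ˢ-cong (λ x → ∑ˢ-map (rowTerm D) (x ∷_) (listsOfLength n l)) entries)

  pick : ℕ → ℕ → Series
  pick e x = const (ind (x ≟ e)) ⊛ X x

  sumTo-pick : ∀ N k a → k ≤ N → sumTo N (λ x → ind (x ≟ k) *ᶻ a) ≡ a
  sumTo-pick N k a l with m≤n⇒m<n∨m≡n l
  sumTo-pick zero    .0       a l | inj₂ refl = ℤP.*-identityˡ a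
  sumTo-pick (suc N) k        a l | inj₁ (s≤s k≤N) = trans (cong₂ _+ᶻ_ (sumTo-pick N k a k≤N)
    (cong (_*ᶻ a) (ind-no (suc N ≟ k) λ { refl → <-irrefl refl k≤N }))) (ℤP.+-identityʳ a)
  sumTo-pick (suc N) .(suc N) a l | inj₂ refl = trans (cong₂ _+ᶻ_ (none N ≤-refl) (cong (_*ᶻ a) (ind-yes (suc N ≟ suc N) refl)))
      (trans (ℤP.+-identityˡ _) (ℤP.*-identityˡ a))
    where
    none : ∀ M → M ≤ N → sumTo M (λ x → ind (x ≟ suc N) *ᶻ a) ≡ + 0
    none zero    l = refl
    none (suc M) l = cong₂ _+ᶻ_ (none M (<⇒≤ l)) (cong (_*ᶻ a) (ind-no (suc M ≟ suc N) λ { refl → <-irrefl refl l }))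

  pick-sum : ∀ e → ∑ˢ (pick e) entries ≈[ n ] X e
  pick-sum e k k≤n = trans (∑ˢ-at (pick e) entries k) (trans (∑ₗ-upTo (λ x → pick e x k) n)
    (trans (sumTo-cong n λ x → trans (const-⊛ (ind (x ≟ e)) (X x) k) (swap x)) (sumTo-pick n k (X e k) k≤n)))
    where
    swap : ∀ x → ind (x ≟ e) *ᶻ X x k ≡ ind (x ≟ k) *ᶻ X e k
    swap x = go (x ≟ e) (x ≟ k)
      where
      go : (d : Dec (x ≡ e)) (d′ : Dec (x ≡ k)) → ind d *ᶻ X x k ≡ ind d′ *ᶻ X e k
      go (yes refl) (yes refl) = refl
      go (yes refl) (no x≢k)   = trans (ℤP.*-identityˡ _) (X-off x k (x≢k ∘ sym))
      go (no x≢e)   (yes refl) = sym (trans (ℤP.*-identityˡ _) (X-off e x x≢e))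
      go (no _)     (no _)     = refl

  pick-⊛ : ∀ e R → ∑ˢ (λ x → const (ind (x ≟ e)) ⊛ (X x ⊛ R)) entries ≈[ n ] X e ⊛ R
  pick-⊛ e R = ≈[]-trans (≈⇒≈[] (≈-trans (∑ˢ-cong (λ x → ≈-sym (⊛-assoc _ _ _)) entries) (∑ˢ-⊛ʳ R (pick e) entries)))
    (⊛-cong[] {∑ˢ (pick e) entries} n (pick-sum e) (λ _ _ → refl))

  picked : ∀ D (e : ℕ) x l → ∑ˢ (λ xs → const (ind (x ≟ e) *ᶻ valid D xs) ⊛ X (x + sum xs)) (listsOfLength n l) ≈
                              const (ind (x ≟ e)) ⊛ (X x ⊛ rowPoly D l)
  picked D e x l = ≈-trans (∑ˢ-cong (λ xs → ≈-trans (⊛-cong (const-* _ _) (≈-sym (X-+ x (sum xs))))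
      (solve 4 (λ a b x y → (a :* b) :* (x :* y) := (a :* x) :* (b :* y)) ≈-refl (const (ind (x ≟ e))) (const (valid D xs)) (X x) (X (sum xs)))) (listsOfLength n l))
    (≈-trans (∑ˢ-⊛ˡ (const (ind (x ≟ e)) ⊛ X x) (rowTerm D) (listsOfLength n l)) (⊛-assoc _ _ _))

  rowPoly-zero : ∀ l → rowPoly 0 (suc l) ≈[ n ] X 1 ⊛ rowPoly 0 l
  rowPoly-zero l = ≈[]-trans (≈⇒≈[] (≈-trans (rowPoly-cons 0 l) (∑ˢ-cong (λ x → ≈-trans
      (∑ˢ-cong (λ xs → ⊛-cong (≡⇒≈ (cong const (valid-zero x xs))) ≈-refl) (listsOfLength n l)) (picked 0 1 x l)) entries)))
    (pick-⊛ 1 (rowPoly 0 l))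

  rowPoly-suc : ∀ D l → rowPoly (suc D) (suc l) ≈[ n ] rowPoly D (suc l) ⊕ X (2 * suc D + 1) ⊛ rowPoly (suc D) l
  rowPoly-suc D l = ≈[]-trans (≈⇒≈[] (≈-trans (rowPoly-cons (suc D) l) (≈-trans (∑ˢ-cong split entries)
      (≈-trans (∑ˢ-⊕ (λ x → ∑ˢ (λ xs → rowTerm D (x ∷ xs)) (listsOfLength n l)) (λ x → const (ind (x ≟ 2 * suc D + 1)) ⊛ (X x ⊛ rowPoly (suc D) l)) entries)
        (⊕-cong (≈-sym (rowPoly-cons D l)) ≈-refl)))))
    (⊕-cong[] {rowPoly D (suc l)} n (λ _ _ → refl) (pick-⊛ (2 * suc D + 1) (rowPoly (suc D) l)))
    where
    split : ∀ x → ∑ˢ (λ xs → rowTerm (suc D) (x ∷ xs)) (listsOfLength n l) ≈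
                  ∑ˢ (λ xs → rowTerm D (x ∷ xs)) (listsOfLength n l) ⊕ const (ind (x ≟ 2 * suc D + 1)) ⊛ (X x ⊛ rowPoly (suc D) l)
    split x = ≈-trans (∑ˢ-cong (λ xs → ≈-trans (⊛-cong (≈-trans (≡⇒≈ (cong const (valid-suc D x xs))) (const-+ _ _)) ≈-refl) (⊛-distribʳ _ _ _)) (listsOfLength n l))
      (≈-trans (∑ˢ-⊕ (λ xs → rowTerm D (x ∷ xs)) (λ xs → const (ind (x ≟ 2 * suc D + 1) *ᶻ valid (suc D) xs) ⊛ X (x + sum xs)) (listsOfLength n l))
        (⊕-congˡ (picked (suc D) (2 * suc D + 1) x l)))

  rowSeries-zero : ∀ l → rowSeries 0 (suc l) ≈ X 1 ⊛ rowSeries 0 l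
  rowSeries-zero l = ≈-trans (⊛-congˡ (≈-trans (c-self (suc l)) (≈-sym (c-self l)))) (≈-sym (X-merge 1 l (c l l) refl))

  rowSeries-suc : ∀ D l → rowSeries (suc D) (suc l) ≈ rowSeries D (suc l) ⊕ X (2 * suc D + 1) ⊛ rowSeries (suc D) l
  rowSeries-suc D l = ≈-trans (⊛-congˡ (≈-trans (c-pascal (D + suc l) l)
      (⊕-congˡ (⊛-cong (X-cong (cong (2 *_) (trans (cong (_∸ l) (+-suc D l)) (m+n∸n≡m (suc D) l)))) (c-cong l (+-suc D l))))))
    (≈-trans (solve 3 (λ x a b → x :* (a :+ b) := x :* a :+ x :* b) ≈-refl (X (suc l)) (c (D + suc l) (suc l)) (X (2 * suc D) ⊛ c (suc D + l) l))
      (⊕-congˡ (≈-trans (X-merge (suc l) (2 * suc D) _ (lem D l)) (≈-sym (X-merge (2 * suc D + 1) l _ refl)))))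
    where
    lem : ∀ D l → suc l + 2 * suc D ≡ 2 * suc D + 1 + l
    lem = ℕR.solve-∀

  rowPoly≈ : ∀ l D → rowPoly D l ≈[ n ] rowSeries D l
  rowPoly≈ zero D = ≈⇒≈[] (≈-trans (⊕-𝟘 _ ≈-refl) (⊛-comm (const (+ 1)) (X 0)))
  rowPoly≈ (suc l) zero = ≈[]-trans (rowPoly-zero l)
    (≈[]-trans (⊛-cong[] {X 1} n (λ _ _ → refl) (rowPoly≈ l 0)) (≈⇒≈[] (≈-sym (rowSeries-zero l))))
  rowPoly≈ (suc l) (suc D) = ≈[]-trans (rowPoly-suc D l)
    (≈[]-trans (⊕-cong[] n (rowPoly≈ (suc l) D) (⊛-cong[] {X (2 * suc D + 1)} n (λ _ _ → refl) (rowPoly≈ l (suc D)))) (≈⇒≈[] (≈-sym (rowSeries-suc D l))))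

sumTo-0 : ∀ N → sumTo N (λ _ → + 0) ≡ + 0
sumTo-0 zero    = refl
sumTo-0 (suc N) = cong (_+ᶻ + 0) (sumTo-0 N)

sumTo-+ : ∀ N f g → sumTo N (λ k → f k +ᶻ g k) ≡ sumTo N f +ᶻ sumTo N g
sumTo-+ zero    f g = refl
sumTo-+ (suc N) f g = trans (cong (_+ᶻ (f (suc N) +ᶻ g (suc N))) (sumTo-+ N f g)) (lem (sumTo N f) (sumTo N g) (f (suc N)) (g (suc N)))
  where
  lem : ∀ a b c d → (a +ᶻ b) +ᶻ (c +ᶻ d) ≡ (a +ᶻ c) +ᶻ (b +ᶻ d)
  lem = ℤR.solve-∀

∑ₗ-sumTo : {A : Set} (N : ℕ) (h : A → ℕ → ℤ) (xs : List A) → ∑ₗ (λ a → sumTo N (h a)) xs ≡ sumTo N (λ k → ∑ₗ (λ a → h a k) xs)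
∑ₗ-sumTo N h []       = sym (sumTo-0 N)
∑ₗ-sumTo N h (x ∷ xs) = trans (cong (sumTo N (h x) +ᶻ_) (∑ₗ-sumTo N h xs)) (sym (sumTo-+ N (h x) _))

∑ₗ-length : ∀ n i (h : ℕ → List ℕ → ℤ) → ∑ₗ (λ xs → h (length xs) xs) (listsOfLength n i) ≡ ∑ₗ (h i) (listsOfLength n i)
∑ₗ-length n zero    h = refl
∑ₗ-length n (suc i) h = trans (peel (λ xs → h (length xs) xs)) (trans
    (∑ₗ-cong (λ x → ∑ₗ-length n i (λ l xs → h (suc l) (x ∷ xs))) (upTo (suc n))) (sym (peel (h (suc i)))))
  where
  peel : ∀ (f : List ℕ → ℤ) → ∑ₗ f (listsOfLength n (suc i)) ≡ ∑ₗ (λ x → ∑ₗ (λ xs → f (x ∷ xs)) (listsOfLength n i)) (upTo (suc n))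
  peel f = trans (∑ₗ-concatMap f (λ x → map (x ∷_) (listsOfLength n i)) (upTo (suc n)))
                 (∑ₗ-cong (λ x → ∑ₗ-map f (x ∷_) (listsOfLength n i)) (upTo (suc n)))

∑ₗ-smallLists : ∀ n f → ∑ₗ f (smallLists n) ≡ sumTo n (λ i → ∑ₗ f (listsOfLength n i))
∑ₗ-smallLists n f = trans (∑ₗ-concatMap f (listsOfLength n) (upTo (suc n))) (∑ₗ-upTo _ n)

∑ₗ-candidates : ∀ n f → ∑ₗ f (candidates n) ≡
  sumTo n (λ D → sumTo n (λ i → sumTo n (λ j → ∑ₗ (λ as → ∑ₗ (λ bs → f (D , as , bs)) (listsOfLength n j)) (listsOfLength n i))))
∑ₗ-candidates n f = trans (∑ₗ-concatMap f withD (upTo (suc n))) (trans (∑ₗ-upTo (λ D → ∑ₗ f (withD D)) n) (sumTo-cong n λ D →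
  trans (∑ₗ-concatMap f (withTop D) (smallLists n)) (trans (∑ₗ-smallLists n (λ as → ∑ₗ f (withTop D as))) (sumTo-cong n λ i →
    trans (∑ₗ-cong (λ as → trans (∑ₗ-map f (λ bs → D , as , bs) (smallLists n)) (∑ₗ-smallLists n (λ bs → f (D , as , bs)))) (listsOfLength n i))
          (∑ₗ-sumTo n (λ as j → ∑ₗ (λ bs → f (D , as , bs)) (listsOfLength n j)) (listsOfLength n i))))))
  where
  withTop : ℕ → List ℕ → List Symbol
  withTop D as = map (λ bs → D , as , bs) (smallLists n)
  withD : ℕ → List Symbol
  withD D = concatMap (withTop D) (smallLists n)

ind-X : ∀ n e → ind (n ≟ e) ≡ X e n
ind-X n e = go (n ≟ e)
  where
  go : (d : Dec (n ≡ e)) → ind d ≡ X e n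
  go (yes refl) = sym (X-on n)
  go (no n≢e)   = sym (X-off e n n≢e)

module SymbolSum (w : ℤ → ℤ) (n : ℕ) where

  open Rows n

  weight : Symbol → ℤ
  weight σ = ind (isOddDurfeeSymbol? n σ) *ᶻ w (oddRank σ)

  coefficient : ∀ D as bs → ind (isOddDurfeeSymbol? n (D , as , bs)) ≡ (X (2 * D * D + 2 * D + 1) ⊛ (rowTerm D as ⊛ rowTerm D bs)) n
  coefficient D as bs = begin
    ind (isOddDurfeeSymbol? n (D , as , bs))
      ≡⟨ trans (ind-× (validRow? D as) (validRow? D bs ×-dec (n ≟ e))) (cong (valid D as *ᶻ_) (trans (ind-× (validRow? D bs) (n ≟ e)) (cong (valid D bs *ᶻ_) (ind-X n e)))) ⟩
    valid D as *ᶻ (valid D bs *ᶻ X e n)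
      ≡⟨ sym (trans (const-⊛ (valid D as) _ n) (cong (valid D as *ᶻ_) (const-⊛ (valid D bs) (X e) n))) ⟩
    (const (valid D as) ⊛ (const (valid D bs) ⊛ X e)) n
      ≡⟨ at (⊛-congˡ (⊛-congˡ (≈-trans (X-cong (lem (sum as) (sum bs) D)) (≈-sym (≈-trans (⊛-congˡ (X-+ (sum as) (sum bs))) (X-+ _ _)))))) n ⟩
    (const (valid D as) ⊛ (const (valid D bs) ⊛ (X (2 * D * D + 2 * D + 1) ⊛ (X (sum as) ⊛ X (sum bs))))) n
      ≡⟨ at (solve 5 (λ a b x y z → a :* (b :* (x :* (y :* z))) := x :* ((a :* y) :* (b :* z))) ≈-refl
           (const (valid D as)) (const (valid D bs)) (X (2 * D * D + 2 * D + 1)) (X (sum as)) (X (sum bs))) n ⟩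
    (X (2 * D * D + 2 * D + 1) ⊛ (rowTerm D as ⊛ rowTerm D bs)) n ∎
    where
    open ≡-Reasoning
    e : ℕ
    e = sum as + sum bs + 2 * D * D + 2 * D + 1
    lem : ∀ a b D → a + b + 2 * D * D + 2 * D + 1 ≡ 2 * D * D + 2 * D + 1 + (a + b)
    lem = ℕR.solve-∀

  block : ∀ D i j → ∑ₗ (λ as → ∑ₗ (λ bs → weight (D , as , bs)) (listsOfLength n j)) (listsOfLength n i) ≡
                    w (+ i -ᶻ + j) *ᶻ symbolSeries D i j n
  block D i j = begin
    ∑ₗ (λ as → ∑ₗ (λ bs → weight (D , as , bs)) Lj) Li
      ≡⟨ ∑ₗ-cong (λ as → ∑ₗ-length n j (λ l bs → ind (isOddDurfeeSymbol? n (D , as , bs)) *ᶻ w (+ length as -ᶻ + l))) Li ⟩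
    ∑ₗ (λ as → ∑ₗ (λ bs → ind (isOddDurfeeSymbol? n (D , as , bs)) *ᶻ w (+ length as -ᶻ + j)) Lj) Li
      ≡⟨ ∑ₗ-length n i (λ l as → ∑ₗ (λ bs → ind (isOddDurfeeSymbol? n (D , as , bs)) *ᶻ w (+ l -ᶻ + j)) Lj) ⟩
    ∑ₗ (λ as → ∑ₗ (λ bs → ind (isOddDurfeeSymbol? n (D , as , bs)) *ᶻ w (+ i -ᶻ + j)) Lj) Li
      ≡⟨ ∑ₗ-cong (λ as → trans (∑ₗ-cong (λ bs → trans (ℤP.*-comm _ (w (+ i -ᶻ + j))) (cong (w (+ i -ᶻ + j) *ᶻ_) (coefficient D as bs))) Lj)
           (∑ₗ-*ˡ (w (+ i -ᶻ + j)) _ Lj)) Li ⟩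
    ∑ₗ (λ as → w (+ i -ᶻ + j) *ᶻ ∑ₗ (λ bs → (Q ⊛ (rowTerm D as ⊛ rowTerm D bs)) n) Lj) Li
      ≡⟨ ∑ₗ-*ˡ (w (+ i -ᶻ + j)) _ Li ⟩
    w (+ i -ᶻ + j) *ᶻ ∑ₗ (λ as → ∑ₗ (λ bs → (Q ⊛ (rowTerm D as ⊛ rowTerm D bs)) n) Lj) Li
      ≡⟨ cong (w (+ i -ᶻ + j) *ᶻ_) (trans (∑ₗ-cong (λ as → sym (∑ˢ-at _ Lj n)) Li) (trans (sym (∑ˢ-at _ Li n)) (trans (at product n) replace))) ⟩
    w (+ i -ᶻ + j) *ᶻ symbolSeries D i j n ∎
    where
    open ≡-Reasoning
    Li Lj : List (List ℕ)
    Li = listsOfLength n i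
    Lj = listsOfLength n j
    Q : Series
    Q = X (2 * D * D + 2 * D + 1)
    product : ∑ˢ (λ as → ∑ˢ (λ bs → Q ⊛ (rowTerm D as ⊛ rowTerm D bs)) Lj) Li ≈ Q ⊛ (rowPoly D i ⊛ rowPoly D j)
    product = ≈-trans (∑ˢ-cong (λ as → ≈-trans (∑ˢ-⊛ˡ Q (λ bs → rowTerm D as ⊛ rowTerm D bs) Lj) (⊛-congˡ (∑ˢ-⊛ˡ (rowTerm D as) (rowTerm D) Lj))) Li)
      (≈-trans (∑ˢ-⊛ˡ Q (λ as → rowTerm D as ⊛ rowPoly D j) Li) (⊛-congˡ (∑ˢ-⊛ʳ (rowPoly D j) (rowTerm D) Li)))
    replace : (Q ⊛ (rowPoly D i ⊛ rowPoly D j)) n ≡ symbolSeries D i j n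
    replace = ⊛-cong[] {Q} n (λ _ _ → refl) (⊛-cong[] {rowPoly D i} n (rowPoly≈ i D) (rowPoly≈ j D)) n ≤-refl

  symbol-sum : ∑ₗ (λ σ → w (oddRank σ)) (filter (isOddDurfeeSymbol? n) (candidates n)) ≡ (X 1 ⊛ weighted w φ) n
  symbol-sum = trans (∑ₗ-filter (isOddDurfeeSymbol? n) (λ σ → w (oddRank σ)) (candidates n))
    (trans (∑ₗ-candidates n weight)
    (trans (sumTo-cong n λ D → sumTo-cong n λ i → sumTo-cong n λ j → block D i j)
           (sym (Resum.total-at w n))))

congruent : ℤ → ℤ → ℤ
congruent a m = ind (m %ℕ 8 ≟ a %ℕ 8)

N0-series : ∀ a n → + N0 a 8 n ≡ (X 1 ⊛ weighted (congruent a) φ) n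
N0-series a n = trans (length-filter (λ σ → oddRank σ %ℕ 8 ≟ a %ℕ 8) (filter (isOddDurfeeSymbol? n) (candidates n)))
  (SymbolSum.symbol-sum (congruent a) n)

below-8 : (Q : ℕ → Set) → Q 0 → Q 1 → Q 2 → Q 3 → Q 4 → Q 5 → Q 6 → Q 7 → ∀ r → r < 8 → Q r
below-8 Q q₀ q₁ q₂ q₃ q₄ q₅ q₆ q₇ = λ where
  0 _ → q₀
  1 _ → q₁
  2 _ → q₂
  3 _ → q₃
  4 _ → q₄
  5 _ → q₅
  6 _ → q₆
  7 _ → q₇
  (suc (suc (suc (suc (suc (suc (suc (suc _)))))))) (s≤s (s≤s (s≤s (s≤s (s≤s (s≤s (s≤s (s≤s ()))))))))

neg₈ : ℕ → ℕ
neg₈ zero    = 0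
neg₈ (suc r) = 8 ∸ suc r

-ᶻ-%ℕ8 : ∀ n → (-ᶻ (+ n)) %ℕ 8 ≡ neg₈ (n % 8)
-ᶻ-%ℕ8 zero = refl
-ᶻ-%ℕ8 (suc n) with suc n % 8
... | zero  = refl
... | suc r = refl

%ℕ8-abs : ∀ m → (m %ℕ 8 ≡ ∣ m ∣ % 8 × (-ᶻ m) %ℕ 8 ≡ neg₈ (∣ m ∣ % 8)) ⊎ (m %ℕ 8 ≡ neg₈ (∣ m ∣ % 8) × (-ᶻ m) %ℕ 8 ≡ ∣ m ∣ % 8)
%ℕ8-abs (+ n)    = inj₁ (refl , -ᶻ-%ℕ8 n)
%ℕ8-abs -[1+ n ] = inj₂ (-ᶻ-%ℕ8 (suc n) , refl)

anti-%8 : ∀ (w : ℕ → ℤ) → (∀ n → w (4 + n) ≡ -ᶻ w n) → ∀ n → w n ≡ w (n % 8)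
anti-%8 w p n = trans (cong w (trans (DivMod.m≡m%n+[m/n]*n n 8) (+-comm (n % 8) _))) (go (n / 8) (n % 8))
  where
  go : ∀ k r → w (k * 8 + r) ≡ w r
  go zero    r = refl
  go (suc k) r = trans (p (4 + (k * 8 + r))) (trans (cong -ᶻ_ (p (k * 8 + r))) (trans (ℤP.neg-involutive _) (go k r)))

w₀-congruent : ∀ m → congruent (+ 0) m -ᶻ congruent (+ 4) m ≡ w₀ m
w₀-congruent m = trans (by-residue (%ℕ8-abs m)) (sym (anti-%8 w₀ℕ (λ _ → refl) ∣ m ∣))
  where
  f : ℕ → ℤ
  f r = ind (r ≟ 0) -ᶻ ind (r ≟ 4)
  r<8 : ∣ m ∣ % 8 < 8
  r<8 = DivMod.m%n<n ∣ m ∣ 8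
  by-residue : _ → f (m %ℕ 8) ≡ w₀ℕ (∣ m ∣ % 8)
  by-residue (inj₁ (e , _)) = trans (cong f e) (below-8 (λ r → f r ≡ w₀ℕ r) refl refl refl refl refl refl refl refl (∣ m ∣ % 8) r<8)
  by-residue (inj₂ (e , _)) = trans (cong f e) (below-8 (λ r → f (neg₈ r) ≡ w₀ℕ r) refl refl refl refl refl refl refl refl (∣ m ∣ % 8) r<8)

v₁ : ℤ → ℤ
v₁ m = congruent (+ 1) m -ᶻ congruent (+ 3) m

w₁-congruent : ∀ m → v₁ m +ᶻ v₁ (-ᶻ m) ≡ w₁ m
w₁-congruent m = trans (by-residue (%ℕ8-abs m)) (sym (anti-%8 w₁ℕ (λ _ → refl) ∣ m ∣))
  where
  f : ℕ → ℤ
  f r = ind (r ≟ 1) -ᶻ ind (r ≟ 3)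
  r<8 : ∣ m ∣ % 8 < 8
  r<8 = DivMod.m%n<n ∣ m ∣ 8
  by-residue : _ → f (m %ℕ 8) +ᶻ f ((-ᶻ m) %ℕ 8) ≡ w₁ℕ (∣ m ∣ % 8)
  by-residue (inj₁ (d , e)) = trans (cong₂ (λ x y → f x +ᶻ f y) d e) (below-8 (λ r → f r +ᶻ f (neg₈ r) ≡ w₁ℕ r) refl refl refl refl refl refl refl refl (∣ m ∣ % 8) r<8)
  by-residue (inj₂ (d , e)) = trans (cong₂ (λ x y → f x +ᶻ f y) d e) (below-8 (λ r → f (neg₈ r) +ᶻ f r ≡ w₁ℕ r) refl refl refl refl refl refl refl refl (∣ m ∣ % 8) r<8)

weighted-cong : ∀ {w w′} u → (∀ m → w m ≡ w′ m) → weighted w u ≈ weighted w′ u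
weighted-cong {w} {w′} u e = ∑-cong (weightedFam w u) (weightedFam w′ u) λ m → ⊛-cong (≡⇒≈ (cong const (e m))) ≈-refl

weighted-+ : ∀ w w′ u → weighted (λ m → w m +ᶻ w′ m) u ≈ weighted w u ⊕ weighted w′ u
weighted-+ w w′ u = ∑-⊕ (weightedFam (λ m → w m +ᶻ w′ m) u) (weightedFam w u) (weightedFam w′ u) λ m →
  ≈-trans (⊛-cong (const-+ _ _) ≈-refl) (⊛-distribʳ _ _ _)

weighted-neg : ∀ w u → weighted (λ m → -ᶻ w m) u ≈ ⊝ weighted w u
weighted-neg w u = ∑-⊝ (weightedFam (λ m → -ᶻ w m) u) (weightedFam w u) λ m →
  ≈-trans (⊛-cong (const-neg (w m)) ≈-refl) (solve 2 (λ a b → (:- a) :* b := :- (a :* b)) ≈-refl (const (w m)) (hat u m))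

weighted-reflect : ∀ w u → weighted (λ m → w (-ᶻ m)) u ≈ weighted w u
weighted-reflect w u = ∑-reflect (weightedFam (λ m → w (-ᶻ m)) u) (weightedFam w u) λ m → ⊛-congˡ (≈-sym (hat-even u m))

X1-at : ∀ f n → (X 1 ⊛ f) (suc n) ≡ f n
X1-at f n = X-⊛-≥ 1 f n

N0-difference : ∀ a b n → + N0 a 8 (suc n) -ᶻ + N0 b 8 (suc n) ≡ weighted (λ m → congruent a m -ᶻ congruent b m) φ n
N0-difference a b n = trans (cong₂ _-ᶻ_ (trans (N0-series a (suc n)) (X1-at _ n)) (trans (N0-series b (suc n)) (X1-at _ n)))
  (sym (trans (at (≈-trans (weighted-+ (congruent a) (λ m → -ᶻ congruent b m) φ) (⊕-congˡ (weighted-neg (congruent b) φ))) n)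
    (trans (⊕-at _ _ n) (cong (weighted (congruent a) φ n +ᶻ_) (⊝-at _ n)))))

N0-difference₀₄ : ∀ n → + N0 (+ 0) 8 (suc n) -ᶻ + N0 (+ 4) 8 (suc n) ≡ A₀ n
N0-difference₀₄ n = trans (N0-difference (+ 0) (+ 4) n) (at (weighted-cong φ w₀-congruent) n)

N0-difference₁₃ : ∀ n → + 2 *ᶻ (+ N0 (+ 1) 8 (suc n) -ᶻ + N0 (+ 3) 8 (suc n)) ≡ A₁ n
N0-difference₁₃ n = trans (cong (+ 2 *ᶻ_) (N0-difference (+ 1) (+ 3) n)) (trans (lem (weighted v₁ φ n))
  (trans (sym (⊕-at (weighted v₁ φ) (weighted v₁ φ) n)) (at double-v₁ n)))
  where
  lem : ∀ x → + 2 *ᶻ x ≡ x +ᶻ x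
  lem = ℤR.solve-∀
  double-v₁ : weighted v₁ φ ⊕ weighted v₁ φ ≈ A₁
  double-v₁ = ≈-trans (⊕-congˡ (≈-sym (weighted-reflect v₁ φ)))
    (≈-trans (≈-sym (weighted-+ v₁ (λ m → v₁ (-ᶻ m)) φ)) (weighted-cong φ w₁-congruent))

residue : ∀ n r → (8 * n + r) % 8 ≡ r % 8
residue n r = trans (cong (_% 8) (trans (+-comm (8 * n) r) (cong (λ x → r + x) (*-comm 8 n)))) (DivMod.[m+kn]%n≡m%n r n 8)

N0-equal₀₄ : ∀ r → Van r A₀ → ∀ n → N0 (+ 0) 8 (8 * n + suc r) ≡ N0 (+ 4) 8 (8 * n + suc r)
N0-equal₀₄ r van n = subst (λ k → N0 (+ 0) 8 k ≡ N0 (+ 4) 8 k) (sym (+-suc (8 * n) r))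
  (ℤP.+-injective (ℤP.i-j≡0⇒i≡j _ _ (trans (N0-difference₀₄ (8 * n + r)) (van (8 * n + r) (residue n r)))))

N0-equal₁₃ : ∀ r → Van r A₁ → ∀ n → N0 (+ 1) 8 (8 * n + suc r) ≡ N0 (+ 3) 8 (8 * n + suc r)
N0-equal₁₃ r van n = subst (λ k → N0 (+ 1) 8 k ≡ N0 (+ 3) 8 k) (sym (+-suc (8 * n) r))
  (ℤP.+-injective (ℤP.i-j≡0⇒i≡j _ _ (half (trans (N0-difference₁₃ (8 * n + r)) (van (8 * n + r) (residue n r))))))
  where
  half : ∀ {x} → + 2 *ᶻ x ≡ + 0 → x ≡ + 0
  half {x} e with ℤP.i*j≡0⇒i≡0∨j≡0 (+ 2) e
  ... | inj₂ z = z

theorem1p8 : (n : ℕ) →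
    (N0 (+ 0) 8 (8 * n + 5) ≡ N0 (+ 4) 8 (8 * n + 5)) ×
    (N0 (+ 0) 8 (8 * n + 7) ≡ N0 (+ 4) 8 (8 * n + 7)) ×
    (N0 (+ 1) 8 (8 * n + 4) ≡ N0 (+ 3) 8 (8 * n + 4)) ×
    (N0 (+ 1) 8 (8 * n + 6) ≡ N0 (+ 3) 8 (8 * n + 6))
theorem1p8 n = N0-equal₀₄ 4 A₀-Van₄ n , N0-equal₀₄ 6 A₀-Van₆ n , N0-equal₁₃ 3 A₁-Van₃ n , N0-equal₁₃ 5 A₁-Van₅ n
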